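{- Let $n\ge 1$, $s\ge 0$ be integers, let $a_j=\binom{n+s-j}{n-j}$ for $0\le j\le n$, let $b_0,\dots,b_n$ be integers with $|b_0|=|b_n|=1$, and let $G(x)=\sum_{j=0}^n b_ja_j\frac{x^j}{j!}$. Let $k$ be an integer with $2\le k\le n/2$ and assume that $G(x)$ has a factor of degree $k$ over $\mathbb{Q}$. Then $s>92$ unless $$(n,k,s)\in\{(4,2,7),(4,2,23),(9,2,19),(9,2,47),(16,2,14),(16,2,34),(16,2,89),(9,3,47),(16,3,19),(10,5,4)\}.$$
   Context: Factors are taken in $\mathbb{Q}[x]$ and have positive degree. -}

module Defs where

open import Data.Nat as ℕ using (ℕ; zero; suc; _∸_; _!; _<_)
open import Data.Nat.Properties using (_!≢0)
open import Data.Nat.Combinatorics using (_C_)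
open import Data.Integer as ℤ using (ℤ; +_)
open import Data.Rational as ℚ using (ℚ; 0ℚ; _+_; _*_; _/_)
open import Data.Fin using (Fin; toℕ)
open import Data.List using (List; []; _∷_; map; tabulate)
open import Data.Product using (Σ; _×_)
open import Relation.Binary.PropositionalEquality using (_≡_; _≢_)

-- Polynomials in ℚ[x] as coefficient lists, lowest degree first.
Poly : Set
Poly = List ℚ

coeff : Poly → ℕ → ℚ
coeff []       _       = 0ℚ
coeff (a ∷ p)  zero    = a
coeff (a ∷ p)  (suc i) = coeff p i

_+ₚ_ : Poly → Poly → Poly
[]      +ₚ q       = q
(a ∷ p) +ₚ []      = a ∷ p
(a ∷ p) +ₚ (b ∷ q) = (a + b) ∷ (p +ₚ q)

_*ₚ_ : Poly → Poly → Poly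
[]      *ₚ q = []
(a ∷ p) *ₚ q = map (a *_) q +ₚ (0ℚ ∷ (p *ₚ q))

-- equality of polynomials (representations may differ by trailing zeros)
_≈ₚ_ : Poly → Poly → Set
p ≈ₚ q = ∀ i → coeff p i ≡ coeff q i

HasDegree : Poly → ℕ → Set
HasDegree p k = (coeff p k ≢ 0ℚ) × (∀ i → k < i → coeff p i ≡ 0ℚ)

_∣ₚ_ : Poly → Poly → Set
f ∣ₚ g = Σ Poly (λ h → (f *ₚ h) ≈ₚ g)

HasFactorOfDegree : Poly → ℕ → Set
HasFactorOfDegree g k = Σ Poly (λ f → HasDegree f k × f ∣ₚ g)

aCoef : ℕ → ℕ → ℕ → ℕ
aCoef n s j = (n ℕ.+ s ∸ j) C (n ∸ j)

G : (n s : ℕ) → (Fin (suc n) → ℤ) → Poly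
G n s b = tabulate (λ j → let instance _ = toℕ j !≢0 in
  (b j ℤ.* + aCoef n s (toℕ j)) / (toℕ j !))

-- exceptional triples (n , k , s)
exceptions : List (ℕ × ℕ × ℕ)
exceptions =
  (4 , 2 , 7) ∷ (4 , 2 , 23) ∷ (9 , 2 , 19) ∷ (9 , 2 , 47) ∷ (16 , 2 , 14) ∷
  (16 , 2 , 34) ∷ (16 , 2 , 89) ∷ (9 , 3 , 47) ∷ (16 , 3 , 19) ∷ (10 , 5 , 4) ∷ []
  where open import Data.Product using (_,_)

{-# OPTIONS --safe #-}
module Submission where

-- Multiplied by n!, the polynomial G has the integral coefficients bⱼ cⱼ, where cⱼ = C(n+s-j, n-j) (j+1)⋯n. A factor of
-- degree k cuts out a piece of width k of every p-adic Newton polygon. As |b₀| = |bₙ| = 1, the polygon is controlled from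
-- its two ends, and such a piece is impossible if p > k divides n - l for some l < k, or p ^ e > k divides n, unless p
-- divides C(n+s, s). By Kummer and Lucas this forces p ≤ s + l, respectively p ^ e ≤ s, and carries between n and s in base p.
--
-- For s ≤ 92, all prime factors of n(n-1)⋯(n-k+1) are therefore at most k + 91. If k > 45, this is refuted in the manner
-- of Sylvester and Erdős: C(n, k) ≤ n ^ π(k+91) bounds n, and the remaining n lie close above a number with a large prime
-- factor. If k ≤ 45, then n is 92-smooth with bounded prime powers, and its primes p > k restrict n modulo p²; a
-- depth-first search with the Chinese remainder theorem lists the candidates, which are eliminated by explicit polygons.
-- Only (10, 5, 5) among the survivors is not an exception; its polygon at 3 depends on whether 3 divides b₁.

open import Defs
open import Agda.Builtin.Nat using (mod-helper; div-helper)
open import Data.Nat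
open import Data.Nat.Properties
open import Data.Nat.Divisibility
open import Data.Nat.DivMod using (m%n<n; m≡m%n+[m/n]*n; m/n*n≡m; %-distribˡ-*; [m+kn]%n≡m%n)
open import Data.Nat.Primality hiding (prime)
open import Data.Nat.Primality.Factorisation using (factorise)
open import Data.Nat.Combinatorics using (_C_; nCk≡n!/k![n-k]!; k![n∸k]!∣n!; nCn≡1)
open import Data.Nat.Induction using (<-wellFounded)
open import Data.Nat.ListAction using (product)
open import Data.Nat.Tactic.RingSolver using (solve-∀)
open import Data.Integer as ℤ using (ℤ; 0ℤ; ∣_∣)
import Data.Integer.Properties as ℤ
import Data.Integer.Divisibility.Signed as ℤˢ
open import Data.Rational as ℚ using (ℚ; 0ℚ; ↥_; ↧ₙ_) renaming (_/_ to _/ℚ_)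
import Data.Rational.Properties as ℚ
import Data.Rational.Unnormalised as ℚᵘ
import Data.Rational.Unnormalised.Properties as ℚᵘ
open import Data.Rational.Literals using (fromℤ)
open import Data.Bool using (Bool; true; false; _∧_; _∨_; not; if_then_else_; T)
open import Data.Fin using (Fin; toℕ; fromℕ; fromℕ<) renaming (zero to fzero; suc to fsuc)
open import Data.Fin.Properties using (toℕ-fromℕ<; fromℕ-def)
open import Data.List using (List; []; _∷_; map; tabulate; length)
open import Data.List.Membership.Propositional using (_∈_)
open import Data.List.Relation.Unary.All using ([]; _∷_)
open import Data.List.Relation.Unary.Any using (here; there)
open import Data.Maybe using (Maybe; just; nothing)
open import Data.Product using (Σ; ∃; _×_; _,_; proj₁; proj₂)
open import Data.Sum using (_⊎_; inj₁; inj₂; [_,_]′)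
open import Data.Empty using (⊥; ⊥-elim)
open import Data.Unit using (tt)
open import Function using (_∘_)
open import Induction.WellFounded using (Acc; acc)
open import Relation.Nullary using (¬_; Dec; yes; no; contradiction)
open import Relation.Nullary.Decidable using (¬?; from-yes; from-no)
open import Relation.Binary.PropositionalEquality
open import Relation.Binary.Definitions using (tri<; tri≈; tri>)

-- The integers b are arbitrary, so the valuations of the inner coefficients of n! G are bounded
-- only from below and no Newton polygon is known completely. Every exclusion therefore takes one
-- form, `noFactor`: outside a few coefficients, all points lie strictly above a line of one slope
-- at the right end and above a line of another slope at the left end. A factor of degree k then has
-- a piece of width d ≤ k and drop u with a₁ / q₁ < u / d < a₂ / q₂, and the slopes are chosen so
-- that no such fraction exists.
--
-- Degrees up to 30 are out of reach of counting, as there are at least k primes up to k + 91. There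
-- n is known only to divide a fixed product of prime powers, which has far too many divisors to
-- list. The primes p > k make the search feasible: such a p contributes just p to n but fixes n
-- modulo p² to at most 92 / p classes, so the modulus soon outgrows the bound on n.
--
-- Primes are counted by sieving with 2, 3, 5 and 7 only; the density 48/210 < 1/4 is what the
-- estimates beyond k = 4096 rest on.

prime≥2 : ∀ {p} → Prime p → 2 ≤ p
prime≥2 {0} pp = contradiction pp ¬prime[0]
prime≥2 {1} pp = contradiction pp ¬prime[1]
prime≥2 {suc (suc _)} _ = s≤s (s≤s z≤n)

primeDivisor : ∀ {m} → 2 ≤ m → ∃ λ p → Prime p × p ∣ m
primeDivisor {suc m} 2≤m with factorise (suc m)
... | record { factors = [] ; isFactorisation = eq ; factorsPrime = _ } =
  contradiction (subst (2 ≤_) eq 2≤m) λ { (s≤s ()) }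
... | record { factors = p ∷ ps ; isFactorisation = eq ; factorsPrime = pp ∷ _ } =
  p , pp , subst (p ∣_) (sym eq) (m∣m*n (product ps))

∣⇒≤′ : ∀ {d x} → 0 < x → d ∣ x → d ≤ x
∣⇒≤′ {x = suc _} _ = ∣⇒≤

≢0⇒0< : ∀ {x} → x ≢ 0 → 0 < x
≢0⇒0< = n≢0⇒n>0

-- Exact powers of a prime

infix 4 _^_∥_

-- A relation instead of a valuation function: it fails for every e when x = 0, so that vanishing
-- coefficients, whose valuation is infinite, never enter a minimum.
record _^_∥_ (p e x : ℕ) : Set where
  constructor exactly
  field
    cofactor : ℕ
    equality : x ≡ p ^ e * cofactor
    coprime  : p ∤ cofactor

∤-* : ∀ {p} → Prime p → ∀ {x y} → p ∤ x → p ∤ y → p ∤ x * y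
∤-* pp {x} {y} p∤x p∤y d∣ with euclidsLemma x y pp d∣
... | inj₁ a = p∤x a
... | inj₂ b = p∤y b

module _ {p} (pp : Prime p) where

  private
    instance
      _ = prime⇒nonZero pp

  p∤1 : p ∤ 1
  p∤1 p∣1 with prime≥2 pp | ∣1⇒≡1 p∣1
  ... | s≤s () | refl

  ∥-* : ∀ {d e x y} → p ^ d ∥ x → p ^ e ∥ y → p ^ (d + e) ∥ x * y
  ∥-* {d} {e} (exactly v refl p∤v) (exactly w refl p∤w) = exactly (v * w)
    (trans ([m*n]*[o*p]≡[m*o]*[n*p] (p ^ d) v (p ^ e) w) (cong (_* (v * w)) (sym (^-distribˡ-+-* p d e))))
    (∤-* pp p∤v p∤w)

  ∤⇒∥ : ∀ {x} → p ∤ x → p ^ 0 ∥ x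
  ∤⇒∥ {x} p∤x = exactly x (sym (*-identityˡ x)) p∤x

  ∥-p^ : ∀ e → p ^ e ∥ p ^ e
  ∥-p^ e = exactly 1 (sym (*-identityʳ _)) p∤1

  ∥⇒∣ : ∀ {e x v} → p ^ e ∥ x → v ≤ e → p ^ v ∣ x
  ∥⇒∣ {e} {x} {v} (exactly w refl _) v≤e =
    ∣m⇒∣m*n w (subst (p ^ v ∣_) (trans (sym (^-distribˡ-+-* p v (e ∸ v))) (cong (p ^_) (m+[n∸m]≡n v≤e))) (m∣m*n (p ^ (e ∸ v))))

  ∥⇒≤ : ∀ {e x v} → p ^ e ∥ x → p ^ v ∣ x → v ≤ e
  ∥⇒≤ {e} {x} {v} (exactly w refl p∤w) d∣ with v ≤? e
  ... | yes v≤e = v≤e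
  ... | no v≰e = contradiction
    (*-cancelˡ-∣ (p ^ e) {{m^n≢0 p e}} (∣-trans (subst (_∣ p ^ v) (*-comm p (p ^ e)) (p^suc∣ (≰⇒> v≰e))) d∣)) p∤w
    where
    p^suc∣ : ∀ {d} → suc d ≤ v → p ^ suc d ∣ p ^ v
    p^suc∣ {d} le = subst (p ^ suc d ∣_) (trans (sym (^-distribˡ-+-* p (suc d) (v ∸ suc d))) (cong (p ^_) (m+[n∸m]≡n le))) (m∣m*n (p ^ (v ∸ suc d)))

  ∥-unique : ∀ {d e x} → p ^ d ∥ x → p ^ e ∥ x → d ≡ e
  ∥-unique a b = ≤-antisym (∥⇒≤ b (∥⇒∣ a ≤-refl)) (∥⇒≤ a (∥⇒∣ b ≤-refl))

  ∥-exists : ∀ {x} → x ≢ 0 → ∃ λ e → p ^ e ∥ x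
  ∥-exists {x} = go (<-wellFounded x)
    where
    go : ∀ {x} → Acc _<_ x → x ≢ 0 → ∃ λ e → p ^ e ∥ x
    go {x} (acc rec) x≢0 with p ∣? x
    ... | no p∤x = 0 , ∤⇒∥ p∤x
    ... | yes (divides q refl) with go {q} (rec (subst (q <_) (*-comm p q)
            (m<n*m' q≢0))) q≢0
      where
      q≢0 : q ≢ 0
      q≢0 refl = x≢0 refl
      m<n*m' : q ≢ 0 → q < p * q
      m<n*m' ne = subst (_< p * q) (*-identityˡ q) (*-monoˡ-< q {{≢-nonZero ne}} (prime≥2 pp))
    ... | e , exactly w refl p∤w = suc e , exactly w (trans (*-comm _ p) (sym (*-assoc p (p ^ e) w))) p∤w

-- Products of integer sequences and their valuations

conv : (ℕ → ℤ) → (ℕ → ℤ) → ℕ → ℤ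
conv F H zero    = F 0 ℤ.* H 0
conv F H (suc m) = F 0 ℤ.* H (suc m) ℤ.+ conv (F ∘ suc) H m

∣-+ℤ : ∀ {d} x y → d ∣ ∣ x ∣ → d ∣ ∣ y ∣ → d ∣ ∣ x ℤ.+ y ∣
∣-+ℤ {d} x y d∣x d∣y = ℤˢ.∣⇒∣ᵤ {ℤ.+ d} (ℤˢ.∣m∣n⇒∣m+n {ℤ.+ d} {x} {y} (ℤˢ.∣ᵤ⇒∣ d∣x) (ℤˢ.∣ᵤ⇒∣ d∣y))

∣-+ˡℤ : ∀ {d} x y → d ∣ ∣ x ℤ.+ y ∣ → d ∣ ∣ x ∣ → d ∣ ∣ y ∣
∣-+ˡℤ {d} x y d∣s d∣x = ℤˢ.∣⇒∣ᵤ {ℤ.+ d} (ℤˢ.∣m+n∣m⇒∣n {ℤ.+ d} {x} {y} (ℤˢ.∣ᵤ⇒∣ d∣s) (ℤˢ.∣ᵤ⇒∣ d∣x))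

conv-∣ : ∀ {d} F H m → (∀ i j → i + j ≡ m → d ∣ ∣ F i ℤ.* H j ∣) → d ∣ ∣ conv F H m ∣
conv-∣ F H zero    all = all 0 0 refl
conv-∣ F H (suc m) all = ∣-+ℤ (F 0 ℤ.* H (suc m)) _ (all 0 (suc m) refl)
  (conv-∣ (F ∘ suc) H m λ i j eq → all (suc i) j (cong suc eq))

-- If d divides a sum and all terms but one, it divides the last. For d = 0 divisibility means
-- vanishing, which later serves to find the degree of a product.
conv-∣-single : ∀ {d} F H i₀ j₀ → (∀ i j → i + j ≡ i₀ + j₀ → i ≢ i₀ → d ∣ ∣ F i ℤ.* H j ∣) →
  d ∣ ∣ conv F H (i₀ + j₀) ∣ → d ∣ ∣ F i₀ ℤ.* H j₀ ∣
conv-∣-single F H zero zero others d∣ = d∣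
conv-∣-single {d} F H zero (suc j₀) others d∣ =
  ∣-+ˡℤ (conv (F ∘ suc) H j₀) _ (subst (λ z → d ∣ ∣ z ∣) (ℤ.+-comm (F 0 ℤ.* H (suc j₀)) _) d∣)
    (conv-∣ (F ∘ suc) H j₀ λ i j eq → others (suc i) j (cong suc eq) λ ())
conv-∣-single F H (suc i₀) j₀ others d∣ =
  conv-∣-single (F ∘ suc) H i₀ j₀ (λ i j eq i≢ → others (suc i) j (cong suc eq) (i≢ ∘ suc-injective))
    (∣-+ˡℤ (F 0 ℤ.* H (suc (i₀ + j₀))) _ d∣ (others 0 (suc (i₀ + j₀)) refl λ ()))

argmin : ∀ {P : ℕ → Set} → (∀ i → Dec (P i)) → (κ : ℕ → ℕ) → ∀ D →
  (∀ i → i ≤ D → ¬ P i) ⊎ (∃ λ i₀ → i₀ ≤ D × P i₀ × (∀ i → i ≤ D → P i → κ i₀ ≤ κ i))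
argmin P? κ zero with P? 0
... | yes P0 = inj₂ (0 , z≤n , P0 , λ { .0 z≤n _ → ≤-refl })
... | no ¬P0 = inj₁ λ { .0 z≤n → ¬P0 }
argmin {P} P? κ (suc D) with argmin P? κ D | P? (suc D)
... | inj₁ none | no ¬P = inj₁ λ i i≤ → split i i≤
  where
  split : ∀ i → i ≤ suc D → ¬ P i
  split i i≤ with m≤n⇒m<n∨m≡n i≤
  ... | inj₁ (s≤s lt) = none i lt
  ... | inj₂ refl = ¬P
... | inj₁ none | yes P₁ = inj₂ (suc D , ≤-refl , P₁ , λ i i≤ Pi → split i i≤ Pi)
  where
  split : ∀ i → i ≤ suc D → P i → κ (suc D) ≤ κ i
  split i i≤ Pi with m≤n⇒m<n∨m≡n i≤
  ... | inj₁ (s≤s lt) = contradiction Pi (none i lt)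
  ... | inj₂ refl = ≤-refl
... | inj₂ (i₀ , i₀≤ , P₀ , min) | no ¬P = inj₂ (i₀ , m≤n⇒m≤1+n i₀≤ , P₀ , split)
  where
  split : ∀ i → i ≤ suc D → P i → κ i₀ ≤ κ i
  split i i≤ Pi with m≤n⇒m<n∨m≡n i≤
  ... | inj₁ (s≤s lt) = min i lt Pi
  ... | inj₂ refl = contradiction Pi ¬P
... | inj₂ (i₀ , i₀≤ , P₀ , min) | yes P₁ with κ i₀ ≤? κ (suc D)
...   | yes le = inj₂ (i₀ , m≤n⇒m≤1+n i₀≤ , P₀ , split)
  where
  split : ∀ i → i ≤ suc D → P i → κ i₀ ≤ κ i
  split i i≤ Pi with m≤n⇒m<n∨m≡n i≤
  ... | inj₁ (s≤s lt) = min i lt Pi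
  ... | inj₂ refl = le
...   | no ¬le = inj₂ (suc D , ≤-refl , P₁ , split)
  where
  split : ∀ i → i ≤ suc D → P i → κ (suc D) ≤ κ i
  split i i≤ Pi with m≤n⇒m<n∨m≡n i≤
  ... | inj₁ (s≤s lt) = ≤-trans (<⇒≤ (≰⇒> ¬le)) (min i lt Pi)
  ... | inj₂ refl = ≤-refl

-- For y < T the number T x + y encodes the lexicographic order of pairs. This puts a weight and its
-- tie-break into one minimum, and also yields the uniqueness of quotients.
lex-≤ : ∀ {T x₀ y₀ x y} → y < T → T * x₀ + y₀ ≤ T * x + y → x₀ ≤ x
lex-≤ {T} {x₀} {y₀} {x} {y} y<T le = ≮⇒≥ λ x<x₀ → <⇒≱
  (begin-strict
    T * x + y   <⟨ +-monoʳ-< (T * x) y<T ⟩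
    T * x + T   ≡⟨ trans (+-comm (T * x) T) (sym (*-suc T x)) ⟩
    T * suc x   ≤⟨ *-monoʳ-≤ T x<x₀ ⟩
    T * x₀      ≤⟨ m≤m+n _ y₀ ⟩
    T * x₀ + y₀ ∎) le
  where open ≤-Reasoning

lex-< : ∀ {T x₀ y₀ x y} → y < y₀ → T * x₀ + y₀ ≤ T * x + y → x₀ < x
lex-< {T} y<y₀ le = ≰⇒> λ x≤x₀ → <⇒≱ (+-mono-≤-< (*-monoʳ-≤ T x≤x₀) y<y₀) le

∥⇒≢0 : ∀ {p e x} → Prime p → p ^ e ∥ x → x ≢ 0
∥⇒≢0 {p} {e} pp (exactly w eq p∤w) refl with m*n≡0⇒m≡0∨n≡0 (p ^ e) (sym eq)
... | inj₂ refl = p∤w (p ∣0)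
... | inj₁ z = ≢-nonZero⁻¹ (p ^ e) {{m^n≢0 p e {{prime⇒nonZero pp}}}} z

module _ {p} (pp : Prime p) where

  val : ℤ → ℕ
  val z with ∣ z ∣ ≟ 0
  -- A default value; only nonzero integers are ever measured.
  ... | yes _   = 0
  ... | no z≢0 = proj₁ (∥-exists pp z≢0)

  val-∥ : ∀ z → ∣ z ∣ ≢ 0 → p ^ val z ∥ ∣ z ∣
  val-∥ z ne with ∣ z ∣ ≟ 0
  ... | yes eq = contradiction eq ne
  ... | no z≢0 = proj₂ (∥-exists pp z≢0)

  record Extremal (q a : ℕ) (ρ : ℕ → ℕ) (F : ℕ → ℤ) (D : ℕ) : Set where
    field
      i₀ e₀   : ℕ
      i₀≤     : i₀ ≤ D
      exact   : p ^ e₀ ∥ ∣ F i₀ ∣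
      minimal : ∀ {i e} → p ^ e ∥ ∣ F i ∣ → q * e₀ + a * i₀ ≤ q * e + a * i
      strict  : ∀ {i e} → p ^ e ∥ ∣ F i ∣ → ρ i < ρ i₀ → q * e₀ + a * i₀ < q * e + a * i

  -- Of two indices of equal weight the one with smaller ρ wins, so an index that ρ prefers but that
  -- lost has strictly larger weight; this is the field `strict`.
  extremal : ∀ q a ρ (F : ℕ → ℤ) D → (∀ i → i ≤ D → ρ i ≤ D) →
    (∀ i → ∣ F i ∣ ≢ 0 → i ≤ D) → (∃ λ i → ∣ F i ∣ ≢ 0) → Extremal q a ρ F D
  extremal q a ρ F D ρ≤ supp (i₁ , ne) with argmin (λ i → ¬? (∣ F i ∣ ≟ 0)) (λ i → suc D * (q * val (F i) + a * i) + ρ i) D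
  ... | inj₁ none = contradiction ne (none i₁ (supp i₁ ne))
  ... | inj₂ (i₀ , i₀≤ , F₀ , min) = record
    { i₀ = i₀ ; e₀ = val (F i₀) ; i₀≤ = i₀≤ ; exact = val-∥ (F i₀) F₀
    ; minimal = λ {i} ex → lex-≤ {suc D} {y₀ = ρ i₀} (s≤s (ρ≤ i (i≤ ex))) (min′ ex)
    ; strict = λ ex lt → lex-< {suc D} lt (min′ ex) }
    where
    i≤ : ∀ {i e} → p ^ e ∥ ∣ F i ∣ → i ≤ D
    i≤ {i} ex = supp i (∥⇒≢0 pp ex)
    min′ : ∀ {i e} → p ^ e ∥ ∣ F i ∣ →
      suc D * (q * val (F i₀) + a * i₀) + ρ i₀ ≤ suc D * (q * e + a * i) + ρ i
    min′ {i} {e} ex = subst (λ z → _ ≤ suc D * (q * z + a * i) + ρ i)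
      (∥-unique pp (val-∥ (F i) (∥⇒≢0 pp ex)) ex) (min i (i≤ ex) (∥⇒≢0 pp ex))

  module Product
    (F H g : ℕ → ℤ) (N : ℤ) (N≢0 : ∣ N ∣ ≢ 0) (FH≡Ng : ∀ m → conv F H m ≡ N ℤ.* g m)
    (q-1 a : ℕ) where

    q = suc q-1
    ν = val N

    module _ (i₀ j₀ d₀ e₀ : ℕ) (Fᵢ : p ^ d₀ ∥ ∣ F i₀ ∣) (Hⱼ : p ^ e₀ ∥ ∣ H j₀ ∣)
      (Fmin : ∀ {i e} → p ^ e ∥ ∣ F i ∣ → q * d₀ + a * i₀ ≤ q * e + a * i)
      (Hmin : ∀ {i e} → p ^ e ∥ ∣ H i ∣ → q * e₀ + a * j₀ ≤ q * e + a * i)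
      (other : ∀ {i j d e} → i + j ≡ i₀ + j₀ → i ≢ i₀ → p ^ d ∥ ∣ F i ∣ → p ^ e ∥ ∣ H j ∣ →
        (q * d₀ + a * i₀) + (q * e₀ + a * j₀) < (q * d + a * i) + (q * e + a * j)) where

      private
        regroup : ∀ d i e j → (q * d + a * i) + (q * e + a * j) ≡ q * (d + e) + a * (i + j)
        regroup d i e j = lemma q a d i e j
          where
          lemma : ∀ q a d i e j → (q * d + a * i) + (q * e + a * j) ≡ q * (d + e) + a * (i + j)
          lemma = solve-∀

        term : ∀ i j {t} → (∀ {d e} → p ^ d ∥ ∣ F i ∣ → p ^ e ∥ ∣ H j ∣ → t ≤ d + e) → p ^ t ∣ ∣ F i ℤ.* H j ∣
        term i j {t} bound rewrite ℤ.abs-* (F i) (H j) with ∣ F i ∣ ≟ 0 | ∣ H j ∣ ≟ 0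
        ... | yes eq | _ rewrite eq = (p ^ t) ∣0
        ... | no _ | yes eq rewrite eq | *-zeroʳ (∣ F i ∣) = (p ^ t) ∣0
        ... | no F≢0 | no H≢0 with ∥-exists pp F≢0 | ∥-exists pp H≢0
        ...   | d , exd | e , exe = ∥⇒∣ pp (∥-* pp exd exe) (bound exd exe)

        cancel-q : ∀ {x y z} → q * x + z < q * y + z → x < y
        cancel-q {x} {y} {z} lt = *-cancelˡ-< q x y (+-cancelʳ-< z (q * x) (q * y) lt)

      -- By `other`, the pair (i₀, j₀) has strictly the least weight among the pairs of the same
      -- sum. Weights on such pairs differ only by valuations, so its term alone determines the
      -- valuation of the coefficient.
      no-more : ¬ p ^ suc (d₀ + e₀) ∣ ∣ conv F H (i₀ + j₀) ∣
      no-more d∣ = <-irrefl refl (∥⇒≤ pp (∥-* pp Fᵢ Hⱼ) (subst (p ^ suc (d₀ + e₀) ∣_) (ℤ.abs-* (F i₀) (H j₀))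
        (conv-∣-single F H i₀ j₀ (λ i j eq i≢ → term i j λ {d} {e} exd exe →
          cancel-q {z = a * (i₀ + j₀)} (subst₂ _<_ (regroup d₀ i₀ e₀ j₀)
            (trans (regroup d i e j) (cong (λ z → q * (d + e) + a * z) eq)) (other eq i≢ exd exe))) d∣)))

      -- The minimal weights of F and H add up to that of N g: were the weight at m* smaller, every
      -- term of that coefficient of F H would be too divisible. Of g only a divisor at i₀ + j₀ and
      -- a non-divisor at m* are used, because the b's leave exact valuations open.
      minimizer : ∀ {v m* v*} → p ^ v ∣ ∣ g (i₀ + j₀) ∣ → ¬ p ^ suc v* ∣ ∣ g m* ∣ →
        q * v + a * (i₀ + j₀) ≤ q * v* + a * m*
      minimizer {v} {m*} {v*} d∣ ¬d∣ = ≮⇒≥ λ lt → ¬d∣ (from-N (subst (λ z → p ^ suc (ν + v*) ∣ ∣ z ∣) (FH≡Ng m*)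
          (conv-∣ F H m* λ i j eq → term i j λ {d} {e} exd exe → cancel-q {z = a * m*} (begin-strict
            q * (ν + v*) + a * m*           ≡⟨ ring q ν v* (a * m*) ⟩
            q * ν + (q * v* + a * m*)       <⟨ +-monoʳ-< (q * ν) lt ⟩
            q * ν + (q * v + a * (i₀ + j₀)) ≡⟨ sym (ring q ν v (a * (i₀ + j₀))) ⟩
            q * (ν + v) + a * (i₀ + j₀)     ≤⟨ +-monoˡ-≤ (a * (i₀ + j₀)) (*-monoʳ-≤ q ν+v≤) ⟩
            q * (d₀ + e₀) + a * (i₀ + j₀)   ≡⟨ sym (regroup d₀ i₀ e₀ j₀) ⟩
            (q * d₀ + a * i₀) + (q * e₀ + a * j₀) ≤⟨ +-mono-≤ (Fmin exd) (Hmin exe) ⟩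
            (q * d + a * i) + (q * e + a * j) ≡⟨ trans (regroup d i e j) (cong (λ z → q * (d + e) + a * z) eq) ⟩
            q * (d + e) + a * m*            ∎))))
        where
        open ≤-Reasoning
        ring : ∀ q x y z → q * (x + y) + z ≡ q * x + (q * y + z)
        ring = solve-∀
        -- Otherwise N g would be more divisible at i₀ + j₀ than `no-more` permits.
        ν+v≤ : ν + v ≤ d₀ + e₀
        ν+v≤ = ≮⇒≥ λ lt → no-more (subst (λ z → p ^ suc (d₀ + e₀) ∣ ∣ z ∣) (sym (FH≡Ng (i₀ + j₀)))
          (subst (p ^ suc (d₀ + e₀) ∣_) (sym (ℤ.abs-* N (g (i₀ + j₀))))
          (∣-trans (p^∣p^ lt) (subst (_∣ ∣ N ∣ * ∣ g (i₀ + j₀) ∣) (sym (^-distribˡ-+-* p ν v))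
            (*-pres-∣ (∥⇒∣ pp (val-∥ N N≢0) ≤-refl) d∣)))))
          where
          p^∣p^ : ∀ {x y} → x ≤ y → p ^ x ∣ p ^ y
          p^∣p^ {x} {y} = ∥⇒∣ pp (∥-p^ pp y)
        from-N : p ^ suc (ν + v*) ∣ ∣ N ℤ.* g m* ∣ → p ^ suc v* ∣ ∣ g m* ∣
        from-N d∣ rewrite ℤ.abs-* N (g m*) with ∣ g m* ∣ ≟ 0
        ... | yes eq rewrite eq = (p ^ suc v*) ∣0
        ... | no ne with ∥-exists pp ne
        ...   | e , ex = ∥⇒∣ pp ex (+-cancelˡ-≤ ν (suc v*) e (subst (_≤ ν + e) (sym (+-suc ν v*))
                  (∥⇒≤ pp (∥-* pp (val-∥ N N≢0) ex) d∣)))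

-- From rational to integral factorisations

fromℤ-+ : ∀ x y → fromℤ (x ℤ.+ y) ≡ fromℤ x ℚ.+ fromℤ y
fromℤ-+ x y = ℚ.toℚᵘ-injective (ℚᵘ.≃-trans
  (ℚᵘ.*≡* (cong (ℤ._* ℤ.+ 1) (sym (cong₂ ℤ._+_ (ℤ.*-identityʳ x) (ℤ.*-identityʳ y)))))
  (ℚᵘ.≃-sym (ℚ.toℚᵘ-homo-+ (fromℤ x) (fromℤ y))))

fromℤ-* : ∀ x y → fromℤ (x ℤ.* y) ≡ fromℤ x ℚ.* fromℤ y
fromℤ-* x y = ℚ.toℚᵘ-injective (ℚᵘ.≃-sym (ℚ.toℚᵘ-homo-* (fromℤ x) (fromℤ y)))

fromℤ-injective : ∀ {x y} → fromℤ x ≡ fromℤ y → x ≡ y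
fromℤ-injective = cong ↥_

clear-denominator : ∀ a → a ℚ.* fromℤ (ℤ.+ ↧ₙ a) ≡ fromℤ (↥ a)
clear-denominator a@record{} = ℚ.toℚᵘ-injective (ℚᵘ.≃-trans (ℚ.toℚᵘ-homo-* a (fromℤ (ℤ.+ ↧ₙ a)))
  (ℚᵘ.*≡* (trans (ℤ.*-identityʳ _) (cong (λ z → ↥ a ℤ.* ℤ.+ z) (sym (*-identityʳ (↧ₙ a)))))))

/-clear : ∀ z d w .{{_ : NonZero d}} → (z /ℚ d) ℚ.* fromℤ (ℤ.+ (d * w)) ≡ fromℤ (z ℤ.* ℤ.+ w)
/-clear z d@(suc d-1) w = ℚ.toℚᵘ-injective (ℚᵘ.≃-trans (ℚ.toℚᵘ-homo-* (z /ℚ d) (fromℤ (ℤ.+ (d * w))))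
  (ℚᵘ.≃-trans (ℚᵘ.*-congʳ (ℚ.toℚᵘ-fromℚᵘ (ℚᵘ.mkℚᵘ z d-1))) (ℚᵘ.*≡* (begin
    (z ℤ.* ℤ.+ (d * w)) ℤ.* ℤ.+ 1     ≡⟨ ℤ.*-identityʳ _ ⟩
    z ℤ.* ℤ.+ (d * w)                 ≡⟨ cong (z ℤ.*_) (trans (cong ℤ.+_ (*-comm d w)) (ℤ.pos-* w d)) ⟩
    z ℤ.* (ℤ.+ w ℤ.* ℤ.+ d)           ≡⟨ sym (ℤ.*-assoc z (ℤ.+ w) (ℤ.+ d)) ⟩
    (z ℤ.* ℤ.+ w) ℤ.* ℤ.+ d           ≡⟨ cong (λ y → (z ℤ.* ℤ.+ w) ℤ.* ℤ.+ y) (sym (*-identityʳ d)) ⟩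
    (z ℤ.* ℤ.+ w) ℤ.* ℤ.+ (d * 1)     ∎))))
  where open ≡-Reasoning

convℚ : (ℕ → ℚ) → (ℕ → ℚ) → ℕ → ℚ
convℚ φ ψ zero    = φ 0 ℚ.* ψ 0
convℚ φ ψ (suc m) = φ 0 ℚ.* ψ (suc m) ℚ.+ convℚ (φ ∘ suc) ψ m

coeff-+ : ∀ p q i → coeff (p +ₚ q) i ≡ coeff p i ℚ.+ coeff q i
coeff-+ [] q i = sym (ℚ.+-identityˡ _)
coeff-+ (a ∷ p) [] i = sym (ℚ.+-identityʳ _)
coeff-+ (a ∷ p) (b ∷ q) zero = refl
coeff-+ (a ∷ p) (b ∷ q) (suc i) = coeff-+ p q i

coeff-scale : ∀ a q i → coeff (map (a ℚ.*_) q) i ≡ a ℚ.* coeff q i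
coeff-scale a [] i = sym (ℚ.*-zeroʳ a)
coeff-scale a (b ∷ q) zero = refl
coeff-scale a (b ∷ q) (suc i) = coeff-scale a q i

coeff-* : ∀ f h m → coeff (f *ₚ h) m ≡ convℚ (coeff f) (coeff h) m
coeff-* [] h zero = sym (ℚ.*-zeroˡ (coeff h 0))
coeff-* [] h (suc m) = sym (trans (cong₂ ℚ._+_ (ℚ.*-zeroˡ (coeff h (suc m))) (sym (coeff-* [] h m))) (ℚ.+-identityˡ 0ℚ))
coeff-* (a ∷ f) h zero = trans (coeff-+ (map (a ℚ.*_) h) (0ℚ ∷ (f *ₚ h)) 0)
  (trans (ℚ.+-identityʳ _) (coeff-scale a h 0))
coeff-* (a ∷ f) h (suc m) = trans (coeff-+ (map (a ℚ.*_) h) (0ℚ ∷ (f *ₚ h)) (suc m))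
  (cong₂ ℚ._+_ (coeff-scale a h (suc m)) (coeff-* f h m))

convℚ-clear : ∀ {φ ψ x y F H} → (∀ i → φ i ℚ.* x ≡ fromℤ (F i)) → (∀ i → ψ i ℚ.* y ≡ fromℤ (H i)) →
  ∀ m → convℚ φ ψ m ℚ.* (x ℚ.* y) ≡ fromℤ (conv F H m)
convℚ-clear {φ} {ψ} {x} {y} {F} {H} φF ψH = go φ F φF
  where
  interchange : ∀ a b c d → (a ℚ.* b) ℚ.* (c ℚ.* d) ≡ (a ℚ.* c) ℚ.* (b ℚ.* d)
  interchange a b c d = begin
    (a ℚ.* b) ℚ.* (c ℚ.* d) ≡⟨ ℚ.*-assoc a b (c ℚ.* d) ⟩
    a ℚ.* (b ℚ.* (c ℚ.* d)) ≡⟨ cong (a ℚ.*_) (sym (ℚ.*-assoc b c d)) ⟩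
    a ℚ.* ((b ℚ.* c) ℚ.* d) ≡⟨ cong (λ z → a ℚ.* (z ℚ.* d)) (ℚ.*-comm b c) ⟩
    a ℚ.* ((c ℚ.* b) ℚ.* d) ≡⟨ cong (a ℚ.*_) (ℚ.*-assoc c b d) ⟩
    a ℚ.* (c ℚ.* (b ℚ.* d)) ≡⟨ sym (ℚ.*-assoc a c (b ℚ.* d)) ⟩
    (a ℚ.* c) ℚ.* (b ℚ.* d) ∎
    where open ≡-Reasoning
  term : ∀ a z j → a ℚ.* x ≡ fromℤ z → (a ℚ.* ψ j) ℚ.* (x ℚ.* y) ≡ fromℤ (z ℤ.* H j)
  term a z j eq = trans (interchange a (ψ j) x y) (trans (cong₂ ℚ._*_ eq (ψH j)) (sym (fromℤ-* z (H j))))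
  go : ∀ φ F → (∀ i → φ i ℚ.* x ≡ fromℤ (F i)) → ∀ m → convℚ φ ψ m ℚ.* (x ℚ.* y) ≡ fromℤ (conv F H m)
  go φ F φF zero = term (φ 0) (F 0) 0 (φF 0)
  go φ F φF (suc m) = trans (ℚ.*-distribʳ-+ (x ℚ.* y) (φ 0 ℚ.* ψ (suc m)) (convℚ (φ ∘ suc) ψ m))
    (trans (cong₂ ℚ._+_ (term (φ 0) (F 0) (suc m) (φF 0)) (go (φ ∘ suc) (F ∘ suc) (φF ∘ suc) m))
      (sym (fromℤ-+ (F 0 ℤ.* H (suc m)) (conv (F ∘ suc) H m))))

clear-denominators : (f : Poly) → ∃ λ D → D ≢ 0 × Σ (ℕ → ℤ) λ F → ∀ i → coeff f i ℚ.* fromℤ (ℤ.+ D) ≡ fromℤ (F i)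
clear-denominators [] = 1 , (λ ()) , (λ _ → 0ℤ) , λ i → refl
clear-denominators (a ∷ f) with clear-denominators f
... | D , D≢0 , F , F≡ = ↧ₙ a * D , ne , F′ , F′≡
  where
  ne : ↧ₙ a * D ≢ 0
  ne eq with m*n≡0⇒m≡0∨n≡0 (↧ₙ a) eq
  ... | inj₂ z = D≢0 z
  split : ∀ x y → fromℤ (ℤ.+ (x * y)) ≡ fromℤ (ℤ.+ x) ℚ.* fromℤ (ℤ.+ y)
  split x y = trans (cong fromℤ (ℤ.pos-* x y)) (fromℤ-* (ℤ.+ x) (ℤ.+ y))
  F′ : ℕ → ℤ
  F′ zero    = ↥ a ℤ.* ℤ.+ D
  F′ (suc i) = F i ℤ.* ℤ.+ ↧ₙ a
  F′≡ : ∀ i → coeff (a ∷ f) i ℚ.* fromℤ (ℤ.+ (↧ₙ a * D)) ≡ fromℤ (F′ i)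
  F′≡ zero = trans (cong (λ z → a ℚ.* z) (split (↧ₙ a) D))
    (trans (sym (ℚ.*-assoc a (fromℤ (ℤ.+ ↧ₙ a)) (fromℤ (ℤ.+ D))))
    (trans (cong (ℚ._* fromℤ (ℤ.+ D)) (clear-denominator a)) (sym (fromℤ-* (↥ a) (ℤ.+ D)))))
  F′≡ (suc i) = trans (cong (λ z → coeff f i ℚ.* z) (trans (cong (λ z → fromℤ (ℤ.+ z)) (*-comm (↧ₙ a) D)) (split D (↧ₙ a))))
    (trans (sym (ℚ.*-assoc (coeff f i) (fromℤ (ℤ.+ D)) (fromℤ (ℤ.+ ↧ₙ a))))
    (trans (cong (ℚ._* fromℤ (ℤ.+ ↧ₙ a)) (F≡ i)) (sym (fromℤ-* (F i) (ℤ.+ ↧ₙ a)))))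

coeff-tabulate : ∀ {N} (h : Fin N → ℚ) i (lt : i < N) → coeff (tabulate h) i ≡ h (fromℕ< lt)
coeff-tabulate {suc N} h zero lt = refl
coeff-tabulate {suc N} h (suc i) (s≤s lt) = coeff-tabulate (h ∘ fsuc) i lt

coeff-tabulate-≥ : ∀ {N} (h : Fin N → ℚ) i → N ≤ i → coeff (tabulate h) i ≡ 0ℚ
coeff-tabulate-≥ {zero} h i N≤i = refl
coeff-tabulate-≥ {suc N} h (suc i) (s≤s N≤i) = coeff-tabulate-≥ (h ∘ fsuc) i N≤i

coeff-≥length : ∀ f i → length f ≤ i → coeff f i ≡ 0ℚ
coeff-≥length [] i _ = refl
coeff-≥length (a ∷ f) (suc i) (s≤s le) = coeff-≥length f i le

-- The product (n + 1)⋯(n + d), that is (n + d)!/n!. In this form factorials and binomials are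
-- compared without division.
asc : ℕ → ℕ → ℕ
asc n zero    = 1
asc n (suc d) = asc n d * (n + suc d)

asc-! : ∀ m d → m ! * asc m d ≡ (m + d) !
asc-! m zero rewrite +-identityʳ m = *-identityʳ (m !)
asc-! m (suc d) rewrite +-suc m d = begin
  m ! * (asc m d * suc (m + d)) ≡⟨ sym (*-assoc (m !) (asc m d) _) ⟩
  m ! * asc m d * suc (m + d)   ≡⟨ cong (_* suc (m + d)) (asc-! m d) ⟩
  (m + d) ! * suc (m + d)       ≡⟨ *-comm ((m + d) !) (suc (m + d)) ⟩
  suc (m + d) * (m + d) !       ∎
  where open ≡-Reasoning

cCoef : ℕ → ℕ → ℕ → ℕ
cCoef n s m = aCoef n s m * asc m (n ∸ m)

cCoef-top : ∀ n s → cCoef n s n ≡ 1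
cCoef-top n s rewrite n∸n≡0 n = refl

extend : ∀ {n} → (Fin (suc n) → ℤ) → ℕ → ℤ
extend {n} b m with m <? suc n
... | yes lt = b (fromℕ< lt)
... | no _   = 0ℤ

extend-> : ∀ {n} (b : Fin (suc n) → ℤ) {m} → n < m → extend b m ≡ 0ℤ
extend-> {n} b {m} n<m with m <? suc n
... | yes lt = contradiction n<m (<⇒≱ lt)
... | no _   = refl

extend-top : ∀ {n} (b : Fin (suc n) → ℤ) → extend b n ≡ b (fromℕ n)
extend-top {n} b with n <? suc n
... | yes lt = cong b (sym (fromℕ-def n))
... | no ¬lt = contradiction ≤-refl ¬lt

-- The coefficients of n! G.
gCoef : ∀ n s → (Fin (suc n) → ℤ) → ℕ → ℤ
gCoef n s b m = extend b m ℤ.* ℤ.+ cCoef n s m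

Gᵢ : ∀ n s → (Fin (suc n) → ℤ) → Fin (suc n) → ℚ
Gᵢ n s b j = _/ℚ_ (b j ℤ.* ℤ.+ aCoef n s (toℕ j)) (toℕ j !) {{toℕ j !≢0}}

G-clear : ∀ n s b m → coeff (G n s b) m ℚ.* fromℤ (ℤ.+ (n !)) ≡ fromℤ (gCoef n s b m)
G-clear n s b m with m <? suc n
... | no m≮ = trans (cong (ℚ._* fromℤ (ℤ.+ (n !))) (coeff-tabulate-≥ (Gᵢ n s b) m (≮⇒≥ m≮))) (ℚ.*-zeroˡ (fromℤ (ℤ.+ (n !))))
... | yes lt@(s≤s m≤n) = begin
  coeff (G n s b) m ℚ.* fromℤ (ℤ.+ (n !))
    ≡⟨ cong (ℚ._* fromℤ (ℤ.+ (n !))) (trans (coeff-tabulate (Gᵢ n s b) m lt) (at (toℕ-fromℕ< lt))) ⟩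
  (_/ℚ_ (b j ℤ.* ℤ.+ aCoef n s m) (m !) {{m !≢0}}) ℚ.* fromℤ (ℤ.+ (n !))
    ≡⟨ cong (λ z → _/ℚ_ (b j ℤ.* ℤ.+ aCoef n s m) (m !) {{m !≢0}} ℚ.* fromℤ (ℤ.+ z)) (sym (trans (asc-! m (n ∸ m)) (cong _! (m+[n∸m]≡n m≤n)))) ⟩
  (_/ℚ_ (b j ℤ.* ℤ.+ aCoef n s m) (m !) {{m !≢0}}) ℚ.* fromℤ (ℤ.+ (m ! * asc m (n ∸ m)))
    ≡⟨ /-clear (b j ℤ.* ℤ.+ aCoef n s m) (m !) (asc m (n ∸ m)) {{m !≢0}} ⟩
  fromℤ (b j ℤ.* ℤ.+ aCoef n s m ℤ.* ℤ.+ asc m (n ∸ m))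
    ≡⟨ cong fromℤ (trans (ℤ.*-assoc (b j) _ _) (cong (b j ℤ.*_) (sym (ℤ.pos-* (aCoef n s m) (asc m (n ∸ m)))))) ⟩
  fromℤ (b j ℤ.* ℤ.+ cCoef n s m) ∎
  where
  open ≡-Reasoning
  j = fromℕ< lt
  at : ∀ {i} → toℕ j ≡ i → _/ℚ_ (b j ℤ.* ℤ.+ aCoef n s (toℕ j)) (toℕ j !) {{toℕ j !≢0}} ≡ _/ℚ_ (b j ℤ.* ℤ.+ aCoef n s i) (i !) {{i !≢0}}
  at refl = refl

-- The common denominator N stays on the right: it shifts all valuations of g by the same amount,
-- which does not move the minimisers.
record Factorisation (n k : ℕ) (g : ℕ → ℤ) : Set where
  field
    F H     : ℕ → ℤ
    N       : ℤ
    N≢0     : ∣ N ∣ ≢ 0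
    FH≡Ng   : ∀ m → conv F H m ≡ N ℤ.* g m
    k≤n     : k ≤ n
    F-bound : ∀ i → ∣ F i ∣ ≢ 0 → i ≤ k
    F-top   : ∣ F k ∣ ≢ 0
    H-bound : ∀ j → ∣ H j ∣ ≢ 0 → j ≤ n ∸ k
    H-some  : ∃ λ j → ∣ H j ∣ ≢ 0

cancel-fromℤ : ∀ {a z x} → x ≢ 0 → a ℚ.* fromℤ (ℤ.+ x) ≡ fromℤ z → ∣ z ∣ ≡ 0 → a ≡ 0ℚ
cancel-fromℤ {a} {z} {x} x≢0 eq z≡0 = ℚ.≃⇒≡ (ℚ.*≡* (trans (ℤ.*-identityʳ (↥ a)) (trans ↥a≡0 (sym (ℤ.*-zeroˡ (ℤ.+ ↧ₙ a))))))
  where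
  num : ↥ a ℤ.* ℤ.+ x ≡ 0ℤ
  num = fromℤ-injective (begin
    fromℤ (↥ a ℤ.* ℤ.+ x)                                     ≡⟨ fromℤ-* (↥ a) (ℤ.+ x) ⟩
    fromℤ (↥ a) ℚ.* fromℤ (ℤ.+ x)                             ≡⟨ cong (ℚ._* fromℤ (ℤ.+ x)) (sym (clear-denominator a)) ⟩
    a ℚ.* fromℤ (ℤ.+ ↧ₙ a) ℚ.* fromℤ (ℤ.+ x)                  ≡⟨ ℚ.*-assoc a _ _ ⟩
    a ℚ.* (fromℤ (ℤ.+ ↧ₙ a) ℚ.* fromℤ (ℤ.+ x))                ≡⟨ cong (a ℚ.*_) (ℚ.*-comm (fromℤ (ℤ.+ ↧ₙ a)) (fromℤ (ℤ.+ x))) ⟩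
    a ℚ.* (fromℤ (ℤ.+ x) ℚ.* fromℤ (ℤ.+ ↧ₙ a))                ≡⟨ sym (ℚ.*-assoc a _ _) ⟩
    a ℚ.* fromℤ (ℤ.+ x) ℚ.* fromℤ (ℤ.+ ↧ₙ a)                  ≡⟨ cong (ℚ._* fromℤ (ℤ.+ ↧ₙ a)) (trans eq (cong fromℤ (ℤ.∣i∣≡0⇒i≡0 {z} z≡0))) ⟩
    0ℚ ℚ.* fromℤ (ℤ.+ ↧ₙ a)                                   ≡⟨ ℚ.*-zeroˡ (fromℤ (ℤ.+ ↧ₙ a)) ⟩
    0ℚ ∎)
    where open ≡-Reasoning
  ↥a≡0 : ↥ a ≡ 0ℤ
  ↥a≡0 with ℤ.i*j≡0⇒i≡0∨j≡0 (↥ a) num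
  ... | inj₁ e = e
  ... | inj₂ e = contradiction (ℤ.+-injective e) x≢0

factorisation : ∀ n s b k → ∣ b (fromℕ n) ∣ ≡ 1 → HasFactorOfDegree (G n s b) k → Factorisation n k (gCoef n s b)
factorisation n s b k bₙ≡1 (f , (f-top , f-bound) , h , fh≈G) with clear-denominators f | clear-denominators h
... | Df , Df≢0 , F₀ , F₀≡ | Dh , Dh≢0 , H , H≡ = record
  { F = F ; H = H ; N = N ; N≢0 = N≢0 ; FH≡Ng = FH≡Ng ; k≤n = ≤-trans (m≤m+n k top) k+top≤n ; F-bound = F-bound ; F-top = F-top
  ; H-bound = λ j ne → ≤-trans (top-max j ne) (m+n≤o⇒n≤o∸m k+top≤n) ; H-some = top , top-≢0 }
  where
  -- The n! that makes G integral is put into F.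
  F : ℕ → ℤ
  F i = F₀ i ℤ.* ℤ.+ (n !)
  N : ℤ
  N = ℤ.+ (Df * Dh)
  g = gCoef n s b
  m+n≤o⇒n≤o∸m : ∀ {m o} → k + m ≤ o → m ≤ o ∸ k
  m+n≤o⇒n≤o∸m {m} {o} le = subst (_≤ o ∸ k) (m+n∸m≡n k m) (∸-monoˡ-≤ k le)
  N≢0 : Df * Dh ≢ 0
  N≢0 eq with m*n≡0⇒m≡0∨n≡0 Df eq
  ... | inj₁ z = Df≢0 z
  ... | inj₂ z = Dh≢0 z
  F≡ : ∀ i → coeff f i ℚ.* (fromℤ (ℤ.+ Df) ℚ.* fromℤ (ℤ.+ (n !))) ≡ fromℤ (F i)
  F≡ i = trans (sym (ℚ.*-assoc (coeff f i) _ _)) (trans (cong (ℚ._* fromℤ (ℤ.+ (n !))) (F₀≡ i)) (sym (fromℤ-* (F₀ i) (ℤ.+ (n !)))))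
  FH≡Ng : ∀ m → conv F H m ≡ N ℤ.* g m
  FH≡Ng m = fromℤ-injective (begin
    fromℤ (conv F H m)                     ≡⟨ sym (convℚ-clear F≡ H≡ m) ⟩
    convℚ (coeff f) (coeff h) m ℚ.* (x ℚ.* z ℚ.* y)
      ≡⟨ cong (ℚ._* (x ℚ.* z ℚ.* y)) (trans (sym (coeff-* f h m)) (fh≈G m)) ⟩
    coeff (G n s b) m ℚ.* (x ℚ.* z ℚ.* y)  ≡⟨ cong (coeff (G n s b) m ℚ.*_) (trans (cong (ℚ._* y) (ℚ.*-comm x z)) (ℚ.*-assoc z x y)) ⟩
    coeff (G n s b) m ℚ.* (z ℚ.* (x ℚ.* y)) ≡⟨ sym (ℚ.*-assoc (coeff (G n s b) m) z (x ℚ.* y)) ⟩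
    coeff (G n s b) m ℚ.* z ℚ.* (x ℚ.* y)  ≡⟨ cong₂ ℚ._*_ (G-clear n s b m) (sym (trans (cong fromℤ (ℤ.pos-* Df Dh)) (fromℤ-* (ℤ.+ Df) (ℤ.+ Dh)))) ⟩
    fromℤ (g m) ℚ.* fromℤ N                ≡⟨ sym (fromℤ-* (g m) N) ⟩
    fromℤ (g m ℤ.* N)                      ≡⟨ cong fromℤ (ℤ.*-comm (g m) N) ⟩
    fromℤ (N ℤ.* g m)                      ∎)
    where
    open ≡-Reasoning
    x = fromℤ (ℤ.+ Df)
    y = fromℤ (ℤ.+ Dh)
    z = fromℤ (ℤ.+ (n !))
  clear-≢0 : ∀ {D a z} → a ℚ.* fromℤ (ℤ.+ D) ≡ fromℤ z → a ≡ 0ℚ → ∣ z ∣ ≡ 0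
  clear-≢0 {D} eq refl = cong ∣_∣ (fromℤ-injective (trans (sym eq) (ℚ.*-zeroˡ (fromℤ (ℤ.+ D)))))
  F-bound : ∀ i → ∣ F i ∣ ≢ 0 → i ≤ k
  F-bound i ne = ≮⇒≥ λ k<i → ne (trans (ℤ.abs-* (F₀ i) (ℤ.+ (n !))) (cong (_* (n !)) (clear-≢0 {Df} (F₀≡ i) (f-bound i k<i))))
  F-top : ∣ F k ∣ ≢ 0
  F-top eq with m*n≡0⇒m≡0∨n≡0 ∣ F₀ k ∣ (trans (sym (ℤ.abs-* (F₀ k) (ℤ.+ (n !)))) eq)
  ... | inj₁ z = f-top (cancel-fromℤ Df≢0 (F₀≡ k) z)
  ... | inj₂ z = ≢-nonZero⁻¹ (n !) {{n !≢0}} z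
  L = length h
  H-far : ∀ j → ∣ H j ∣ ≢ 0 → j ≤ L
  H-far j ne = ≮⇒≥ λ L<j → ne (clear-≢0 {Dh} (H≡ j) (coeff-≥length h j (<⇒≤ L<j)))
  g-top : ∣ g n ∣ ≡ 1
  g-top = trans (ℤ.abs-* (extend b n) (ℤ.+ cCoef n s n)) (trans (cong₂ _*_ (trans (cong ∣_∣ (extend-top b)) bₙ≡1) (cCoef-top n s)) refl)
  product≢0 : ∀ m → ∣ conv F H m ∣ ≢ 0 → m ≤ n
  product≢0 m ne = ≮⇒≥ λ n<m → ne (trans (cong ∣_∣ (trans (FH≡Ng m) (trans (cong (N ℤ.*_) (trans (cong (ℤ._* ℤ.+ cCoef n s m) (extend-> b n<m)) (ℤ.*-zeroˡ (ℤ.+ cCoef n s m)))) (ℤ.*-zeroʳ N)))) refl)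
  -- The list h may end in zeros, so its degree is found as the index minimising L - j among the
  -- nonzero coefficients.
  largest : ∃ λ t → t ≤ L × ∣ H t ∣ ≢ 0 × (∀ j → j ≤ L → ∣ H j ∣ ≢ 0 → L ∸ t ≤ L ∸ j)
  largest with argmin (λ j → ¬? (∣ H j ∣ ≟ 0)) (L ∸_) L
  ... | inj₂ found = found
  ... | inj₁ none = contradiction (0∣⇒≡0 (conv-∣ F H n λ i j _ → zero-term i j)) conv-n≢0
    where
    H≡0 : ∀ j → ∣ H j ∣ ≡ 0
    H≡0 j with ∣ H j ∣ ≟ 0
    ... | yes e = e
    ... | no ne = contradiction ne (none j (H-far j ne))
    zero-term : ∀ i j → 0 ∣ ∣ F i ℤ.* H j ∣
    zero-term i j = subst (0 ∣_) (sym (trans (ℤ.abs-* (F i) (H j)) (trans (cong (∣ F i ∣ *_) (H≡0 j)) (*-zeroʳ ∣ F i ∣)))) ∣-refl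
    conv-n≢0 : ∣ conv F H n ∣ ≢ 0
    conv-n≢0 e = N≢0 (trans (sym (trans (cong ∣_∣ (FH≡Ng n)) (trans (ℤ.abs-* N (g n)) (trans (cong ((Df * Dh) *_) g-top) (*-identityʳ (Df * Dh)))))) e)
  top = proj₁ largest
  top-≢0 = proj₁ (proj₂ (proj₂ largest))
  top-max : ∀ j → ∣ H j ∣ ≢ 0 → j ≤ top
  top-max j ne = ≮⇒≥ λ lt → <⇒≱ (∸-monoʳ-< lt (H-far j ne)) (proj₂ (proj₂ (proj₂ largest)) j (H-far j ne) ne)
  -- The leading coefficients of F and H give the only nonzero term of index k + top; the others
  -- vanish, which is expressed as divisibility by 0.
  k+top≤n : k + top ≤ n
  k+top≤n = product≢0 (k + top) λ e → contradiction
    (trans (sym (ℤ.abs-* (F k) (H top))) (0∣⇒≡0 (conv-∣-single F H k top (λ i j eq i≢ → others i j eq i≢) (subst (0 ∣_) (sym e) ∣-refl))))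
    λ z → [ F-top , top-≢0 ]′ (m*n≡0⇒m≡0∨n≡0 ∣ F k ∣ z)
    where
    others : ∀ i j → i + j ≡ k + top → i ≢ k → 0 ∣ ∣ F i ℤ.* H j ∣
    others i j eq i≢ with ∣ F i ∣ ≟ 0 | ∣ H j ∣ ≟ 0
    ... | yes z | _ = subst (0 ∣_) (sym (trans (ℤ.abs-* (F i) (H j)) (cong (_* ∣ H j ∣) z))) ∣-refl
    ... | no _ | yes z = subst (0 ∣_) (sym (trans (ℤ.abs-* (F i) (H j)) (trans (cong (∣ F i ∣ *_) z) (*-zeroʳ ∣ F i ∣)))) ∣-refl
    ... | no a | no c = contradiction eq (<⇒≢ (+-mono-<-≤ (≤∧≢⇒< (F-bound i a) i≢) (top-max j c)))

-- The Newton polygon criterion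

module _ {p} (pp : Prime p) {n k g} (fact : Factorisation n k g) where
  open Factorisation fact

  -- The weights q v + a i and the tie-break ρ pick out the two ends of the edge of slope -a/q
  -- in the Newton polygons of F, H and g.
  noFactor : ∀ q₁-1 a₁ q₂-1 a₂ l l′ m* v* → let q₁ = suc q₁-1 ; q₂ = suc q₂-1 in
    l + l′ < k → ¬ p ∣ ∣ g n ∣ →
    (∀ m → m ≤ n → l < n ∸ m → ∃ λ v → p ^ v ∣ ∣ g m ∣ × a₁ * n < q₁ * v + a₁ * m) →
    ¬ p ^ suc v* ∣ ∣ g m* ∣ →
    (∀ m → m ≤ n → l′ < m → ∃ λ v → p ^ v ∣ ∣ g m ∣ × q₂ * v* + a₂ * m* < q₂ * v + a₂ * m) →
    (∀ d u → d ≤ k → k ≤ d + (l + l′) → a₁ * d < q₁ * u → q₂ * u < a₂ * d → ⊥) → ⊥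
  noFactor q₁-1 a₁ q₂-1 a₂ l l′ m* v* l+l′<k p∤gₙ right p^∤ left gap =
    gap d u (≤-trans (m∸n≤m lo.i₀ hi.i₀) lo.i₀≤) k≤d+
      (+-cancelʳ-< (q₁ * lo.e₀ + a₁ * hi.i₀) (a₁ * d) (q₁ * u) (subst₂ _<_ (eqL a₁ d hi.i₀ q₁ lo.e₀ lo.i₀ hi+d) (eqR q₁ u lo.e₀ hi.e₀ a₁ hi.i₀ lo+u) lo-strict))
      (+-cancelʳ-< (q₂ * lo.e₀ + a₂ * hi.i₀) (q₂ * u) (a₂ * d) (subst₂ _<_ (eqR q₂ u lo.e₀ hi.e₀ a₂ hi.i₀ lo+u) (eqL a₂ d hi.i₀ q₂ lo.e₀ lo.i₀ hi+d) hi-strict))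
    where
    q₁ = suc q₁-1
    q₂ = suc q₂-1
    δ = n ∸ k
    -- The tie-break i prefers the smallest minimiser, k - i the largest: `lo` is the left end of
    -- the edge for the slope at the right, `hi` the right end of the edge for the slope at the
    -- left.
    module lo = Extremal (extremal pp q₁ a₁ (λ i → i) F k (λ i i≤ → i≤) F-bound (k , F-top))
    module loH = Extremal (extremal pp q₁ a₁ (λ i → i) H δ (λ i i≤ → i≤) H-bound H-some)
    module hi = Extremal (extremal pp q₂ a₂ (k ∸_) F k (λ i _ → m∸n≤m k i) F-bound (k , F-top))
    module hiH = Extremal (extremal pp q₂ a₂ (δ ∸_) H δ (λ i _ → m∸n≤m δ i) H-bound H-some)
    +-<-right : ∀ {i i′ j j′} → i + j ≡ i′ + j′ → i′ < i → j < j′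
    +-<-right {i} {i′} {j} {j′} eq lt = ≰⇒> λ j′≤j → <⇒≢ (+-mono-<-≤ lt j′≤j) (sym eq)
    +-<-right′ : ∀ {i i′ j j′} → i + j ≡ i′ + j′ → i < i′ → j′ < j
    +-<-right′ eq lt = +-<-right (sym eq) lt
    lo-min : ∀ {v} → p ^ v ∣ ∣ g (lo.i₀ + loH.i₀) ∣ → q₁ * v + a₁ * (lo.i₀ + loH.i₀) ≤ a₁ * n
    lo-min {v} d∣ = subst (λ z → q₁ * v + a₁ * (lo.i₀ + loH.i₀) ≤ z + a₁ * n) (*-zeroʳ q₁)
      (Product.minimizer pp F H g N N≢0 FH≡Ng q₁-1 a₁ lo.i₀ loH.i₀ lo.e₀ loH.e₀ lo.exact loH.exact lo.minimal loH.minimal other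
        {v* = 0} d∣ λ d → p∤gₙ (subst (_∣ ∣ g n ∣) (*-identityʳ p) d))
      where
      other : ∀ {i j d e} → i + j ≡ lo.i₀ + loH.i₀ → i ≢ lo.i₀ → p ^ d ∥ ∣ F i ∣ → p ^ e ∥ ∣ H j ∣ → _
      other {i} eq i≢ exd exe with <-cmp i lo.i₀
      ... | tri< lt _ _ = +-mono-<-≤ (lo.strict exd lt) (loH.minimal exe)
      ... | tri≈ _ e _ = contradiction e i≢
      ... | tri> _ _ gt = +-mono-≤-< (lo.minimal exd) (loH.strict exe (+-<-right eq gt))
    hi-min : ∀ {v} → p ^ v ∣ ∣ g (hi.i₀ + hiH.i₀) ∣ → q₂ * v + a₂ * (hi.i₀ + hiH.i₀) ≤ q₂ * v* + a₂ * m*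
    hi-min d∣ = Product.minimizer pp F H g N N≢0 FH≡Ng q₂-1 a₂ hi.i₀ hiH.i₀ hi.e₀ hiH.e₀ hi.exact hiH.exact hi.minimal hiH.minimal other d∣ p^∤
      where
      other : ∀ {i j d e} → i + j ≡ hi.i₀ + hiH.i₀ → i ≢ hi.i₀ → p ^ d ∥ ∣ F i ∣ → p ^ e ∥ ∣ H j ∣ → _
      other {i} {j} eq i≢ exd exe with <-cmp i hi.i₀
      ... | tri> _ _ gt = +-mono-<-≤ (hi.strict exd (∸-monoʳ-< gt (F-bound i (∥⇒≢0 pp exd)))) (hiH.minimal exe)
      ... | tri≈ _ e _ = contradiction e i≢
      ... | tri< lt _ _ = +-mono-≤-< (hi.minimal exd) (hiH.strict exe (∸-monoʳ-< (+-<-right′ eq lt) (H-bound j (∥⇒≢0 pp exe))))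
    lo-m≤n : lo.i₀ + loH.i₀ ≤ n
    lo-m≤n = subst (lo.i₀ + loH.i₀ ≤_) (m+[n∸m]≡n k≤n) (+-mono-≤ lo.i₀≤ loH.i₀≤)
    hi-m≤n : hi.i₀ + hiH.i₀ ≤ n
    hi-m≤n = subst (hi.i₀ + hiH.i₀ ≤_) (m+[n∸m]≡n k≤n) (+-mono-≤ hi.i₀≤ hiH.i₀≤)
    -- By `right` the minimiser of g is within l of n; H accounts for at most n - k of it, hence F
    -- for at least k - l.
    k≤l+lo : k ≤ l + lo.i₀
    k≤l+lo = +-cancelʳ-≤ δ k (l + lo.i₀) (begin
      k + δ                  ≡⟨ m+[n∸m]≡n k≤n ⟩
      n                      ≤⟨ m≤n+m∸n n (lo.i₀ + loH.i₀) ⟩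
      (lo.i₀ + loH.i₀) + (n ∸ (lo.i₀ + loH.i₀)) ≤⟨ +-monoʳ-≤ (lo.i₀ + loH.i₀) n∸m≤l ⟩
      (lo.i₀ + loH.i₀) + l   ≤⟨ +-monoˡ-≤ l (+-monoʳ-≤ lo.i₀ loH.i₀≤) ⟩
      (lo.i₀ + δ) + l        ≡⟨ trans (+-comm (lo.i₀ + δ) l) (sym (+-assoc l lo.i₀ δ)) ⟩
      l + lo.i₀ + δ ∎)
      where
      open ≤-Reasoning
      n∸m≤l : n ∸ (lo.i₀ + loH.i₀) ≤ l
      n∸m≤l = ≮⇒≥ λ lt → let (v , d∣ , big) = right (lo.i₀ + loH.i₀) lo-m≤n lt in <⇒≱ big (lo-min d∣)
    hi≤l′ : hi.i₀ ≤ l′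
    hi≤l′ = ≤-trans (m≤m+n hi.i₀ hiH.i₀) (≮⇒≥ λ lt → let (v , d∣ , big) = left (hi.i₀ + hiH.i₀) hi-m≤n lt in <⇒≱ big (hi-min d∣))
    hi<lo : hi.i₀ < lo.i₀
    hi<lo = +-cancelˡ-< l hi.i₀ lo.i₀ (≤-<-trans (+-monoʳ-≤ l hi≤l′) (<-≤-trans l+l′<k k≤l+lo))
    d = lo.i₀ ∸ hi.i₀
    hi+d : hi.i₀ + d ≡ lo.i₀
    hi+d = m+[n∸m]≡n (<⇒≤ hi<lo)
    -- From `hi` to `lo` the polygon of F has width d and drop u. Each end is preferred by its own
    -- tie-break, so both slope inequalities are strict.
    lo-strict : q₁ * lo.e₀ + a₁ * lo.i₀ < q₁ * hi.e₀ + a₁ * hi.i₀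
    lo-strict = lo.strict hi.exact hi<lo
    hi-strict : q₂ * hi.e₀ + a₂ * hi.i₀ < q₂ * lo.e₀ + a₂ * lo.i₀
    hi-strict = hi.strict lo.exact (∸-monoʳ-< hi<lo lo.i₀≤)
    lo<hi-e : lo.e₀ ≤ hi.e₀
    lo<hi-e = ≮⇒≥ λ lt → <⇒≱ lo-strict (+-mono-≤ (*-monoʳ-≤ q₁ (<⇒≤ lt)) (*-monoʳ-≤ a₁ (<⇒≤ hi<lo)))
    u = hi.e₀ ∸ lo.e₀
    lo+u : lo.e₀ + u ≡ hi.e₀
    lo+u = m+[n∸m]≡n lo<hi-e
    k≤d+ : k ≤ d + (l + l′)
    k≤d+ = begin
      k                    ≤⟨ k≤l+lo ⟩
      l + lo.i₀            ≡⟨ cong (l +_) (sym hi+d) ⟩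
      l + (hi.i₀ + d)      ≤⟨ +-monoʳ-≤ l (+-monoˡ-≤ d hi≤l′) ⟩
      l + (l′ + d)         ≡⟨ trans (sym (+-assoc l l′ d)) (+-comm (l + l′) d) ⟩
      d + (l + l′)         ∎
      where open ≤-Reasoning
    eqL : ∀ a d h q e i → h + d ≡ i → q * e + a * i ≡ a * d + (q * e + a * h)
    eqL a d h q e i refl = ring a d h q e
      where
      ring : ∀ a d h q e → q * e + a * (h + d) ≡ a * d + (q * e + a * h)
      ring = solve-∀
    eqR : ∀ q u e e′ a h → e + u ≡ e′ → q * e′ + a * h ≡ q * u + (q * e + a * h)
    eqR q u e e′ a h refl = ring q u e a h
      where
      ring : ∀ q u e a h → q * (e + u) + a * h ≡ q * u + (q * e + a * h)
      ring = solve-∀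

-- Binomial coefficients and factorials modulo a prime

binom : ℕ → ℕ → ℕ
binom n s = (n + s) C n

binom-zero : ∀ n → binom n 0 ≡ 1
binom-zero n rewrite +-identityʳ n = nCn≡1 n

binom-! : ∀ n s → binom n s * s ! ≡ asc n s
binom-! n s = *-cancelˡ-≡ (binom n s * s !) (asc n s) (n !) {{n !≢0}} (begin
  n ! * (binom n s * s !)  ≡⟨ ring (n !) (binom n s) (s !) ⟩
  binom n s * (n ! * s !)  ≡⟨ C-! ⟩
  (n + s) !                ≡⟨ sym (asc-! n s) ⟩
  n ! * asc n s            ∎)
  where
  open ≡-Reasoning
  ring : ∀ a b c → a * (b * c) ≡ b * (a * c)
  ring = solve-∀
  instance _ = m*n≢0 (n !) ((n + s ∸ n) !) {{n !≢0}} {{(n + s ∸ n) !≢0}}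
  C-! : binom n s * (n ! * s !) ≡ (n + s) !
  C-! = begin
    binom n s * (n ! * s !)             ≡⟨ cong (λ z → binom n s * (n ! * z !)) (sym (m+n∸m≡n n s)) ⟩
    binom n s * (n ! * (n + s ∸ n) !)   ≡⟨ cong (_* (n ! * (n + s ∸ n) !)) (nCk≡n!/k![n-k]! (m≤m+n n s)) ⟩
    ((n + s) ! / (n ! * (n + s ∸ n) !)) * (n ! * (n + s ∸ n) !) ≡⟨ m/n*n≡m (k![n∸k]!∣n! (m≤m+n n s)) ⟩
    (n + s) ! ∎

asc-0 : ∀ s → asc 0 s ≡ s !
asc-0 s = trans (sym (*-identityˡ (asc 0 s))) (asc-! 0 s)

asc≢0 : ∀ n s → asc n s ≢ 0
asc≢0 n (suc s) eq with m*n≡0⇒m≡0∨n≡0 (asc n s) eq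
... | inj₁ z = asc≢0 n s z
... | inj₂ z = contradiction (trans (sym (+-suc n s)) z) λ ()

∣asc : ∀ m {i d} → 0 < i → i ≤ d → m + i ∣ asc m d
∣asc m {i} {zero} 0<i i≤0 = contradiction (<-≤-trans 0<i i≤0) λ ()
∣asc m {i} {suc d} 0<i i≤d with m≤n⇒m<n∨m≡n i≤d
... | inj₁ (s≤s lt) = ∣m⇒∣m*n (m + suc d) (∣asc m 0<i lt)
... | inj₂ refl = n∣m*n (asc m d)

divMod-unique : ∀ {p a b r r′} → r < p → r′ < p → p * a + r ≡ p * b + r′ → a ≡ b
divMod-unique {p} r< r′< eq = ≤-antisym (lex-≤ {p} r′< (≤-reflexive eq)) (lex-≤ {p} r< (≤-reflexive (sym eq)))

divMod : ∀ p → 0 < p → ∀ n → ∃ λ q → ∃ λ r → r < p × n ≡ p * q + r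
divMod p@(suc _) _ n = n / p , n % p , m%n<n n p , trans (m≡m%n+[m/n]*n n p) (trans (+-comm (n % p) _) (cong (_+ n % p) (*-comm (n / p) p)))

module _ {p} (pp : Prime p) where

  private
    0<p : 0 < p
    0<p = <-≤-trans (s≤s z≤n) (prime≥2 pp)

  -- The multiples of p among p n + l + 1, ..., p n + l + s are p (n + 1), ..., p (n + quot).
  -- Divided by p they form a product of the same kind, one base-p digit shorter; all later descents
  -- rest on this.
  record AscSplit (n l s : ℕ) : Set where
    field
      quot rem unit : ℕ
      rem<      : rem < p
      l+s≡      : l + s ≡ p * quot + rem
      p∤unit    : p ∤ unit
      asc≡      : asc (p * n + l) s ≡ unit * (p ^ quot * asc n quot)

  -- Pulling the multiples of p out of a product of consecutive integers.
  ascSplit : ∀ n {l} → l < p → ∀ s → AscSplit n l s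
  ascSplit n {l} l<p zero = record
    { quot = 0 ; rem = l ; unit = 1 ; rem< = l<p ; l+s≡ = trans (+-identityʳ l) (cong (_+ l) (sym (*-zeroʳ p)))
    ; p∤unit = p∤1 pp ; asc≡ = refl }
  ascSplit n {l} l<p (suc s) with ascSplit n l<p s
  ... | sp with m≤n⇒m<n∨m≡n (AscSplit.rem< sp)
  ...   | inj₁ lt = record
    { quot = quot ; rem = suc rem ; unit = unit * x ; rem< = lt
    ; l+s≡ = trans (+-suc l s) (trans (cong suc l+s≡) (sym (+-suc (p * quot) rem)))
    ; p∤unit = ∤-* pp p∤unit p∤x
    ; asc≡ = trans (cong (_* x) asc≡) (trans (*-assoc unit _ x) (trans (cong (unit *_) (*-comm _ x)) (sym (*-assoc unit x _)))) }
    where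
    open AscSplit sp
    x = p * n + l + suc s
    x≡ : x ≡ p * (n + quot) + suc rem
    x≡ = trans (+-assoc (p * n) l (suc s)) (trans (cong (p * n +_) (trans (+-suc l s) (cong suc l+s≡))) (ring p n quot rem))
      where
      ring : ∀ p n q r → p * n + suc (p * q + r) ≡ p * (n + q) + suc r
      ring = solve-∀
    p∤x : p ∤ x
    p∤x d∣ = <⇒≱ lt (∣⇒≤ (∣m+n∣m⇒∣n (subst (p ∣_) x≡ d∣) (m∣m*n (n + quot))))
  ...   | inj₂ eq = record
    { quot = suc quot ; rem = 0 ; unit = unit ; rem< = 0<p
    ; l+s≡ = trans (+-suc l s) (trans (cong suc l+s≡) (trans (sym (+-suc (p * quot) rem)) (trans (cong (p * quot +_) eq) (ring₁ p quot))))
    ; p∤unit = p∤unit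
    ; asc≡ = trans (cong₂ _*_ asc≡ x≡) (ring₂ unit (p ^ quot) (asc n quot) p (n + suc quot)) }
    where
    open AscSplit sp
    ring₁ : ∀ p q → p * q + p ≡ p * suc q + 0
    ring₁ = solve-∀
    ring₂ : ∀ u P a p y → u * (P * a) * (p * y) ≡ u * (p * P * (a * y))
    ring₂ = solve-∀
    x≡ : p * n + l + suc s ≡ p * (n + suc quot)
    x≡ = trans (+-assoc (p * n) l (suc s)) (trans (cong (p * n +_) (trans (+-suc l s) (trans (cong suc l+s≡) (trans (sym (+-suc (p * quot) rem)) (cong (p * quot +_) eq))))) (ring p n quot))
      where
      ring : ∀ p n q → p * n + (p * q + p) ≡ p * (n + suc q)
      ring = solve-∀

  -- As l + r < p, numerator and denominator contain equally many multiples of p, namely s; after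
  -- cancelling p^s the two binomials differ by units. Indexing `binom` by two summands makes the
  -- carries visible.
  lucas : ∀ n s {l r} → l + r < p → p ∤ binom n s → p ∤ binom (p * n + l) (p * s + r)
  lucas n s {l} {r} l+r<p p∤₁ p∣ = ∤-* pp (AscSplit.p∤unit A) p∤₁ (subst (p ∣_) binom≡ (∣m⇒∣m*n (AscSplit.unit S) p∣))
    where
    l<p = ≤-<-trans (m≤m+n l r) l+r<p
    r<p = ≤-<-trans (m≤n+m r l) l+r<p
    A = ascSplit n l<p (p * s + r)
    S = ascSplit 0 0<p (p * s + r)
    module SA = AscSplit A
    module SS = AscSplit S
    A-quot : SA.quot ≡ s
    A-quot = divMod-unique SA.rem< l+r<p (trans (sym SA.l+s≡) (ring l (p * s) r))
      where
      ring : ∀ l x r → l + (x + r) ≡ x + (l + r)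
      ring = solve-∀
    S-quot : SS.quot ≡ s
    S-quot = divMod-unique SS.rem< r<p (sym SS.l+s≡)
    N = binom (p * n + l) (p * s + r)
    binom≡ : N * SS.unit ≡ SA.unit * binom n s
    binom≡ = *-cancelʳ-≡ _ _ (p ^ s * s !) {{m*n≢0 (p ^ s) (s !) {{m^n≢0 p s {{prime⇒nonZero pp}}}} {{s !≢0}}}} (begin
      N * SS.unit * (p ^ s * s !)          ≡⟨ *-assoc N SS.unit _ ⟩
      N * (SS.unit * (p ^ s * s !))        ≡⟨ cong (λ z → N * (SS.unit * (p ^ s * z))) (sym (asc-0 s)) ⟩
      N * (SS.unit * (p ^ s * asc 0 s))    ≡⟨ cong (λ z → N * (SS.unit * (p ^ z * asc 0 z))) (sym S-quot) ⟩
      N * (SS.unit * (p ^ SS.quot * asc 0 SS.quot)) ≡⟨ cong (N *_) (sym SS.asc≡) ⟩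
      N * asc (p * 0 + 0) (p * s + r)     ≡⟨ cong (λ z → N * asc (z + 0) (p * s + r)) (*-zeroʳ p) ⟩
      N * asc 0 (p * s + r)               ≡⟨ cong (N *_) (asc-0 (p * s + r)) ⟩
      N * (p * s + r) !                   ≡⟨ binom-! (p * n + l) (p * s + r) ⟩
      asc (p * n + l) (p * s + r)         ≡⟨ SA.asc≡ ⟩
      SA.unit * (p ^ SA.quot * asc n SA.quot) ≡⟨ cong (λ z → SA.unit * (p ^ z * asc n z)) A-quot ⟩
      SA.unit * (p ^ s * asc n s)          ≡⟨ cong (λ z → SA.unit * (p ^ s * z)) (sym (binom-! n s)) ⟩
      SA.unit * (p ^ s * (binom n s * s !)) ≡⟨ ring SA.unit (p ^ s) (binom n s) (s !) ⟩
      SA.unit * binom n s * (p ^ s * s !)  ∎)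
      where
      open ≡-Reasoning
      ring : ∀ a b c d → a * (b * (c * d)) ≡ a * c * (b * d)
      ring = solve-∀

  p∤binom-small : ∀ m {l s} → s + l < p → p ∤ binom (p * m + l) s
  p∤binom-small m {l} {s} lt = subst (λ z → p ∤ binom (p * m + l) z) (cong (_+ s) (*-zeroʳ p))
    (lucas m 0 (subst (_< p) (+-comm s l) lt) (subst (p ∤_) (sym (binom-zero m)) (p∤1 pp)))

  -- The lowest e digits of n are zero and s has no others, so no carry occurs.
  p∤binom-p^ : ∀ e {n s} → p ^ e ∣ n → s < p ^ e → p ∤ binom n s
  p∤binom-p^ zero {n} {zero} _ _ = subst (p ∤_) (sym (binom-zero n)) (p∤1 pp)
  p∤binom-p^ zero {n} {suc s} _ (s≤s ())
  p∤binom-p^ (suc e) {n} {s} (divides c n≡) s< with divMod p 0<p s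
  ... | s₁ , r , r<p , refl = subst (λ z → p ∤ binom z (p * s₁ + r)) (trans (+-identityʳ _) (sym n≡′))
    (lucas (c * p ^ e) s₁ r<p (p∤binom-p^ e (n∣m*n c) (*-cancelˡ-< p s₁ (p ^ e) (≤-<-trans (m≤m+n (p * s₁) r) s<))))
    where
    n≡′ : n ≡ p * (c * p ^ e)
    n≡′ = trans n≡ (ring c p (p ^ e))
      where
      ring : ∀ c p P → c * (p * P) ≡ p * (c * P)
      ring = solve-∀

  -- The last digit of p m is 0, so the first carry arises at the second digit: l + s₁ ≥ p for the
  -- last digit l of m. Then r = p - l works, and p m is congruent to -p r modulo p².
  p∣binom⇒residue : ∀ m {s} → s < p * p → p ∣ binom (p * m) s → ∃ λ r → 0 < r × p * r ≤ s × p ∣ m + r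
  p∣binom⇒residue m {s} s<p² p∣ with divMod p 0<p s | divMod p 0<p m
  ... | s₁ , r₀ , r₀<p , refl | m₁ , l , l<p , refl with l + s₁ <? p
  ...   | yes lt = contradiction p∣ (subst (λ z → p ∤ binom z (p * s₁ + r₀)) (+-identityʳ (p * (p * m₁ + l)))
    (lucas (p * m₁ + l) s₁ {0} {r₀} r₀<p (p∤binom-small m₁ (subst (_< p) (+-comm l s₁) lt))))
  ...   | no ¬lt = p ∸ l , m<n⇒0<n∸m l<p , ≤-trans (*-monoʳ-≤ p (m≤n+o⇒m∸n≤o p l (≮⇒≥ ¬lt))) (m≤m+n (p * s₁) r₀) ,
    subst (p ∣_) (sym (trans (+-assoc (p * m₁) l (p ∸ l)) (cong (p * m₁ +_) (m+[n∸m]≡n (<⇒≤ l<p)))))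
      (∣m∣n⇒∣m+n (m∣m*n m₁) ∣-refl)

  -- Legendre's bound, from v(m!) = quot + v(quot!) with p quot ≤ m; the strictness originates in
  -- the case quot = 0.
  ∥!-bound : ∀ m {e} → 0 < m → p ^ e ∥ m ! → (p ∸ 1) * e < m
  ∥!-bound m = go (<-wellFounded m)
    where
    go : ∀ {m} → Acc _<_ m → ∀ {e} → 0 < m → p ^ e ∥ m ! → (p ∸ 1) * e < m
    go {m} (acc rec) {e} 0<m ex with ascSplit 0 0<p m
    ... | sp = subst (λ z → (p ∸ 1) * z < m) (∥-unique pp ex′ ex) bound
      where
      open AscSplit sp
      e₁ = proj₁ (∥-exists pp {quot !} (≢-nonZero⁻¹ _ {{quot !≢0}}))
      ex₁ = proj₂ (∥-exists pp {quot !} (≢-nonZero⁻¹ _ {{quot !≢0}}))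
      m!≡ : unit * (p ^ quot * quot !) ≡ m !
      m!≡ = trans (cong (λ z → unit * (p ^ quot * z)) (sym (asc-0 quot))) (trans (sym asc≡)
        (trans (cong (λ z → asc (z + 0) m) (*-zeroʳ p)) (asc-0 m)))
      ex′ : p ^ (quot + e₁) ∥ m !
      ex′ = subst (p ^ (quot + e₁) ∥_) m!≡ (∥-* pp (∤⇒∥ pp p∤unit) (∥-* pp (∥-p^ pp quot) ex₁))
      suc-pred-p : suc (p ∸ 1) ≡ p
      suc-pred-p = m+[n∸m]≡n 0<p
      bound : (p ∸ 1) * (quot + e₁) < m
      bound with quot ≟ 0
      ... | yes q≡0 = subst (λ z → (p ∸ 1) * z < m) (sym (cong₂ _+_ q≡0 e₁≡0)) (subst (_< m) (sym (*-zeroʳ (p ∸ 1))) 0<m)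
        where
        e₁≡0 : e₁ ≡ 0
        e₁≡0 = ∥-unique pp ex₁ (subst (λ z → p ^ 0 ∥ z !) (sym q≡0) (∤⇒∥ pp (p∤1 pp)))
      ... | no q≢0 = begin-strict
        (p ∸ 1) * (quot + e₁)          ≡⟨ *-distribˡ-+ (p ∸ 1) quot e₁ ⟩
        (p ∸ 1) * quot + (p ∸ 1) * e₁  <⟨ +-monoʳ-< ((p ∸ 1) * quot) (go (rec quot<m) (≢0⇒0< q≢0) ex₁) ⟩
        (p ∸ 1) * quot + quot          ≡⟨ +-comm _ quot ⟩
        suc (p ∸ 1) * quot             ≡⟨ cong (_* quot) suc-pred-p ⟩
        p * quot                       ≤⟨ pq≤m ⟩
        m ∎
        where
        open ≤-Reasoning
        pq≤m : p * quot ≤ m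
        pq≤m = subst (p * quot ≤_) (sym l+s≡) (m≤m+n (p * quot) rem)
        quot<m : quot < m
        quot<m = <-≤-trans (m<m*n quot p {{≢-nonZero q≢0}} (prime≥2 pp)) (subst (_≤ m) (*-comm p quot) pq≤m)

  -- Ending at a multiple of p^e, t consecutive integers contain at least t / p^i multiples of p^i
  -- for each i ≤ e. Summation gives v ≥ t (1 - 1 / p^e) / (p - 1), here cleared of denominators.
  asc-p^ : ∀ e m t → p ^ e ∣ m + t → ∃ λ v → p ^ v ∣ asc m t × t * p ^ e ≤ (p ∸ 1) * p ^ e * v + t
  asc-p^ zero m t _ = 0 , 1∣ asc m t , subst (_≤ (p ∸ 1) * 1 * 0 + t) (sym (*-identityʳ t)) (m≤n+m t _)
  asc-p^ (suc e) m t d∣ with divMod p 0<p m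
  ... | m₁ , l , l<p , refl with ascSplit m₁ l<p t
  ...   | sp = quot + v′ , subst (p ^ (quot + v′) ∣_) (sym asc≡) (∣n⇒∣m*n unit (subst (_∣ p ^ quot * asc m₁ quot) (sym (^-distribˡ-+-* p quot v′)) (*-monoʳ-∣ (p ^ quot) v′∣))) , bound
    where
    open AscSplit sp
    n≡ : p * m₁ + l + t ≡ p * (m₁ + quot) + rem
    n≡ = trans (+-assoc (p * m₁) l t) (trans (cong (p * m₁ +_) l+s≡) (ring p m₁ quot rem))
      where
      ring : ∀ p m q r → p * m + (p * q + r) ≡ p * (m + q) + r
      ring = solve-∀
    p∣rem : p ∣ rem
    p∣rem = ∣m+n∣m⇒∣n (subst (p ∣_) n≡ (∣-trans (m∣m*n (p ^ e)) d∣)) (m∣m*n (m₁ + quot))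
    rem≡0 : rem ≡ 0
    rem≡0 with rem ≟ 0
    ... | yes z = z
    ... | no nz = contradiction (∣⇒≤ {{≢-nonZero nz}} p∣rem) (<⇒≱ rem<)
    d∣₁ : p ^ e ∣ m₁ + quot
    d∣₁ = *-cancelˡ-∣ p {{prime⇒nonZero pp}} (subst (p * p ^ e ∣_) (trans n≡ (trans (cong (p * (m₁ + quot) +_) rem≡0) (+-identityʳ _))) d∣)
    IH = asc-p^ e m₁ quot d∣₁
    v′ = proj₁ IH
    v′∣ = proj₁ (proj₂ IH)
    P = p ^ e
    c = p ∸ 1
    p≡ : p ≡ suc c
    p≡ = sym (m+[n∸m]≡n 0<p)
    t≤pq : t ≤ p * quot
    t≤pq = ≤-trans (m≤n+m t l) (≤-reflexive (trans l+s≡ (trans (cong (p * quot +_) rem≡0) (+-identityʳ _))))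
    -- What rounding t up to a multiple of p adds; multiplying it by p^(e + 1) can only help.
    x = p * quot ∸ t
    t+x : t + x ≡ p * quot
    t+x = m+[n∸m]≡n t≤pq
    bound : t * (p * P) ≤ c * (p * P) * (quot + v′) + t
    bound = +-cancelʳ-≤ x _ _ (begin
      t * (p * P) + x                 ≤⟨ +-monoʳ-≤ (t * (p * P)) (m≤m*n x (p * P) {{m*n≢0 p P {{prime⇒nonZero pp}} {{m^n≢0 p e {{prime⇒nonZero pp}}}}}}) ⟩
      t * (p * P) + x * (p * P)       ≡⟨ sym (*-distribʳ-+ (p * P) t x) ⟩
      (t + x) * (p * P)               ≡⟨ cong₂ (λ a z → a * (z * P)) t+x p≡ ⟩
      p * quot * (suc c * P)          ≡⟨ ring₁ p quot c P ⟩
      c * (p * P) * quot + p * (quot * P) ≤⟨ +-monoʳ-≤ (c * (p * P) * quot) (*-monoʳ-≤ p (proj₂ (proj₂ IH))) ⟩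
      c * (p * P) * quot + p * (c * P * v′ + quot) ≡⟨ ring₂ c p P quot v′ ⟩
      c * (p * P) * (quot + v′) + p * quot ≡⟨ cong (c * (p * P) * (quot + v′) +_) (sym t+x) ⟩
      c * (p * P) * (quot + v′) + (t + x) ≡⟨ sym (+-assoc _ t x) ⟩
      c * (p * P) * (quot + v′) + t + x ∎)
      where
      open ≤-Reasoning
      ring₁ : ∀ p q c P → p * q * (suc c * P) ≡ c * (p * P) * q + p * (q * P)
      ring₁ = solve-∀
      ring₂ : ∀ c p P q v → c * (p * P) * q + p * (c * P * v + q) ≡ c * (p * P) * (q + v) + p * q
      ring₂ = solve-∀

-- Exclusion by primes and by prime powers

module Criteria (n s k : ℕ) (b : Fin (suc n) → ℤ) (b₀≡1 : ∣ b fzero ∣ ≡ 1) (bₙ≡1 : ∣ b (fromℕ n) ∣ ≡ 1)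
  (fact : Factorisation n k (gCoef n s b)) where

  g = gCoef n s b

  ∣g : ∀ m {d} → d ∣ cCoef n s m → d ∣ ∣ g m ∣
  ∣g m {d} d∣ = subst (d ∣_) (sym (ℤ.abs-* (extend b m) (ℤ.+ cCoef n s m))) (∣n⇒∣m*n ∣ extend b m ∣ d∣)

  ∣g₀∣ : ∣ g 0 ∣ ≡ binom n s * n !
  ∣g₀∣ = trans (ℤ.abs-* (b fzero) _) (trans (cong (_* cCoef n s 0) b₀≡1) (trans (*-identityˡ _) (cong (binom n s *_) (asc-0 n))))

  ∣gₙ∣ : ∣ g n ∣ ≡ 1
  ∣gₙ∣ = trans (ℤ.abs-* (extend b n) _) (cong₂ _*_ (trans (cong ∣_∣ (extend-top b)) bₙ≡1) (cCoef-top n s))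

  module _ {p} (pp : Prime p) (p∤ : p ∤ binom n s) where

    private
      v₀ = proj₁ (∥-exists pp {n !} (≢-nonZero⁻¹ _ {{n !≢0}}))
      ex₀ = proj₂ (∥-exists pp {n !} (≢-nonZero⁻¹ _ {{n !≢0}}))
      p-2 = p ∸ 2
      p-1≡ : suc p-2 ≡ p ∸ 1
      p-1≡ with prime≥2 pp
      ... | s≤s (s≤s _) = refl

    p^∤g₀ : ¬ p ^ suc v₀ ∣ ∣ g 0 ∣
    p^∤g₀ d∣ = <-irrefl refl (∥⇒≤ pp (∥-* pp (∤⇒∥ pp p∤) ex₀) (subst (p ^ suc v₀ ∣_) ∣g₀∣ d∣))

    -- The coefficient at m retains v(n!) - v(m!) factors p, and v(m!) < m / (p - 1) by Legendre:
    -- seen from the left end, all slopes are below 1 / (p - 1).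
    left-slopes : ∀ m → m ≤ n → 0 < m → ∃ λ v → p ^ v ∣ ∣ g m ∣ × suc p-2 * v₀ + 1 * 0 < suc p-2 * v + 1 * m
    left-slopes m m≤n 0<m = v , ∣g m (∣n⇒∣m*n (aCoef n s m) (∥⇒∣ pp exᵥ ≤-refl)) , lt
      where
      e   = proj₁ (∥-exists pp {m !} (≢-nonZero⁻¹ _ {{m !≢0}}))
      exₑ = proj₂ (∥-exists pp {m !} (≢-nonZero⁻¹ _ {{m !≢0}}))
      v   = proj₁ (∥-exists pp (asc≢0 m (n ∸ m)))
      exᵥ = proj₂ (∥-exists pp (asc≢0 m (n ∸ m)))
      v₀≡ : e + v ≡ v₀
      v₀≡ = ∥-unique pp (subst (p ^ (e + v) ∥_) (trans (asc-! m (n ∸ m)) (cong _! (m+[n∸m]≡n m≤n))) (∥-* pp exₑ exᵥ)) ex₀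
      open ≤-Reasoning
      lt : suc p-2 * v₀ + 1 * 0 < suc p-2 * v + 1 * m
      lt = begin-strict
        suc p-2 * v₀ + 1 * 0          ≡⟨ trans (+-identityʳ _) (cong (suc p-2 *_) (sym v₀≡)) ⟩
        suc p-2 * (e + v)             ≡⟨ trans (*-distribˡ-+ (suc p-2) e v) (+-comm (suc p-2 * e) _) ⟩
        suc p-2 * v + suc p-2 * e     <⟨ +-monoʳ-< (suc p-2 * v) (subst (λ z → z * e < m) (sym p-1≡) (∥!-bound pp m 0<m exₑ)) ⟩
        suc p-2 * v + m               ≡⟨ cong (suc p-2 * v +_) (sym (*-identityˡ m)) ⟩
        suc p-2 * v + 1 * m           ∎

    p∤gₙ : ¬ p ∣ ∣ g n ∣
    p∤gₙ d∣ = p∤1 pp (subst (p ∣_) ∣gₙ∣ d∣)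

    -- For m < n - l the product (m + 1)⋯n contains n - l, so p divides the coefficient and the drop
    -- u is positive. The left slopes then demand a width d > (p - 1) u ≥ k.
    excluded-large : k < p → ∀ {l} → l < k → p ∣ n ∸ l → ⊥
    excluded-large k<p {l} l<k d∣ = noFactor pp fact 0 0 p-2 1 l 0 0 v₀ (subst (_< k) (sym (+-identityʳ l)) l<k) p∤gₙ right p^∤g₀ left-slopes gap
      where
      right : ∀ m → m ≤ n → l < n ∸ m → ∃ λ v → p ^ v ∣ ∣ g m ∣ × 0 * n < 1 * v + 0 * m
      right m m≤n l< = 1 , ∣g m (∣n⇒∣m*n (aCoef n s m) (subst (_∣ asc m (n ∸ m)) (sym (*-identityʳ p))
        (∣-trans (subst (p ∣_) (sym m+i) d∣) (∣asc m 0<i (∸-monoˡ-≤ m (m∸n≤m n l)))))) , s≤s z≤n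
        where
        m<n∸l : m < n ∸ l
        m<n∸l = m+n≤o⇒m≤o∸n (suc m) (subst (_≤ n) (+-suc m l) (subst (m + suc l ≤_) (m+[n∸m]≡n m≤n) (+-monoʳ-≤ m l<)))
        m+i : m + (n ∸ l ∸ m) ≡ n ∸ l
        m+i = m+[n∸m]≡n (<⇒≤ m<n∸l)
        0<i : 0 < n ∸ l ∸ m
        0<i = m<n⇒0<n∸m m<n∸l
      gap : ∀ d u → d ≤ k → k ≤ d + (l + 0) → 0 * d < 1 * u → suc p-2 * u < 1 * d → ⊥
      gap d (suc u) d≤k _ _ lt = <⇒≱ lt (begin
        1 * d            ≡⟨ *-identityˡ d ⟩
        d                ≤⟨ d≤k ⟩
        k                ≤⟨ ∸-monoˡ-≤ 1 k<p ⟩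
        p ∸ 1            ≡⟨ sym p-1≡ ⟩
        suc p-2          ≤⟨ m≤m*n (suc p-2) (suc u) ⟩
        suc p-2 * suc u  ∎)
        where open ≤-Reasoning

    -- By `asc-p^` the right slopes are at least (1 - 1 / p^e) / (p - 1), which exceeds (1 - 1 / k)
    -- / (p - 1) as p^e > k. The left slopes are below 1 / (p - 1). For d ≤ k no integer (p - 1) u
    -- lies strictly between d - d / k and d.
    excluded-p^ : 0 < k → ∀ e → p ^ e ∣ n → k < p ^ e → ⊥
    excluded-p^ 0<k e d∣ k< = noFactor pp fact q₁-1 k′ p-2 1 0 0 0 v₀ 0<k p∤gₙ right p^∤g₀ left-slopes gap
      where
      k′ = k ∸ 1
      k≡ : suc k′ ≡ k
      k≡ = m+[n∸m]≡n 0<k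
      -- So that `suc q₁-1` is k (p - 1).
      q₁-1 = p-2 + k′ * suc p-2
      right : ∀ m → m ≤ n → 0 < n ∸ m → ∃ λ v → p ^ v ∣ ∣ g m ∣ × k′ * n < suc q₁-1 * v + k′ * m
      right m m≤n 0<t with asc-p^ pp e m (n ∸ m) (subst (p ^ e ∣_) (sym (m+[n∸m]≡n m≤n)) d∣)
      ... | v , v∣ , le = v , ∣g m (∣n⇒∣m*n (aCoef n s m) v∣) , subst (_< suc q₁-1 * v + k′ * m) n≡ (+-monoˡ-< (k′ * m) lt)
        where
        t = n ∸ m
        P = p ^ e
        n≡ : k′ * t + k′ * m ≡ k′ * n
        n≡ = trans (sym (*-distribˡ-+ k′ t m)) (cong (k′ *_) (m∸n+n≡m m≤n))
        ring₁ : ∀ k t P → suc k * (t * P) ≡ k * t * P + t * P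
        ring₁ = solve-∀
        ring₂ : ∀ k c P v t → suc k * (c * P * v + t) ≡ (suc k * c) * v * P + t * suc k
        ring₂ = solve-∀
        lt : k′ * t < suc q₁-1 * v
        lt = ≰⇒> λ ge → <⇒≱ (subst (_< P) (sym k≡) k<) (*-cancelˡ-≤ t {{>-nonZero 0<t}} (+-cancelˡ-≤ (k′ * t * P) _ _ (begin
          k′ * t * P + t * P                      ≡⟨ sym (ring₁ k′ t P) ⟩
          suc k′ * (t * P)                        ≤⟨ *-monoʳ-≤ (suc k′) le ⟩
          suc k′ * ((p ∸ 1) * P * v + t)          ≡⟨ cong (λ z → suc k′ * (z * P * v + t)) (sym p-1≡) ⟩
          suc k′ * (suc p-2 * P * v + t)          ≡⟨ ring₂ k′ (suc p-2) P v t ⟩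
          suc q₁-1 * v * P + t * suc k′           ≤⟨ +-monoˡ-≤ (t * suc k′) (*-monoˡ-≤ P ge) ⟩
          k′ * t * P + t * suc k′                 ∎)))
          where open ≤-Reasoning
      gap : ∀ d u → d ≤ k → k ≤ d + 0 → k′ * d < suc q₁-1 * u → suc p-2 * u < 1 * d → ⊥
      gap zero u _ _ _ ()
      gap (suc d) u d≤k _ lt lt′ = <⇒≱ lt (begin
        suc k′ * suc p-2 * u    ≡⟨ *-assoc (suc k′) (suc p-2) u ⟩
        suc k′ * (suc p-2 * u)  ≤⟨ *-monoʳ-≤ (suc k′) (s≤s⁻¹ (subst (suc p-2 * u <_) (*-identityˡ (suc d)) lt′)) ⟩
        d + k′ * d              ≤⟨ +-monoˡ-≤ (k′ * d) (s≤s⁻¹ (subst (suc d ≤_) (sym k≡) d≤k)) ⟩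
        k′ + k′ * d             ≡⟨ sym (*-suc k′ d) ⟩
        k′ * suc d              ∎)
        where open ≤-Reasoning

-- Boolean tests and their soundness

∧-true : ∀ {a b} → a ∧ b ≡ true → a ≡ true × b ≡ true
∧-true {true} {true} refl = refl , refl

∨-true : ∀ {a b} → a ∨ b ≡ true → a ≡ true ⊎ b ≡ true
∨-true {true} _ = inj₁ refl
∨-true {false} eq = inj₂ eq

not-true : ∀ {a} → not a ≡ true → a ≡ false
not-true {false} _ = refl

<ᵇ-true : ∀ {m n} → (m <ᵇ n) ≡ true → m < n
<ᵇ-true {m} {n} eq = <ᵇ⇒< m n (subst T (sym eq) tt)

<ᵇ-false : ∀ {m n} → (m <ᵇ n) ≡ false → n ≤ m
<ᵇ-false {m} {n} eq = ≮⇒≥ λ lt → subst T eq (<⇒<ᵇ lt)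

≡ᵇ-true : ∀ {m n} → (m ≡ᵇ n) ≡ true → m ≡ n
≡ᵇ-true {m} {n} eq = ≡ᵇ⇒≡ m n (subst T (sym eq) tt)

≡ᵇ-false : ∀ {m n} → (m ≡ᵇ n) ≡ false → m ≢ n
≡ᵇ-false {m} {n} eq e = subst T eq (≡⇒≡ᵇ m n e)

allBelow : ℕ → (ℕ → Bool) → Bool
allBelow zero    f = true
allBelow (suc n) f = f n ∧ allBelow n f

allBelow-true : ∀ n f → allBelow n f ≡ true → ∀ {i} → i < n → f i ≡ true
allBelow-true (suc n) f eq {i} (s≤s i≤n) with m≤n⇒m<n∨m≡n i≤n
... | inj₁ lt = allBelow-true n f (proj₂ (∧-true eq)) lt
... | inj₂ refl = proj₁ (∧-true {f n} eq)

anyBelow : ℕ → (ℕ → Bool) → Bool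
anyBelow zero    f = false
anyBelow (suc n) f = f n ∨ anyBelow n f

anyBelow-true : ∀ n f → anyBelow n f ≡ true → ∃ λ i → i < n × f i ≡ true
anyBelow-true (suc n) f eq with ∨-true {f n} eq
... | inj₁ e = n , ≤-refl , e
... | inj₂ e = let (i , lt , fi) = anyBelow-true n f e in i , m≤n⇒m≤1+n lt , fi

anyIn : List ℕ → (ℕ → Bool) → Bool
anyIn []       f = false
anyIn (x ∷ xs) f = f x ∨ anyIn xs f

anyIn-true : ∀ xs f → anyIn xs f ≡ true → ∃ λ x → x ∈ xs × f x ≡ true
anyIn-true (x ∷ xs) f eq with ∨-true {f x} eq
... | inj₁ e = x , here refl , e
... | inj₂ e = let (y , y∈ , fy) = anyIn-true xs f e in y , there y∈ , fy

infixl 7 _%%_ _//_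

-- Total division with remainder; n %% 0 = n and n // 0 = n.
_%%_ _//_ : ℕ → ℕ → ℕ
n %% zero  = n
n %% suc d = mod-helper 0 d n d
n // zero  = n
n // suc d = div-helper 0 d n d

%%-< : ∀ n {d} → 0 < d → n %% d < d
%%-< n {suc d} _ = m%n<n n (suc d)

//-%% : ∀ n d → 0 < d → n ≡ d * (n // d) + n %% d
//-%% n (suc d) _ = trans (m≡m%n+[m/n]*n n (suc d)) (trans (+-comm (n % suc d) _) (cong (_+ n % suc d) (*-comm (n / suc d) (suc d))))

%%≡0⇒∣ : ∀ n {d} → 0 < d → n %% d ≡ 0 → d ∣ n
%%≡0⇒∣ n {suc d} _ = m%n≡0⇒n∣m n (suc d)

∣⇒%%≡0 : ∀ n {d} → 0 < d → d ∣ n → n %% d ≡ 0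
∣⇒%%≡0 n {suc d} _ = n∣m⇒m%n≡0 n (suc d)

∣∸%% : ∀ n d → 0 < d → d ∣ n ∸ n %% d
∣∸%% n d 0<d = subst (d ∣_) (sym (trans (cong (_∸ n %% d) (//-%% n d 0<d)) (m+n∸n≡m _ (n %% d)))) (m∣m*n (n // d))

primesUpTo : ℕ → List ℕ
primesUpTo zero = []
primesUpTo (suc n) with prime? (suc n)
... | yes _ = suc n ∷ primesUpTo n
... | no _  = primesUpTo n

∈-primesUpTo : ∀ {n p} → Prime p → p ≤ n → p ∈ primesUpTo n
∈-primesUpTo {zero} pp z≤n = contradiction pp ¬prime[0]
∈-primesUpTo {suc n} pp p≤ with prime? (suc n) | m≤n⇒m<n∨m≡n p≤
... | yes _ | inj₁ (s≤s lt) = there (∈-primesUpTo pp lt)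
... | yes _ | inj₂ refl     = here refl
... | no _  | inj₁ (s≤s lt) = ∈-primesUpTo pp lt
... | no ¬p | inj₂ refl     = contradiction pp ¬p

primesUpTo-prime : ∀ {n p} → p ∈ primesUpTo n → Prime p
primesUpTo-prime {suc n} p∈ with prime? (suc n) | p∈
... | yes pr | here refl = pr
... | yes _  | there q∈ = primesUpTo-prime {n} q∈
... | no _   | q∈       = primesUpTo-prime {n} q∈

prime>0 : ∀ {p} → Prime p → 0 < p
prime>0 pp = <-≤-trans (s≤s z≤n) (prime≥2 pp)

-- Once s is used up, no further carry is possible. Exhausted fuel gives `false`, which claims
-- nothing.
noCarry : ℕ → ℕ → ℕ → ℕ → Bool
noCarry zero    p n s       = false
noCarry (suc f) p n zero    = true
noCarry (suc f) p n s@(suc _) = (n %% p + s %% p <ᵇ p) ∧ noCarry f p (n // p) (s // p)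

noCarry-sound : ∀ f {p} n s → Prime p → noCarry f p n s ≡ true → p ∤ binom n s
noCarry-sound (suc f) n zero pp _ = subst (_ ∤_) (sym (binom-zero n)) (p∤1 pp)
noCarry-sound (suc f) {p} n s@(suc _) pp eq = subst₂ (λ x y → p ∤ binom x y) (sym (//-%% n p 0<p)) (sym (//-%% s p 0<p))
  (lucas pp (n // p) (s // p) (<ᵇ-true (proj₁ both)) (noCarry-sound f (n // p) (s // p) pp (proj₂ both)))
  where
  0<p = prime>0 pp
  both = ∧-true {n %% p + s %% p <ᵇ p} eq

vpᵇ : ℕ → ℕ → ℕ → ℕ
vpᵇ zero    p x = 0
vpᵇ (suc f) p x = if x %% p ≡ᵇ 0 then suc (vpᵇ f p (x // p)) else 0

vpᵇ-∥ : ∀ f {p} x → Prime p → 0 < x → x ≤ f → p ^ vpᵇ f p x ∥ x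
vpᵇ-∥ zero (suc x) pp 0<x ()
vpᵇ-∥ (suc f) {p} x pp 0<x x≤f with x %% p ≡ᵇ 0 in eq
... | false = ∤⇒∥ pp λ d∣ → ≡ᵇ-false eq (∣⇒%%≡0 x (prime>0 pp) d∣)
... | true with vpᵇ-∥ f {p} (x // p) pp 0<q q≤f
  where
  x≡ : x ≡ p * (x // p)
  x≡ = trans (//-%% x p (prime>0 pp)) (trans (cong (p * (x // p) +_) (≡ᵇ-true eq)) (+-identityʳ _))
  0<q : 0 < x // p
  0<q = ≢0⇒0< λ z → <-irrefl refl (subst (0 <_) (trans x≡ (trans (cong (p *_) z) (*-zeroʳ p))) 0<x)
  q≤f : x // p ≤ f
  q≤f = s≤s⁻¹ (≤-trans (subst (x // p <_) (trans (*-comm (x // p) p) (sym x≡)) (m<m*n (x // p) p {{>-nonZero 0<q}} (prime≥2 pp))) x≤f)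
...   | ex = subst (p ^ suc (vpᵇ f p (x // p)) ∥_) (sym x≡) (subst (λ z → z ^ suc (vpᵇ f p (x // p)) ∥ (z * (x // p))) refl
        (∥-* pp p¹ ex))
  where
  x≡ : x ≡ p * (x // p)
  x≡ = trans (//-%% x p (prime>0 pp)) (trans (cong (p * (x // p) +_) (≡ᵇ-true eq)) (+-identityʳ _))
  p¹ : p ^ 1 ∥ p
  p¹ = subst (p ^ 1 ∥_) (*-identityʳ p) (∥-p^ pp 1)

vp : ℕ → ℕ → ℕ
vp p x = vpᵇ x p x

-- Computed Newton polygons

asc-cons : ∀ m d → asc m (suc d) ≡ suc m * asc (suc m) d
asc-cons m zero = trans (*-identityˡ (m + 1)) (trans (+-comm m 1) (sym (*-identityʳ (suc m))))
asc-cons m (suc d) = trans (cong₂ _*_ (asc-cons m d) (+-suc m (suc d))) (*-assoc (suc m) (asc (suc m) d) _)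

binom-suc : ∀ t s → binom (suc t) s * suc t ≡ binom t s * (t + suc s)
binom-suc t s = *-cancelʳ-≡ _ _ (s !) {{s !≢0}} (begin
  binom (suc t) s * suc t * s !    ≡⟨ ring₁ (binom (suc t) s) (suc t) (s !) ⟩
  suc t * (binom (suc t) s * s !)  ≡⟨ cong (suc t *_) (binom-! (suc t) s) ⟩
  suc t * asc (suc t) s            ≡⟨ sym (asc-cons t s) ⟩
  asc t s * (t + suc s)            ≡⟨ cong (_* (t + suc s)) (sym (binom-! t s)) ⟩
  binom t s * s ! * (t + suc s)    ≡⟨ ring₂ (binom t s) (s !) (t + suc s) ⟩
  binom t s * (t + suc s) * s !    ∎)
  where
  open ≡-Reasoning
  ring₁ : ∀ a b c → a * b * c ≡ b * (a * c)
  ring₁ = solve-∀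
  ring₂ : ∀ a b c → a * b * c ≡ a * c * b
  ring₂ = solve-∀

cCoef-from-top : ∀ n s t → t ≤ n → cCoef n s (n ∸ t) ≡ binom t s * asc (n ∸ t) t
cCoef-from-top n s t t≤n = cong₂ (λ x y → (x C y) * asc (n ∸ t) y) n+s∸ (m∸[m∸n]≡n t≤n)
  where
  n+s∸ : n + s ∸ (n ∸ t) ≡ t + s
  n+s∸ = trans (+-∸-comm s (m∸n≤m n t)) (cong (_+ s) (m∸[m∸n]≡n t≤n))

-- The ratio of neighbouring coefficients. It updates valuations from the leading coefficient 1
-- downwards with small numbers, where the coefficients themselves would be huge.
cCoef-suc : ∀ n s t → t < n → cCoef n s (n ∸ suc t) * suc t ≡ cCoef n s (n ∸ t) * ((n ∸ t) * (t + suc s))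
cCoef-suc n s t t<n rewrite cCoef-from-top n s (suc t) t<n | cCoef-from-top n s t (<⇒≤ t<n) = begin
  binom (suc t) s * asc (n ∸ suc t) (suc t) * suc t
    ≡⟨ cong (λ z → binom (suc t) s * z * suc t) (trans (asc-cons (n ∸ suc t) t) (cong (λ z → z * asc z t) n∸t)) ⟩
  binom (suc t) s * ((n ∸ t) * asc (n ∸ t) t) * suc t   ≡⟨ ring₁ (binom (suc t) s) (n ∸ t) (asc (n ∸ t) t) (suc t) ⟩
  binom (suc t) s * suc t * ((n ∸ t) * asc (n ∸ t) t)   ≡⟨ cong (_* ((n ∸ t) * asc (n ∸ t) t)) (binom-suc t s) ⟩
  binom t s * (t + suc s) * ((n ∸ t) * asc (n ∸ t) t)   ≡⟨ ring₂ (binom t s) (t + suc s) (n ∸ t) (asc (n ∸ t) t) ⟩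
  binom t s * asc (n ∸ t) t * ((n ∸ t) * (t + suc s))   ∎
  where
  open ≡-Reasoning
  n∸t : suc (n ∸ suc t) ≡ n ∸ t
  n∸t = trans (sym (+-∸-assoc 1 t<n)) refl
  ring₁ : ∀ a b c d → a * (b * c) * d ≡ a * d * (b * c)
  ring₁ = solve-∀
  ring₂ : ∀ a b c d → a * b * (c * d) ≡ a * d * (c * b)
  ring₂ = solve-∀

binom≢0 : ∀ n s → binom n s ≢ 0
binom≢0 n s eq = asc≢0 n s (trans (sym (binom-! n s)) (cong (_* s !) eq))

cCoef≢0 : ∀ n s t → t ≤ n → cCoef n s (n ∸ t) ≢ 0
cCoef≢0 n s t t≤n eq with m*n≡0⇒m≡0∨n≡0 (binom t s) (trans (sym (cCoef-from-top n s t t≤n)) eq)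
... | inj₁ z = binom≢0 t s z
... | inj₂ z = asc≢0 (n ∸ t) t z

-- By `cCoef-suc` the subtraction never truncates when v is the valuation of the coefficient at n -
-- t.
step : ℕ → ℕ → ℕ → ℕ → ℕ → ℕ
step p n s t v = v + (vp p (n ∸ t) + vp p (t + suc s)) ∸ vp p (suc t)

step-∥ : ∀ {p} → Prime p → ∀ n s t {v} → t < n → p ^ v ∥ cCoef n s (n ∸ t) → p ^ step p n s t v ∥ cCoef n s (n ∸ suc t)
step-∥ {p} pp n s t {v} t<n ex with ∥-exists pp (cCoef≢0 n s (suc t) t<n)
... | v′ , ex′ = subst (p ^_∥ cCoef n s (n ∸ suc t)) (sym (trans (cong (_∸ vp p (suc t)) (sym v′+)) (m+n∸n≡m v′ (vp p (suc t))))) ex′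
  where
  vp-∥ : ∀ {x} → 0 < x → p ^ vp p x ∥ x
  vp-∥ {x} 0<x = vpᵇ-∥ x x pp 0<x ≤-refl
  v′+ : v′ + vp p (suc t) ≡ v + (vp p (n ∸ t) + vp p (t + suc s))
  v′+ = ∥-unique pp (subst (p ^ (v′ + vp p (suc t)) ∥_) (cCoef-suc n s t t<n) (∥-* pp ex′ (vp-∥ (s≤s z≤n))))
    (∥-* pp ex (∥-* pp (vp-∥ (m<n⇒0<n∸m t<n)) (vp-∥ (subst (0 <_) (sym (+-suc t s)) (s≤s z≤n)))))

-- The valuation of the constant coefficient, provided the right end of the polygon is steep enough.
rightPass : (p n s q a l : ℕ) → (r t v : ℕ) → Maybe ℕ
rightPass p n s q a l zero    t v = if (t <ᵇ suc l) ∨ (a * t <ᵇ q * v) then just v else nothing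
rightPass p n s q a l (suc r) t v = if (t <ᵇ suc l) ∨ (a * t <ᵇ q * v) then rightPass p n s q a l r (suc t) (step p n s t v) else nothing

-- A second pass, because v₀ is known only at the end of the first. Here r = n - t is the index of
-- the coefficient in hand.
leftPass : (p n s q a l v₀ : ℕ) → (r t v : ℕ) → Bool
leftPass p n s q a l v₀ zero    t v = (0 <ᵇ suc l) ∨ (q * v₀ <ᵇ q * v + a * 0)
leftPass p n s q a l v₀ (suc r) t v = ((suc r <ᵇ suc l) ∨ (q * v₀ <ᵇ q * v + a * suc r)) ∧ leftPass p n s q a l v₀ r (suc t) (step p n s t v)

-- The range of u suffices because u ≤ q₂ u < a₂ d ≤ a₂ k for q₂ ≥ 1.
gapᵇ : (q₁ a₁ q₂ a₂ k : ℕ) → Bool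
gapᵇ q₁ a₁ q₂ a₂ k = allBelow (suc k) λ d → allBelow (suc (a₂ * k)) λ u → not ((a₁ * d <ᵇ q₁ * u) ∧ (q₂ * u <ᵇ a₂ * d))

polygonᵇ : (p n s k q₁-1 a₁ q₂-1 a₂ l l′ : ℕ) → Bool
polygonᵇ p n s k q₁-1 a₁ q₂-1 a₂ l l′ with rightPass p n s (suc q₁-1) a₁ l n 0 0
... | nothing = false
... | just v₀ = (l + l′ <ᵇ k) ∧ (gapᵇ (suc q₁-1) a₁ (suc q₂-1) a₂ k ∧ leftPass p n s (suc q₂-1) a₂ l′ v₀ n 0 0)

module _ {p} (pp : Prime p) (n s : ℕ) where

  private
    suc≤ : ∀ {t r} → t + suc r ≡ n → suc t + r ≡ n
    suc≤ {t} {r} eq = trans (sym (+-suc t r)) eq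
    t<n : ∀ {t r} → t + suc r ≡ n → t < n
    t<n {t} {r} eq = subst (suc t ≤_) (suc≤ eq) (m≤m+n (suc t) r)

  rightPass-sound : ∀ {q a l v₀} r t v → t + r ≡ n → p ^ v ∥ cCoef n s (n ∸ t) → rightPass p n s q a l r t v ≡ just v₀ →
    p ^ v₀ ∥ cCoef n s 0 × (∀ t′ → t ≤ t′ → t′ ≤ n → l < t′ → ∃ λ v → p ^ v ∥ cCoef n s (n ∸ t′) × a * t′ < q * v)
  rightPass-sound {q} {a} {l} zero t v t+r ex eq with (t <ᵇ suc l) ∨ (a * t <ᵇ q * v) in ok | eq
  ... | true | refl = subst (λ z → p ^ v ∥ cCoef n s z) (trans (cong (n ∸_) t≡n) (n∸n≡0 n)) ex , at
    where
    t≡n = trans (sym (+-identityʳ t)) t+r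
    at : ∀ t′ → t ≤ t′ → t′ ≤ n → l < t′ → ∃ λ v → p ^ v ∥ cCoef n s (n ∸ t′) × a * t′ < q * v
    at t′ t≤ t′≤n l< with ≤-antisym t≤ (subst (t′ ≤_) (sym t≡n) t′≤n)
    ... | refl with ∨-true {t <ᵇ suc l} ok
    ...   | inj₁ e = contradiction l< (<⇒≱ (<ᵇ-true e))
    ...   | inj₂ e = v , ex , <ᵇ-true e
  rightPass-sound {q} {a} {l} (suc r) t v t+r ex eq with (t <ᵇ suc l) ∨ (a * t <ᵇ q * v) in ok
  ... | true = proj₁ IH , at
    where
    IH = rightPass-sound {q} {a} {l} r (suc t) (step p n s t v) (suc≤ t+r) (step-∥ pp n s t (t<n t+r) ex) eq
    at : ∀ t′ → t ≤ t′ → t′ ≤ n → l < t′ → ∃ λ v → p ^ v ∥ cCoef n s (n ∸ t′) × a * t′ < q * v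
    at t′ t≤ t′≤n l< with m≤n⇒m<n∨m≡n t≤
    ... | inj₁ lt = proj₂ IH t′ lt t′≤n l<
    ... | inj₂ refl with ∨-true {t <ᵇ suc l} ok
    ...   | inj₁ e = contradiction l< (<⇒≱ (<ᵇ-true e))
    ...   | inj₂ e = v , ex , <ᵇ-true e

  leftPass-sound : ∀ {q a l v₀} r t v → t + r ≡ n → p ^ v ∥ cCoef n s (n ∸ t) → leftPass p n s q a l v₀ r t v ≡ true →
    ∀ m → m ≤ r → l < m → ∃ λ v → p ^ v ∥ cCoef n s m × q * v₀ < q * v + a * m
  leftPass-sound zero t v t+r ex eq .0 z≤n ()
  leftPass-sound {q} {a} {l} {v₀} (suc r) t v t+r ex eq m m≤ l<m with ∧-true {(suc r <ᵇ suc l) ∨ (q * v₀ <ᵇ q * v + a * suc r)} eq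
  ... | here′ , rest with m≤n⇒m<n∨m≡n m≤
  ...   | inj₁ (s≤s lt) = leftPass-sound {q} {a} {l} {v₀} r (suc t) (step p n s t v) (suc≤ t+r) (step-∥ pp n s t (t<n t+r) ex) rest m lt l<m
  ...   | inj₂ refl with ∨-true {suc r <ᵇ suc l} here′
  ...     | inj₁ e = contradiction l<m (<⇒≱ (<ᵇ-true e))
  ...     | inj₂ e = v , subst (λ z → p ^ v ∥ cCoef n s z) (trans (cong (_∸ t) (sym t+r)) (m+n∸m≡n t (suc r))) ex , <ᵇ-true e

gapᵇ-sound : ∀ q₁ a₁ q₂-1 a₂ k → gapᵇ q₁ a₁ (suc q₂-1) a₂ k ≡ true → ∀ d u → d ≤ k → a₁ * d < q₁ * u → suc q₂-1 * u < a₂ * d → ⊥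
gapᵇ-sound q₁ a₁ q₂-1 a₂ k eq d u d≤k lt lt′
  with allBelow-true (suc (a₂ * k)) _ (allBelow-true (suc k) _ eq (s≤s d≤k)) u<
  where
  u< : u < suc (a₂ * k)
  u< = s≤s (≤-trans (m≤m+n u (q₂-1 * u)) (≤-trans (<⇒≤ lt′) (*-monoʳ-≤ a₂ d≤k)))
... | e with (a₁ * d <ᵇ q₁ * u) in e₁ | (suc q₂-1 * u <ᵇ a₂ * d) in e₂ | e
...   | true | true | ()
...   | false | _ | _ = <⇒≱ lt (<ᵇ-false e₁)
...   | true | false | _ = <⇒≱ lt′ (<ᵇ-false e₂)

polygonᵇ-sound : ∀ {p} → Prime p → ∀ n s k q₁-1 a₁ q₂-1 a₂ l l′ → polygonᵇ p n s k q₁-1 a₁ q₂-1 a₂ l l′ ≡ true →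
  (b : Fin (suc n) → ℤ) → ∣ b fzero ∣ ≡ 1 → ∣ b (fromℕ n) ∣ ≡ 1 → Factorisation n k (gCoef n s b) → ⊥
polygonᵇ-sound {p} pp n s k q₁-1 a₁ q₂-1 a₂ l l′ eq b b₀≡1 bₙ≡1 fact with rightPass p n s (suc q₁-1) a₁ l n 0 0 in eqR
... | just v₀ with ∧-true {l + l′ <ᵇ k} eq
...   | l+l′< , eq′ with ∧-true {gapᵇ (suc q₁-1) a₁ (suc q₂-1) a₂ k} eq′
...     | gap , eqL = noFactor pp fact q₁-1 a₁ q₂-1 a₂ l l′ 0 v₀ (<ᵇ-true l+l′<) p∤gₙ right p^∤ left
            λ d u d≤k _ → gapᵇ-sound (suc q₁-1) a₁ q₂-1 a₂ k gap d u d≤k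
  where
  open Criteria n s k b b₀≡1 bₙ≡1 fact using (g; ∣g; ∣g₀∣; ∣gₙ∣)
  top : p ^ 0 ∥ cCoef n s (n ∸ 0)
  top = subst (p ^ 0 ∥_) (sym (cCoef-top n s)) (∤⇒∥ pp (p∤1 pp))
  R = rightPass-sound pp n s {suc q₁-1} {a₁} {l} n 0 0 refl top eqR
  p∤gₙ : ¬ p ∣ ∣ g n ∣
  p∤gₙ d∣ = p∤1 pp (subst (p ∣_) ∣gₙ∣ d∣)
  p^∤ : ¬ p ^ suc v₀ ∣ ∣ g 0 ∣
  p^∤ d∣ = <-irrefl refl (∥⇒≤ pp (proj₁ R) (subst (p ^ suc v₀ ∣_) (trans ∣g₀∣ (sym (cong (binom n s *_) (asc-0 n)))) d∣))
  right : ∀ m → m ≤ n → l < n ∸ m → ∃ λ v → p ^ v ∣ ∣ g m ∣ × a₁ * n < suc q₁-1 * v + a₁ * m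
  right m m≤n l< with proj₂ R (n ∸ m) z≤n (m∸n≤m n m) l<
  ... | v , ex , lt = v , ∣g m (∥⇒∣ pp (subst (λ z → p ^ v ∥ cCoef n s z) (m∸[m∸n]≡n m≤n) ex) ≤-refl) ,
    subst (_< suc q₁-1 * v + a₁ * m) (trans (sym (*-distribˡ-+ a₁ (n ∸ m) m)) (cong (a₁ *_) (m∸n+n≡m m≤n))) (+-monoˡ-< (a₁ * m) lt)
  left : ∀ m → m ≤ n → l′ < m → ∃ λ v → p ^ v ∣ ∣ g m ∣ × suc q₂-1 * v₀ + a₂ * 0 < suc q₂-1 * v + a₂ * m
  left m m≤n l′< with leftPass-sound pp n s {suc q₂-1} {a₂} {l′} {v₀} n 0 0 refl top eqL m m≤n l′<
  ... | v , ex , lt = v , ∣g m (∥⇒∣ pp ex ≤-refl) , subst (_< suc q₂-1 * v + a₂ * m) (sym (trans (cong (suc q₂-1 * v₀ +_) (*-zeroʳ a₂)) (+-identityʳ _))) lt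

-- Search with the Chinese remainder theorem

-- Extended Euclid; the coefficients alternate in sign, so only their absolute values are carried.
inverse : ℕ → Bool → (q r₀ r₁ t₀ t₁ : ℕ) → ℕ
inverse zero    σ     q r₀ r₁       t₀ t₁ = 0
inverse (suc f) true  q r₀ zero     t₀ t₁ = t₀
inverse (suc f) false q r₀ zero     t₀ t₁ = q ∸ t₀
inverse (suc f) σ     q r₀ (suc r₁) t₀ t₁ = inverse f (not σ) q (suc r₁) (mod-helper 0 r₁ r₀ r₁) t₁ (t₀ + div-helper 0 r₁ r₀ r₁ * t₁)

-- option c q ts: the exact power c of the prime divides n, and n modulo q lies in ts
data Option : Set where
  option : (c q : ℕ) → List ℕ → Option

-- `rest` is the product of the caps of all later primes, stored so that the bound D is updated by a
-- multiplication.
data Item : Set where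
  item : List Option → (rest : ℕ) → Item

module Search (check : ℕ → Bool) where

  candidate : ℕ → ℕ → Bool
  candidate D n = if D %% n ≡ᵇ 0 then check n else true

  scan : Bool → (f D M n : ℕ) → Bool
  scan true  f       D M n = true
  scan false zero    D M n = false
  scan false (suc f) D M n = candidate D n ∧ scan (D <ᵇ n + M) f D M (n + M)

  scanFrom : (D M n : ℕ) → Bool
  scanFrom D M n = scan (D <ᵇ n) (suc (D // M)) D M n

  -- n divides D, n ≡ a (mod M), and cur is the part of D whose primes have been treated.
  -- Once D / M is small, the remaining n are enumerated.
  mutual
    search : Bool → List Item → (cur D M a : ℕ) → Bool
    search true  items                    cur D M a = scanFrom D M a
    search false []                       cur D M a = scanFrom D M a
    search false (item opts rest ∷ items) cur D M a = enter items cur (cur * rest) M a ∧ options opts items cur rest M a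

    -- The factors 8 here and 16 in `options` only balance the cost of scanning against that of
    -- branching; soundness holds for either value of the flag.
    enter : List Item → (cur D M a : ℕ) → Bool
    enter items cur D M a = search (D <ᵇ M * 8) items cur D M a

    options : List Option → List Item → (cur rest M a : ℕ) → Bool
    options []                    items cur rest M a = true
    options (option c q ts ∷ opts) items cur rest M a =
      choose (cur * c * rest <ᵇ M * c * 16) c q ts items (cur * c) (cur * c * rest) M a ∧ options opts items cur rest M a

    choose : Bool → (c q : ℕ) → List ℕ → List Item → (cur D M a : ℕ) → Bool
    choose true  c q ts items cur D M a = coarse c (inverse 64 false c c (M %% c) 0 1) D M a
    choose false c q ts items cur D M a = group q (inverse 64 false q q (M %% q) 0 1) ts items cur D M a

    -- When few numbers up to D are left, the single class 0 modulo c is cheaper than the classes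
    -- modulo q. The inverse is verified by multiplication, so that `inverse` itself carries no
    -- proof.
    coarse : (c inv D M a : ℕ) → Bool
    coarse c inv D M a = ((M * inv) %% c ≡ᵇ 1) ∧ scanFrom D (M * c) (a + M * (((c ∸ a %% c) * inv) %% c))

    group : (q inv : ℕ) → List ℕ → List Item → (cur D M a : ℕ) → Bool
    group q inv ts items cur D M a = ((M * inv) %% q ≡ᵇ 1) ∧ residues (D <ᵇ M * q * 8) ts items q inv (q ∸ a %% q) cur D M (M * q) a

    -- Solves a + M u = t modulo q, where w = q - (a mod q) stands for -a.
    residues : Bool → List ℕ → List Item → (q inv w cur D M Mq a : ℕ) → Bool
    residues small []       items q inv w cur D M Mq a = true
    residues small (t ∷ ts) items q inv w cur D M Mq a =
      search small items cur D Mq (a + M * (((t + w) * inv) %% q)) ∧ residues small ts items q inv w cur D M Mq a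

  candidate-sound : ∀ D n → n ∣ D → 0 < n → candidate D n ≡ true → check n ≡ true
  candidate-sound D n n∣D 0<n eq with D %% n ≡ᵇ 0 in e | eq
  ... | true  | ok = ok
  ... | false | _  = contradiction (∣⇒%%≡0 D 0<n n∣D) (≡ᵇ-false e)

  scan-sound : ∀ f D M n y → n + M * y ≤ D → (n + M * y) ∣ D → 0 < n + M * y → scan (D <ᵇ n) f D M n ≡ true → check (n + M * y) ≡ true
  scan-sound f D M n y ≤D ∣D 0< eq with D <ᵇ n in D<n
  ... | true = contradiction (<-≤-trans (<ᵇ-true {D} {n} D<n) (m≤m+n n (M * y))) (≤⇒≯ ≤D)
  scan-sound (suc f) D M n zero ≤D ∣D 0< eq | false = trans (cong check n≡)
    (candidate-sound D n (subst (_∣ D) n≡ ∣D) (subst (0 <_) n≡ 0<) (proj₁ (∧-true {candidate D n} eq)))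
    where
    n≡ : n + M * 0 ≡ n
    n≡ = trans (cong (n +_) (*-zeroʳ M)) (+-identityʳ n)
  scan-sound (suc f) D M n (suc y) ≤D ∣D 0< eq | false = subst (λ z → check z ≡ true) n≡
    (scan-sound f D M (n + M) y (subst (_≤ D) (sym n≡) ≤D) (subst (_∣ D) (sym n≡) ∣D) (subst (0 <_) (sym n≡) 0<) (proj₂ (∧-true {candidate D n} eq)))
    where
    n≡ : n + M + M * y ≡ n + M * suc y
    n≡ = trans (+-assoc n M (M * y)) (cong (n +_) (sym (*-suc M y)))

  itemsFor : (cap : ℕ → ℕ) (opts : ℕ → List Option) → List ℕ → List Item
  capProduct : (ℕ → ℕ) → List ℕ → ℕ
  capProduct cap [] = 1
  capProduct cap (p ∷ ps) = cap p * capProduct cap ps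
  itemsFor cap opts [] = []
  itemsFor cap opts (p ∷ ps) = item (opts p) (capProduct cap ps) ∷ itemsFor cap opts ps

  ∣p^-cancel : ∀ {p} → Prime p → ∀ i {x Y} → p ∤ x → x ∣ p ^ i * Y → x ∣ Y
  ∣p^-cancel pp zero {x} {Y} p∤x d∣ = subst (x ∣_) (*-identityˡ Y) d∣
  ∣p^-cancel {p} pp (suc i) {x} {Y} p∤x (divides z eq) with euclidsLemma z x pp (subst (p ∣_) (trans (sym (*-assoc p (p ^ i) Y)) eq) (m∣m*n (p ^ i * Y)))
  ... | inj₂ p∣x = contradiction p∣x p∤x
  ... | inj₁ (divides z′ refl) = ∣p^-cancel pp i p∤x (divides z′ (*-cancelˡ-≡ _ _ p {{prime⇒nonZero pp}}
        (trans (sym (*-assoc p (p ^ i) Y)) (trans eq (trans (cong (_* x) (*-comm z′ p)) (*-assoc p z′ x))))))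

  ≡%%⇒∣∸ : ∀ {q} x y → 0 < q → y ≤ x → x %% q ≡ y %% q → q ∣ x ∸ y
  ≡%%⇒∣∸ {q} x y 0<q y≤x eq = subst (q ∣_) (begin
    q * (x // q) ∸ q * (y // q)                         ≡⟨ sym ([m+n]∸[m+o]≡n∸o (x %% q) (q * (x // q)) (q * (y // q))) ⟩
    (x %% q + q * (x // q)) ∸ (x %% q + q * (y // q))   ≡⟨ cong₂ _∸_ (trans (+-comm (x %% q) _) (sym (//-%% x q 0<q)))
      (trans (cong (_+ q * (y // q)) eq) (trans (+-comm (y %% q) _) (sym (//-%% y q 0<q)))) ⟩
    x ∸ y                                               ∎)
    (subst (q ∣_) (*-distribˡ-∸ q (x // q) (y // q)) (m∣m*n (x // q ∸ y // q)))
    where open ≡-Reasoning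

  unit-cancel : ∀ {q M inv} d → 0 < q → (M * inv) %% q ≡ 1 → q ∣ M * d → q ∣ d
  unit-cancel {q} {M} {inv} d 0<q inv≡ q∣ = ∣m+n∣m⇒∣n (subst (q ∣_) (begin
    inv * (M * d)                                ≡⟨ ring inv M d ⟩
    M * inv * d                                  ≡⟨ cong (_* d) (trans (//-%% (M * inv) q 0<q) (cong (q * ((M * inv) // q) +_) inv≡)) ⟩
    (q * ((M * inv) // q) + 1) * d               ≡⟨ trans (*-distribʳ-+ d (q * ((M * inv) // q)) 1) (cong (q * ((M * inv) // q) * d +_) (*-identityˡ d)) ⟩
    q * ((M * inv) // q) * d + d                 ∎) (∣n⇒∣m*n inv q∣)) (∣m⇒∣m*n d (m∣m*n ((M * inv) // q)))
    where
    open ≡-Reasoning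
    ring : ∀ a b c → a * (b * c) ≡ b * a * c
    ring = solve-∀

  residue-unique : ∀ {q M a inv v w} → 0 < q → (M * inv) %% q ≡ 1 → w ≤ v → (a + M * v) %% q ≡ (a + M * w) %% q → q ∣ v ∸ w
  residue-unique {q} {M} {a} {inv} {v} {w} 0<q inv≡ w≤v eq = unit-cancel {q} {M} {inv} (v ∸ w) 0<q inv≡
    (subst (q ∣_) (trans ([m+n]∸[m+o]≡n∸o a (M * v) (M * w)) (sym (*-distribˡ-∸ M v w)))
      (≡%%⇒∣∸ (a + M * v) (a + M * w) 0<q (+-monoʳ-≤ a (*-monoʳ-≤ M w≤v)) eq))

  shift-residue : ∀ {q M a inv t} → t < q → (M * inv) %% q ≡ 1 → (a + M * (((t + (q ∸ a %% q)) * inv) %% q)) %% q ≡ t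
  shift-residue {q} {M} {a} {inv} {t} t<q inv≡ = +-cancelˡ-≡ (q * X) _ _ (trans (sym x≡) x≡′)
    where
    0<q = ≤-<-trans z≤n t<q
    w = t + (q ∸ a %% q)
    u = (w * inv) %% q
    x = a + M * u
    d = (w * inv) // q
    c = (M * inv) // q
    A = a // q
    X = x // q
    open ≡-Reasoning
    ring₁ : ∀ a M u q d → a + M * u + q * (M * d) ≡ a + M * (q * d + u)
    ring₁ = solve-∀
    ring₂ : ∀ a M w i → a + M * (w * i) ≡ a + w * (M * i)
    ring₂ = solve-∀
    ring₃ : ∀ q A r t e c → q * A + r + (t + e) * (q * c + 1) ≡ q * (A + c * (t + e)) + t + (r + e)
    ring₃ = solve-∀
    ring₄ : ∀ q B t → q * B + t + q ≡ q * suc B + t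
    ring₄ = solve-∀
    total : x + q * (M * d) ≡ q * suc (A + c * w) + t
    total = begin
      a + M * u + q * (M * d)                     ≡⟨ ring₁ a M u q d ⟩
      a + M * (q * d + u)                         ≡⟨ cong (λ z → a + M * z) (sym (//-%% (w * inv) q 0<q)) ⟩
      a + M * (w * inv)                           ≡⟨ ring₂ a M w inv ⟩
      a + w * (M * inv)                           ≡⟨ cong₂ (λ y z → y + w * z) (//-%% a q 0<q) (trans (//-%% (M * inv) q 0<q) (cong (q * c +_) inv≡)) ⟩
      q * A + a %% q + w * (q * c + 1)            ≡⟨ ring₃ q A (a %% q) t (q ∸ a %% q) c ⟩
      q * (A + c * w) + t + (a %% q + (q ∸ a %% q)) ≡⟨ cong (q * (A + c * w) + t +_) (m+[n∸m]≡n (<⇒≤ (%%-< a 0<q))) ⟩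
      q * (A + c * w) + t + q                     ≡⟨ ring₄ q (A + c * w) t ⟩
      q * suc (A + c * w) + t                     ∎
    x≡ : x ≡ q * X + x %% q
    x≡ = //-%% x q 0<q
    ring₅ : ∀ q X r Y → q * X + r + q * Y ≡ q * (X + Y) + r
    ring₅ = solve-∀
    quots : X + M * d ≡ suc (A + c * w)
    quots = divMod-unique (%%-< x 0<q) t<q (trans (sym (ring₅ q X (x %% q) (M * d))) (trans (cong (_+ q * (M * d)) (sym x≡)) total))
    x≡′ : x ≡ q * X + t
    x≡′ = +-cancelʳ-≡ (q * (M * d)) _ _ (trans total (trans (cong (λ z → q * z + t) (sym quots)) (sym (ring₅ q X t (M * d)))))

  -- As u is the least solution, y = u + q z with z ≥ 0, and the refined progression starting at a +
  -- M u misses no n.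
  crt : ∀ {q M a inv t u y} → 0 < q → (M * inv) %% q ≡ 1 → (a + M * u) %% q ≡ t → (a + M * y) %% q ≡ t → u < q →
    ∃ λ z → a + M * y ≡ a + M * u + M * q * z
  crt {q} {M} {a} {inv} {t} {u} {y} 0<q inv≡ x≡t n≡t u<q with u ≤? y
  ... | no u≰y = contradiction (∣⇒≤′ (m<n⇒0<n∸m (≰⇒> u≰y))
    (residue-unique {q} {M} {a} {inv} {u} {y} 0<q inv≡ (<⇒≤ (≰⇒> u≰y)) (trans x≡t (sym n≡t)))) (<⇒≱ (≤-<-trans (m∸n≤m u y) u<q))
  ... | yes u≤y with residue-unique {q} {M} {a} {inv} {y} {u} 0<q inv≡ u≤y (trans n≡t (sym x≡t))
  ...   | divides z eq = z , (begin
    a + M * y               ≡⟨ cong (λ w → a + M * w) (trans (sym (m+[n∸m]≡n u≤y)) (cong (u +_) eq)) ⟩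
    a + M * (u + z * q)     ≡⟨ ring a M u z q ⟩
    a + M * u + M * q * z   ∎)
    where
    open ≡-Reasoning
    ring : ∀ a M u z q → a + M * (u + z * q) ≡ a + M * u + M * q * z
    ring = solve-∀

  record Covered (cap : ℕ → ℕ) (opts : ℕ → List Option) (n p : ℕ) : Set where
    field
      isPrime : Prime p
      e E    : ℕ
      cap≡   : cap p ≡ p ^ E
      e≤E    : e ≤ E
      exact  : p ^ e ∥ n
      chosen : e ≡ 0 ⊎ ∃ λ q → ∃ λ ts → option (p ^ e) q ts ∈ opts p × 0 < q × (n %% q) ∈ ts

  module _ (cap : ℕ → ℕ) (opts : ℕ → List Option) where

    private
      D : List ℕ → ℕ
      D = capProduct cap

    caps>0 : ∀ {n} ps → (∀ {p} → p ∈ ps → Covered cap opts n p) → 0 < D ps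
    caps>0 [] cov = s≤s z≤n
    caps>0 (p ∷ ps) cov = subst (λ z → 0 < z * D ps) (sym cap≡) (*-mono-< (m^n>0 p {{prime⇒nonZero isPrime}} E) (caps>0 ps (cov ∘ there)))
      where open Covered (cov (here refl))

    ∣caps : ∀ n ps → 0 < n → (∀ {p} → p ∈ ps → Covered cap opts n p) → (∀ {p} → Prime p → p ∣ n → p ∈ ps) → n ∣ D ps
    ∣caps n ps 0<n cov all = go ps n 0<n (λ p∈ → let open Covered (cov p∈) in isPrime , e , E , cap≡ , e≤E , exact) all
      where
      Bounded : ℕ → ℕ → Set
      Bounded n p = Prime p × ∃ λ e → ∃ λ E → cap p ≡ p ^ E × e ≤ E × p ^ e ∥ n
      go : ∀ ps n → 0 < n → (∀ {p} → p ∈ ps → Bounded n p) → (∀ {p} → Prime p → p ∣ n → p ∈ ps) → n ∣ D ps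
      go [] 1 0<n bd all = ∣-refl
      go [] (suc (suc n)) 0<n bd all with primeDivisor {suc (suc n)} (s≤s (s≤s z≤n))
      ... | p , pp , p∣ with all pp p∣
      ...   | ()
      go (p ∷ ps) n 0<n bd all with bd (here refl)
      ... | pp , e , E , cap≡ , e≤E , exactly w refl p∤w = *-pres-∣ (subst (p ^ e ∣_) (sym cap≡) (∥⇒∣ pp (∥-p^ pp E) e≤E))
        (go ps w 0<w bd′ all′)
        where
        0<w : 0 < w
        0<w = ≢0⇒0< λ { refl → p∤w (p ∣0) }
        bd′ : ∀ {r} → r ∈ ps → Bounded w r
        bd′ {r} r∈ with bd (there r∈)
        ... | pr , d , E′ , cap≡′ , d≤ , ex with ∥-exists pr (λ w≡0 → <-irrefl (sym w≡0) 0<w)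
        ...   | d′ , ex′ = pr , d′ , E′ , cap≡′ , ≤-trans (∥⇒≤ pr ex (∣n⇒∣m*n (p ^ e) (∥⇒∣ pr ex′ ≤-refl))) d≤ , ex′
        all′ : ∀ {r} → Prime r → r ∣ w → r ∈ ps
        all′ pr r∣w with all pr (∣n⇒∣m*n (p ^ e) r∣w)
        ... | here refl = contradiction r∣w p∤w
        ... | there r∈ = r∈

    -- Fixing the exact exponent e lowers the bound by the factor p^(E - e): the cofactor of n is
    -- prime to p and has no share in the surplus.
    keep : ∀ {n p} → (c : Covered cap opts n p) → ∀ cur rest → n ∣ cur * (cap p * rest) → n ∣ cur * p ^ Covered.e c * rest
    keep {n} {p} c cur rest n∣ with Covered.exact c
    ... | exactly w n≡ p∤w = subst₂ _∣_ (sym n≡) (ring (p ^ e) cur rest) (*-monoʳ-∣ (p ^ e)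
      (∣p^-cancel isPrime (E ∸ e) p∤w (*-cancelˡ-∣ (p ^ e) {{m^n≢0 p e {{prime⇒nonZero isPrime}}}} (subst₂ _∣_ n≡ (begin
        cur * (cap p * rest)                     ≡⟨ cong (λ z → cur * (z * rest)) (trans cap≡ (trans (cong (p ^_) (sym (m+[n∸m]≡n e≤E))) (^-distribˡ-+-* p e (E ∸ e)))) ⟩
        cur * (p ^ e * p ^ (E ∸ e) * rest)       ≡⟨ ring′ cur (p ^ e) (p ^ (E ∸ e)) rest ⟩
        p ^ e * (p ^ (E ∸ e) * (cur * rest))     ∎) n∣))))
      where
      open Covered c
      open ≡-Reasoning
      ring : ∀ P c r → P * (c * r) ≡ c * P * r
      ring = solve-∀
      ring′ : ∀ c P Q r → c * (P * Q * r) ≡ P * (Q * (c * r))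
      ring′ = solve-∀

    module _ (n : ℕ) (0<n : 0 < n) where

      scan-all : ∀ {D M a y} → 0 < D → n ∣ D → n ≡ a + M * y → scanFrom D M a ≡ true → check n ≡ true
      scan-all {D} {M} {a} {y} 0<D n∣ refl eq = scan-sound (suc (D // M)) D M a y (∣⇒≤′ 0<D n∣) n∣ 0<n eq

      coarse-sound : ∀ {c inv D M a y} → 0 < c → c ∣ n → 0 < D → n ∣ D → n ≡ a + M * y → coarse c inv D M a ≡ true → check n ≡ true
      coarse-sound {c} {inv} {D} {M} {a} {y} 0<c c∣n 0<D n∣ n≡ eq =
        let (inv≡ , eq′) = ∧-true {(M * inv) %% c ≡ᵇ 1} eq
            (z , n≡′) = crt {c} {M} {a} {inv} {0} {((c ∸ a %% c) * inv) %% c} {y} 0<c (≡ᵇ-true inv≡)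
              (shift-residue {c} {M} {a} {inv} {0} 0<c (≡ᵇ-true inv≡)) (trans (cong (_%% c) (sym n≡)) (∣⇒%%≡0 n 0<c c∣n)) (%%-< ((c ∸ a %% c) * inv) 0<c)
        in scan-all {D} {M * c} {_} {z} 0<D n∣ (trans n≡ n≡′) eq′

      mutual
        search-sound : ∀ ps {cur D′ M a y small} → (∀ {p} → p ∈ ps → Covered cap opts n p) → 0 < cur → D′ ≡ cur * D ps → n ∣ D′ → n ≡ a + M * y →
          search small (itemsFor cap opts ps) cur D′ M a ≡ true → check n ≡ true
        search-sound ps {cur} {_} {M} {a} {y} {true} cov 0<cur refl n∣ n≡ eq = scan-all {M = M} {a} {y} (*-mono-< 0<cur (caps>0 ps cov)) n∣ n≡ eq
        search-sound [] {cur} {_} {M} {a} {y} {false} cov 0<cur refl n∣ n≡ eq = scan-all {M = M} {a} {y} (*-mono-< 0<cur (s≤s z≤n)) n∣ n≡ eq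
        search-sound (p ∷ ps) {cur} {_} {M} {a} {y} {false} cov 0<cur refl n∣ n≡ eq =
          split (∧-true {enter (itemsFor cap opts ps) cur (cur * D ps) M a} eq) (Covered.chosen c)
          where
          c = cov (here refl)
          0<p^e = m^n>0 p {{prime⇒nonZero (Covered.isPrime c)}} (Covered.e c)
          split : enter (itemsFor cap opts ps) cur (cur * D ps) M a ≡ true × options (opts p) (itemsFor cap opts ps) cur (D ps) M a ≡ true →
            Covered.e c ≡ 0 ⊎ (∃ λ q → ∃ λ ts → option (p ^ Covered.e c) q ts ∈ opts p × 0 < q × (n %% q) ∈ ts) → check n ≡ true
          split (none , _) (inj₁ e≡0) = search-sound ps {cur} {_} {M} {a} {y} {cur * D ps <ᵇ M * 8} (cov ∘ there) 0<cur refl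
            (subst (λ z → n ∣ z * D ps) (trans (cong (λ z → cur * p ^ z) e≡0) (*-identityʳ cur)) (keep c cur (D ps) n∣)) n≡ none
          split (_ , some) (inj₂ (q , ts , o∈ , 0<q , t∈)) = options-sound ps {cur} {M} {a} {y} {q = q} {ts} {opts p} (cov ∘ there) 0<p^e
            (∥⇒∣ (Covered.isPrime c) (Covered.exact c) ≤-refl) (*-mono-< 0<cur 0<p^e) (keep c cur (D ps) n∣) n≡ o∈ 0<q t∈ some

        options-sound : ∀ ps {cur M a y c q ts os} → (∀ {p} → p ∈ ps → Covered cap opts n p) → 0 < c → c ∣ n → 0 < cur * c → n ∣ cur * c * D ps → n ≡ a + M * y →
          option c q ts ∈ os → 0 < q → (n %% q) ∈ ts → options os (itemsFor cap opts ps) cur (D ps) M a ≡ true → check n ≡ true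
        options-sound ps {cur} {M} {a} {y} {c} {q} {ts} {_ ∷ os} cov 0<c c∣n 0<cur n∣ n≡ (here refl) 0<q t∈ eq =
          choose-sound ps {cur * c} {M} {a} {y} {c} {q} {ts} {cur * c * D ps <ᵇ M * c * 16} cov 0<c c∣n 0<cur n∣ n≡ 0<q t∈
            (proj₁ (∧-true {choose (cur * c * D ps <ᵇ M * c * 16) c q ts (itemsFor cap opts ps) (cur * c) (cur * c * D ps) M a} eq))
        options-sound ps {cur} {M} {a} {y} {os = option c′ q′ ts′ ∷ os} cov 0<c c∣n 0<cur n∣ n≡ (there o∈) 0<q t∈ eq =
          options-sound ps {cur} {M} {a} {y} {os = os} cov 0<c c∣n 0<cur n∣ n≡ o∈ 0<q t∈
            (proj₂ (∧-true {choose (cur * c′ * D ps <ᵇ M * c′ * 16) c′ q′ ts′ (itemsFor cap opts ps) (cur * c′) (cur * c′ * D ps) M a} eq))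

        choose-sound : ∀ ps {cur M a y c q ts small} → (∀ {p} → p ∈ ps → Covered cap opts n p) → 0 < c → c ∣ n → 0 < cur → n ∣ cur * D ps → n ≡ a + M * y →
          0 < q → (n %% q) ∈ ts → choose small c q ts (itemsFor cap opts ps) cur (cur * D ps) M a ≡ true → check n ≡ true
        choose-sound ps {cur} {M} {a} {y} {c} {q} {ts} {true} cov 0<c c∣n 0<cur n∣ n≡ 0<q t∈ eq =
          coarse-sound {c} {_} {_} {M} {a} {y} 0<c c∣n (*-mono-< 0<cur (caps>0 ps cov)) n∣ n≡ eq
        choose-sound ps {cur} {M} {a} {y} {c} {q} {ts} {false} cov 0<c c∣n 0<cur n∣ n≡ 0<q t∈ eq =
          let (inv≡ , eq′) = ∧-true {(M * inv) %% q ≡ᵇ 1} eq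
          in residues-sound ps {cur} {q} {inv} {M} {a} {y} {ts} cov 0<cur n∣ n≡ 0<q (≡ᵇ-true inv≡) t∈ eq′
          where inv = inverse 64 false q q (M %% q) 0 1

        residues-sound : ∀ ps {cur q inv M a y ts small} → (∀ {p} → p ∈ ps → Covered cap opts n p) → 0 < cur → n ∣ cur * D ps → n ≡ a + M * y →
          0 < q → (M * inv) %% q ≡ 1 → (n %% q) ∈ ts → residues small ts (itemsFor cap opts ps) q inv (q ∸ a %% q) cur (cur * D ps) M (M * q) a ≡ true → check n ≡ true
        residues-sound ps {cur} {q} {inv} {M} {a} {y} {t ∷ ts} {small} cov 0<cur n∣ n≡ 0<q inv≡ (there t∈) eq =
          residues-sound ps {cur} {q} {inv} {M} {a} {y} {ts} {small} cov 0<cur n∣ n≡ 0<q inv≡ t∈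
            (proj₂ (∧-true {search small (itemsFor cap opts ps) cur (cur * D ps) (M * q) (a + M * (((t + (q ∸ a %% q)) * inv) %% q))} eq))
        residues-sound ps {cur} {q} {inv} {M} {a} {y} {t ∷ ts} {small} cov 0<cur n∣ n≡ 0<q inv≡ (here t≡) eq =
          let (z , n≡′) = crt {q} {M} {a} {inv} {t} {((t + (q ∸ a %% q)) * inv) %% q} {y} 0<q inv≡
                (shift-residue {q} {M} {a} {inv} {t} (subst (_< q) t≡ (%%-< n 0<q)) inv≡)
                (trans (cong (_%% q) (sym n≡)) t≡) (%%-< ((t + (q ∸ a %% q)) * inv) 0<q)
          in search-sound ps {cur} {_} {M * q} {_} {z} {small} cov 0<cur refl n∣ (trans n≡ n≡′)
               (proj₁ (∧-true {search small (itemsFor cap opts ps) cur (cur * D ps) (M * q) (a + M * (((t + (q ∸ a %% q)) * inv) %% q))} eq))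

-- Tests for large prime factors and for candidates

squarings : ℕ → ℕ → ℕ → ℕ
squarings zero    m x = x
squarings (suc j) m x = squarings j m ((x * x) %% m)

%%-square : ∀ y m → ((y %% m) * (y %% m)) %% m ≡ (y ^ 2) %% m
%%-square y zero    = cong (y *_) (sym (*-identityʳ y))
%%-square y (suc m) = trans (sym (%-distribˡ-* y y (suc m))) (cong (λ z → (y * z) % suc m) (sym (*-identityʳ y)))

squarings-≡ : ∀ j m y → squarings j m (y %% m) ≡ (y ^ (2 ^ j)) %% m
squarings-≡ zero m y = cong (_%% m) (sym (*-identityʳ y))
squarings-≡ (suc j) m y = trans (cong (squarings j m) (%%-square y m)) (trans (squarings-≡ j m (y ^ 2)) (cong (_%% m) (^-*-assoc y 2 (2 ^ j))))

-- m has a prime factor not dividing Q; the bound on m is 2 ^ 128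
roughᵇ : ℕ → ℕ → Bool
roughᵇ Q m = (m <ᵇ 340282366920938463463374607431768211456) ∧ not (squarings 7 m (Q %% m) ≡ᵇ 0)

-- If all primes of m divided Q, then m would divide Q^E, since m < 2^E has fewer than E prime
-- factors even with multiplicity.
∤^⇒primeDivisor : ∀ Q E m → 0 < m → m < 2 ^ E → m ∤ Q ^ E → ∃ λ p → Prime p × p ∣ m × p ∤ Q
∤^⇒primeDivisor Q zero m 0<m m<1 m∤ = contradiction 0<m (<⇒≱ m<1)
∤^⇒primeDivisor Q (suc E) 1 0<m m< m∤ = contradiction (1∣ _) m∤
∤^⇒primeDivisor Q (suc E) m@(suc (suc _)) 0<m m< m∤ with primeDivisor {m} (s≤s (s≤s z≤n))
... | p , pp , p∣m@(divides w m≡) with p ∣? Q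
...   | no p∤Q = p , pp , p∣m , p∤Q
...   | yes p∣Q with ∤^⇒primeDivisor Q E w 0<w w< (λ w∣ → m∤ (subst (_∣ Q ^ suc E) (trans (*-comm p w) (sym m≡)) (*-pres-∣ p∣Q w∣)))
  where
  0<w : 0 < w
  0<w = ≢0⇒0< λ { refl → contradiction m≡ λ () }
  w< : w < 2 ^ E
  w< = *-cancelˡ-< 2 w (2 ^ E) (≤-<-trans (≤-trans (*-monoˡ-≤ w (prime≥2 pp)) (≤-reflexive (trans (*-comm p w) (sym m≡)))) m<)
...     | r , pr , r∣w , r∤Q = r , pr , subst (r ∣_) (sym m≡) (∣m⇒∣m*n p r∣w) , r∤Q

-- A prime that does not divide B! exceeds B. Thus seven squarings modulo m, with 2^7 = 128, detect
-- a large prime factor without factorising m.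
roughᵇ-sound : ∀ B m → 0 < m → roughᵇ (B !) m ≡ true → ∃ λ p → Prime p × p ∣ m × B < p
roughᵇ-sound B m 0<m eq =
  let (p , pp , p∣m , p∤B!) = ∤^⇒primeDivisor (B !) 128 m 0<m (<ᵇ-true {m} {340282366920938463463374607431768211456} (proj₁ both)) m∤
  in p , pp , p∣m , ≰⇒> λ p≤B → p∤B! (∣-trans (∣! pp) (m≤n⇒m!∣n! p≤B))
  where
  both = ∧-true {m <ᵇ 340282366920938463463374607431768211456} eq
  m∤ : m ∤ (B !) ^ 128
  m∤ m∣ = ≡ᵇ-false (not-true (proj₂ both)) (trans (squarings-≡ 7 m (B !)) (∣⇒%%≡0 ((B !) ^ 128) 0<m m∣))
  ∣! : ∀ {p} → Prime p → p ∣ p !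
  ∣! {zero} pp = contradiction pp ¬prime[0]
  ∣! {suc p} pp = m∣m*n (p !)

select : (ℕ → Bool) → List ℕ → List ℕ
select f [] = []
select f (x ∷ xs) = if f x then x ∷ select f xs else select f xs

∈-select : ∀ f xs {x} → x ∈ select f xs → x ∈ xs × f x ≡ true
∈-select f (y ∷ xs) x∈ with f y in eq | x∈
... | true  | here refl = here refl , eq
... | true  | there x∈′ = let (a , b) = ∈-select f xs x∈′ in there a , b
... | false | x∈′ = let (a , b) = ∈-select f xs x∈′ in there a , b

memberᵇ : ℕ × ℕ × ℕ → List (ℕ × ℕ × ℕ) → Bool
memberᵇ t [] = false
memberᵇ t@(n , k , s) ((n′ , k′ , s′) ∷ ts) = ((n ≡ᵇ n′) ∧ ((k ≡ᵇ k′) ∧ (s ≡ᵇ s′))) ∨ memberᵇ t ts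

memberᵇ-sound : ∀ n k s ts → memberᵇ (n , k , s) ts ≡ true → (n , k , s) ∈ ts
memberᵇ-sound n k s ((n′ , k′ , s′) ∷ ts) eq with ∨-true {(n ≡ᵇ n′) ∧ ((k ≡ᵇ k′) ∧ (s ≡ᵇ s′))} eq
... | inj₂ e = there (memberᵇ-sound n k s ts e)
... | inj₁ e with ∧-true {n ≡ᵇ n′} e
...   | e₁ , e₂ with ∧-true {k ≡ᵇ k′} e₂
...     | e₃ , e₄ = here (cong₂ _,_ (≡ᵇ-true e₁) (cong₂ _,_ (≡ᵇ-true e₃) (≡ᵇ-true e₄)))

large?ᵇ : (n k s p : ℕ) → Bool
large?ᵇ n k s p = (k <ᵇ p) ∧ ((n %% p <ᵇ k) ∧ noCarry 64 p n s)

power?ᵇ : (n k s p e : ℕ) → Bool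
power?ᵇ n k s p e = (k <ᵇ p ^ e) ∧ ((n %% (p ^ e) ≡ᵇ 0) ∧ noCarry 64 p n s)

-- No fraction with denominator at most k lies strictly between 0 and 1 / k. The k - 1 indices that
-- may be given up are split between both ends, l′ of them at the left.
polygon?ᵇ : (n k s p l′ : ℕ) → Bool
polygon?ᵇ n k s p l′ = polygonᵇ p n s k 0 0 (k ∸ 1) 1 (k ∸ 1 ∸ l′) l′

largeTest powerTest polygonTest tripleTest : List ℕ → (n k s : ℕ) → Bool
largeTest ps n k s = anyIn ps (large?ᵇ n k s)
powerTest ps n k s = anyIn ps (λ p → anyBelow 7 (power?ᵇ n k s p))
polygonTest ps n k s = anyIn ps (λ p → anyIn (0 ∷ 1 ∷ 2 ∷ []) (polygon?ᵇ n k s p))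
  -- For p = 2 the slopes are 1 and 1 + 1 / k, with no fraction of denominator at most k between
  -- them. For p = 3 they are 1/2 and 1; as 2/3 lies between, this can serve only k = 2.
  ∨ (polygonᵇ 2 n s k 0 1 (k ∸ 1) (suc k) (k ∸ 1) 0 ∨ polygonᵇ 3 n s k 1 1 0 1 (k ∸ 1) 0)
tripleTest ps n k s = largeTest ps n k s ∨ (powerTest ps n k s ∨
  (memberᵇ (n , k , s) ((10 , 5 , 5) ∷ exceptions) ∨ polygonTest ps n k s))

module _ (ps : List ℕ) (kmin kmax rough! : ℕ) where

  kill?ᵇ : (n l : ℕ) → Bool
  kill?ᵇ n l = (l <ᵇ n) ∧ roughᵇ rough! (n ∸ l)

  -- One n - l with l < kmin and a prime factor above B excludes n for all degrees from kmin to kmax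
  -- and all s at once, because B is at least kmax and at least s + l.
  killᵇ : ℕ → Bool
  killᵇ n = anyBelow kmin (kill?ᵇ n)

  eachkᵇ : (n s k : ℕ) → Bool
  eachkᵇ n s k = (k <ᵇ kmin) ∨ ((n <ᵇ 2 * k) ∨ tripleTest ps n k s)

  eachsᵇ : List ℕ → (n s : ℕ) → Bool
  eachsᵇ qs n s = anyIn qs (λ p → noCarry 64 p n s) ∨ allBelow (suc kmax) (eachkᵇ n s)

  -- These primes depend on n only: they exceed every admissible k and divide n - l for some l <
  -- kmin. What remains for each s is the test for carries.
  window?ᵇ : (n p : ℕ) → Bool
  window?ᵇ n p = (kmax <ᵇ p) ∧ (n %% p <ᵇ kmin)

  checkᵇ : ℕ → Bool
  checkᵇ n = killᵇ n ∨ allBelow 93 (eachsᵇ (select (window?ᵇ n) ps) n)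

Conclusion : ℕ → ℕ → ℕ → Set
Conclusion n k s = (n , k , s) ∈ (10 , 5 , 5) ∷ exceptions

prime[3] : Prime 3
prime[3] = from-yes (prime? 3)

module Excluded (n s k : ℕ) (b : Fin (suc n) → ℤ) (b₀≡1 : ∣ b fzero ∣ ≡ 1) (bₙ≡1 : ∣ b (fromℕ n) ∣ ≡ 1)
  (fact : Factorisation n k (gCoef n s b)) where

  open Criteria n s k b b₀≡1 bₙ≡1 fact

  prime-> : ∀ {p l} → Prime p → k < p → l < k → l ≤ n → p ∣ n ∸ l → s + l < p → ⊥
  prime-> {p} {l} pp k<p l<k l≤n p∣@(divides m eq) s+l<p = excluded-large pp
    (subst (λ z → p ∤ binom z s) n≡ (p∤binom-small pp m s+l<p)) k<p l<k p∣
    where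
    n≡ : p * m + l ≡ n
    n≡ = trans (cong (_+ l) (trans (*-comm p m) (sym eq))) (m∸n+n≡m l≤n)

  prime-%% : ∀ {p} → Prime p → k < p → n %% p < k → p ∤ binom n s → ⊥
  prime-%% {p} pp k<p r<k p∤ = excluded-large pp p∤ k<p r<k (∣∸%% n p (prime>0 pp))

  power-bound : 0 < k → ∀ {p} → Prime p → ∀ {e} → p ^ e ∣ n → p ^ e ≤ k ⊎ p ^ e ≤ s
  power-bound 0<k {p} pp {e} p∣ with p ^ e ≤? k | p ^ e ≤? s
  ... | yes le | _ = inj₁ le
  ... | no _ | yes le = inj₂ le
  ... | no k≱ | no s≱ = ⊥-elim (excluded-p^ pp (p∤binom-p^ pp e p∣ (≰⇒> s≱)) 0<k e p∣ (≰⇒> k≱))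

  module _ (0<k : 0 < k) (ps : List ℕ) (ps-prime : ∀ {p} → p ∈ ps → Prime p) where

    tripleTest-sound : tripleTest ps n k s ≡ true → Conclusion n k s
    tripleTest-sound eq with ∨-true {largeTest ps n k s} eq
    ... | inj₁ e = let (p , p∈ , t) = anyIn-true ps (large?ᵇ n k s) e
                       (k<p , t′) = ∧-true {k <ᵇ p} t
                       (r<k , nc) = ∧-true {n %% p <ᵇ k} t′
                       pp = ps-prime p∈
                   in ⊥-elim (prime-%% pp (<ᵇ-true k<p) (<ᵇ-true r<k) (noCarry-sound 64 n s pp nc))
    ... | inj₂ eq₂ with ∨-true {powerTest ps n k s} eq₂
    ...   | inj₁ e = let (p , p∈ , t) = anyIn-true ps (λ p → anyBelow 7 (power?ᵇ n k s p)) e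
                         (i , _ , t₁) = anyBelow-true 7 (power?ᵇ n k s p) t
                         (k<p , t′) = ∧-true {k <ᵇ p ^ i} t₁
                         (r≡0 , nc) = ∧-true {n %% (p ^ i) ≡ᵇ 0} t′
                         pp = ps-prime p∈
                     in ⊥-elim (excluded-p^ pp (noCarry-sound 64 n s pp nc) 0<k i
                          (%%≡0⇒∣ n (m^n>0 p {{prime⇒nonZero pp}} i) (≡ᵇ-true r≡0)) (<ᵇ-true k<p))
    ...   | inj₂ eq₃ with ∨-true {memberᵇ (n , k , s) ((10 , 5 , 5) ∷ exceptions)} eq₃
    ...     | inj₁ e = memberᵇ-sound n k s ((10 , 5 , 5) ∷ exceptions) e
    ...     | inj₂ eq₄ with ∨-true {anyIn ps (λ p → anyIn (0 ∷ 1 ∷ 2 ∷ []) (polygon?ᵇ n k s p))} eq₄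
    ...       | inj₁ e = let (p , p∈ , t) = anyIn-true ps (λ p → anyIn (0 ∷ 1 ∷ 2 ∷ []) (polygon?ᵇ n k s p)) e
                             (l′ , _ , t′) = anyIn-true (0 ∷ 1 ∷ 2 ∷ []) (polygon?ᵇ n k s p) t
                         in ⊥-elim (polygonᵇ-sound (ps-prime p∈) n s k 0 0 (k ∸ 1) 1 (k ∸ 1 ∸ l′) l′ t′ b b₀≡1 bₙ≡1 fact)
    ...       | inj₂ e with ∨-true {polygonᵇ 2 n s k 0 1 (k ∸ 1) (suc k) (k ∸ 1) 0} e
    ...         | inj₁ t = ⊥-elim (polygonᵇ-sound prime[2] n s k 0 1 (k ∸ 1) (suc k) (k ∸ 1) 0 t b b₀≡1 bₙ≡1 fact)
    ...         | inj₂ t = ⊥-elim (polygonᵇ-sound prime[3] n s k 1 1 0 1 (k ∸ 1) 0 t b b₀≡1 bₙ≡1 fact)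

    module _ (kmin kmax B : ℕ) (kmin≤k : kmin ≤ k) (k≤kmax : k ≤ kmax) where

      killᵇ-sound : kmax ≤ B → s + kmin ≤ suc B → killᵇ ps kmin kmax (B !) n ≡ true → ⊥
      killᵇ-sound kmax≤B B≥ e =
        let (l , l< , t) = anyBelow-true kmin (kill?ᵇ ps kmin kmax (B !) n) e
            (l<n , r) = ∧-true {l <ᵇ n} t
            (p , pp , p∣ , B<p) = roughᵇ-sound B (n ∸ l) (m<n⇒0<n∸m (<ᵇ-true {l} {n} l<n)) r
        in prime-> pp (≤-<-trans (≤-trans k≤kmax kmax≤B) B<p) (<-≤-trans l< kmin≤k) (<⇒≤ (<ᵇ-true {l} {n} l<n)) p∣
             (≤-<-trans (s≤s⁻¹ (≤-trans (≤-reflexive (sym (+-suc s l))) (≤-trans (+-monoʳ-≤ s l<) B≥))) B<p)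

      eachkᵇ-sound : ∀ {r} → 2 * k ≤ n → eachkᵇ ps kmin kmax r n s k ≡ true → Conclusion n k s
      eachkᵇ-sound 2k≤n eq with ∨-true {k <ᵇ kmin} eq
      ... | inj₁ k< = contradiction kmin≤k (<⇒≱ (<ᵇ-true k<))
      ... | inj₂ eq′ with ∨-true {n <ᵇ 2 * k} eq′
      ...   | inj₁ n< = contradiction 2k≤n (<⇒≱ (<ᵇ-true n<))
      ...   | inj₂ t = tripleTest-sound t

      window-sound : ∀ {r} → anyIn (select (window?ᵇ ps kmin kmax r n) ps) (λ p → noCarry 64 p n s) ≡ true → ⊥
      window-sound {r} e =
        let (p , p∈ , nc) = anyIn-true (select (window?ᵇ ps kmin kmax r n) ps) (λ p → noCarry 64 p n s) e
            (p∈ps , f) = ∈-select (window?ᵇ ps kmin kmax r n) ps p∈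
            (kmax<p , r<) = ∧-true {kmax <ᵇ p} f
            pp = ps-prime p∈ps
        in prime-%% pp (≤-<-trans k≤kmax (<ᵇ-true kmax<p)) (<-≤-trans (<ᵇ-true r<) kmin≤k) (noCarry-sound 64 n s pp nc)

      eachsᵇ-sound : ∀ {r} → 2 * k ≤ n → eachsᵇ ps kmin kmax r (select (window?ᵇ ps kmin kmax r n) ps) n s ≡ true → Conclusion n k s
      eachsᵇ-sound {r} 2k≤n e with ∨-true {anyIn (select (window?ᵇ ps kmin kmax r n) ps) (λ p → noCarry 64 p n s)} e
      ... | inj₁ e₁ = ⊥-elim (window-sound {r} e₁)
      ... | inj₂ e₂ = eachkᵇ-sound {r} 2k≤n (allBelow-true (suc kmax) (eachkᵇ ps kmin kmax r n s) e₂ (s≤s k≤kmax))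

      checkᵇ-sound : kmax ≤ B → s + kmin ≤ suc B → s < 93 → 2 * k ≤ n → checkᵇ ps kmin kmax (B !) n ≡ true → Conclusion n k s
      checkᵇ-sound kmax≤B B≥ s<93 2k≤n eq with ∨-true {killᵇ ps kmin kmax (B !) n} eq
      ... | inj₁ e = ⊥-elim (killᵇ-sound kmax≤B B≥ e)
      ... | inj₂ e = eachsᵇ-sound {B !} 2k≤n (allBelow-true 93 (eachsᵇ ps kmin kmax (B !) (select (window?ᵇ ps kmin kmax (B !) n) ps) n) e s<93)

-- Exponent bounds and residue classes for the search

maxExp : ℕ → ℕ
-- For primes up to 92 this is the largest e with p^e ≤ 92; by `power-bound` no higher power divides
-- n when k and s are at most 92.
maxExp p = if p <ᵇ 3 then 6 else if p <ᵇ 5 then 4 else if p <ᵇ 11 then 2 else 1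

capOf : ℕ → ℕ
capOf p = p ^ maxExp p

powersFrom : ℕ → ℕ → List Option
powersFrom p zero    = []
powersFrom p (suc e) = option (p ^ suc e) (p ^ suc e) (0 ∷ []) ∷ powersFrom p e

-- The classes -p r modulo p² that come out of `p∣binom⇒residue`.
carryResidues : ℕ → ℕ → List ℕ
carryResidues p zero    = []
carryResidues p (suc r) = (p * p ∸ p * suc r) ∷ carryResidues p r

-- A prime above kmax exceeds k, so `excluded-p^` with e = 1 forces a carry and thereby confines n
-- modulo p². For a smaller prime only the exact power is chosen.
optionsOf : ℕ → ℕ → List Option
optionsOf kmax p = if kmax <ᵇ p then option (p ^ 1) (p * p) (carryResidues p (92 // p)) ∷ [] else powersFrom p (maxExp p)

∈-powersFrom : ∀ p {e E} → 0 < e → e ≤ E → option (p ^ e) (p ^ e) (0 ∷ []) ∈ powersFrom p E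
∈-powersFrom p {suc e} {suc E} 0<e e≤E with m≤n⇒m<n∨m≡n e≤E
... | inj₁ (s≤s lt) = there (∈-powersFrom p 0<e lt)
... | inj₂ refl = here refl

∈-carryResidues : ∀ p {r R} → 0 < r → r ≤ R → (p * p ∸ p * r) ∈ carryResidues p R
∈-carryResidues p {suc r} {suc R} 0<r r≤R with m≤n⇒m<n∨m≡n r≤R
... | inj₁ (s≤s lt) = there (∈-carryResidues p 0<r lt)
... | inj₂ refl = here refl

92<p^ : ∀ p → 2 ≤ p → 92 < p ^ suc (maxExp p)
92<p^ p 2≤p with p <ᵇ 3 in a
... | true = <-≤-trans (<ᵇ-true {92} {128} refl) (^-monoˡ-≤ 7 2≤p)
... | false with p <ᵇ 5 in b
...   | true = <-≤-trans (<ᵇ-true {92} {243} refl) (^-monoˡ-≤ 5 (<ᵇ-false {p} {3} a))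
...   | false with p <ᵇ 11 in c
...     | true = <-≤-trans (<ᵇ-true {92} {125} refl) (^-monoˡ-≤ 3 (<ᵇ-false {p} {5} b))
...     | false = <-≤-trans (<ᵇ-true {92} {121} refl) (^-monoˡ-≤ 2 (<ᵇ-false {p} {11} c))

maxExp-large : ∀ {p} → 10 < p → maxExp p ≡ 1
maxExp-large {p} 10<p with p <ᵇ 3 in a
... | true = contradiction (<ᵇ-true {p} {3} a) (≤⇒≯ (≤-trans (s≤s (s≤s (s≤s z≤n))) 10<p))
... | false with p <ᵇ 5 in b
...   | true = contradiction (<ᵇ-true {p} {5} b) (≤⇒≯ (≤-trans (s≤s (s≤s (s≤s (s≤s (s≤s z≤n))))) 10<p))
...   | false with p <ᵇ 11 in c
...     | true = contradiction (<ᵇ-true {p} {11} c) (≤⇒≯ 10<p)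
...     | false = refl

searchᵇ : (ℕ → Bool) → ℕ → List ℕ → Bool
searchᵇ check kmax ps = Search.enter check (Search.itemsFor check capOf (optionsOf kmax) ps) 1 (1 * Search.capProduct check capOf ps) 1 0

module _ (n s k : ℕ) (b : Fin (suc n) → ℤ) (b₀≡1 : ∣ b fzero ∣ ≡ 1) (bₙ≡1 : ∣ b (fromℕ n) ∣ ≡ 1)
  (fact : Factorisation n k (gCoef n s b)) (0<n : 0 < n) (0<k : 0 < k) (s≤92 : s ≤ 92) where

  open Excluded n s k b b₀≡1 bₙ≡1 fact
  open Criteria n s k b b₀≡1 bₙ≡1 fact using (excluded-p^)

  module _ (check : ℕ → Bool) (kmax : ℕ) (10≤kmax : 10 ≤ kmax) (kmax≤92 : kmax ≤ 92) (k≤kmax : k ≤ kmax)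
    (ps : List ℕ) (ps-prime : ∀ {p} → p ∈ ps → Prime p) (ps-all : ∀ {p} → Prime p → p ≤ 92 → p ∈ ps) where
    open Search check

    p^≤92 : ∀ {p} → Prime p → ∀ {e} → p ^ e ∣ n → p ^ e ≤ 92
    p^≤92 pp {e} d∣ with power-bound 0<k pp {e} d∣
    ... | inj₁ le = ≤-trans le (≤-trans k≤kmax kmax≤92)
    ... | inj₂ le = ≤-trans le s≤92

    covered : ∀ {p} → p ∈ ps → Covered capOf (optionsOf kmax) n p
    covered {p} p∈ = record { isPrime = pp ; e = e ; E = maxExp p ; cap≡ = refl ; e≤E = e≤E ; exact = ex ; chosen = opt }
      where
      pp = ps-prime p∈
      e = proj₁ (∥-exists pp {n} (λ n≡0 → <-irrefl (sym n≡0) 0<n))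
      ex = proj₂ (∥-exists pp {n} (λ n≡0 → <-irrefl (sym n≡0) 0<n))
      e≤E : e ≤ maxExp p
      e≤E = ≮⇒≥ λ lt → <⇒≱ (92<p^ p (prime≥2 pp)) (≤-trans (^-monoʳ-≤ p {{prime⇒nonZero pp}} lt) (p^≤92 pp {e} (∥⇒∣ pp ex ≤-refl)))
      opt : e ≡ 0 ⊎ ∃ λ q → ∃ λ ts → option (p ^ e) q ts ∈ optionsOf kmax p × 0 < q × (n %% q) ∈ ts
      opt with e ≟ 0
      ... | yes z = inj₁ z
      ... | no nz with kmax <ᵇ p in big
      ...   | false = inj₂ (p ^ e , 0 ∷ [] , ∈-powersFrom p (≢0⇒0< nz) e≤E , 0<q , here (∣⇒%%≡0 n 0<q (∥⇒∣ pp ex ≤-refl)))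
        where 0<q = m^n>0 p {{prime⇒nonZero pp}} e
      ...   | true with ∥⇒∣ pp {e} {n} {1} ex (≢0⇒0< nz)
      ...     | divides m n≡ = inj₂ (p * p , carryResidues p (92 // p) , here (cong (λ z → option (p ^ z) (p * p) (carryResidues p (92 // p))) e≡1) , 0<p² , t∈)
        where
        kmax<p = <ᵇ-true {kmax} {p} big
        0<p = prime>0 pp
        0<p² = *-mono-< 0<p 0<p
        -- p > kmax ≥ 10, and already 11² exceeds 92.
        e≡1 : e ≡ 1
        e≡1 = ≤-antisym (subst (e ≤_) (maxExp-large (≤-<-trans 10≤kmax kmax<p)) e≤E) (≢0⇒0< nz)
        n≡pm : p * m ≡ n
        n≡pm = trans (*-comm p m) (trans (cong (m *_) (sym (*-identityʳ p))) (sym n≡))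
        92<p² : 92 < p * p
        92<p² = <-≤-trans (<ᵇ-true {92} {121} refl) (*-mono-≤ (≤-<-trans 10≤kmax kmax<p) (≤-<-trans 10≤kmax kmax<p))
        p∣binom : p ∣ binom (p * m) s
        p∣binom with p ∣? binom (p * m) s
        ... | yes d = d
        ... | no ¬d = ⊥-elim (excluded-p^ pp (subst (λ z → p ∤ binom z s) n≡pm ¬d) 0<k 1 (subst (_∣ n) (sym (*-identityʳ p)) (subst (p ∣_) n≡pm (m∣m*n m)))
                        (subst (k <_) (sym (*-identityʳ p)) (≤-<-trans k≤kmax kmax<p)))
        t∈ : (n %% (p * p)) ∈ carryResidues p (92 // p)
        t∈ with p∣binom⇒residue pp m (≤-<-trans s≤92 92<p²) p∣binom
        ... | r , 0<r , pr≤s , divides zero m+r≡ = contradiction (subst (0 <_) m+r≡ (≤-trans 0<r (m≤n+m r m))) λ ()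
        ... | r , 0<r , pr≤s , divides (suc j) m+r≡ = subst (_∈ carryResidues p (92 // p)) (sym n%%) (∈-carryResidues p 0<r r≤)
          where
          pr≤92 = ≤-trans pr≤s s≤92
          pr<p² = ≤-<-trans pr≤92 92<p²
          r≤ : r ≤ 92 // p
          r≤ = ≮⇒≥ λ lt → <⇒≱ (subst (_< p + p * (92 // p)) (sym (//-%% 92 p 0<p)) (subst (p * (92 // p) + 92 %% p <_) (+-comm (p * (92 // p)) p) (+-monoʳ-< (p * (92 // p)) (%%-< 92 0<p))))
            (≤-trans (≤-reflexive (sym (*-suc p (92 // p)))) (≤-trans (*-monoʳ-≤ p lt) pr≤92))
          t = p * p ∸ p * r
          n≡t : n ≡ p * p * j + t
          n≡t = +-cancelʳ-≡ (p * r) _ _ (begin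
            n + p * r                       ≡⟨ cong (_+ p * r) (sym n≡pm) ⟩
            p * m + p * r                   ≡⟨ sym (*-distribˡ-+ p m r) ⟩
            p * (m + r)                     ≡⟨ cong (p *_) m+r≡ ⟩
            p * (suc j * p)                 ≡⟨ ring p j ⟩
            p * p * j + p * p               ≡⟨ cong (p * p * j +_) (sym (m∸n+n≡m (<⇒≤ pr<p²))) ⟩
            p * p * j + (t + p * r)         ≡⟨ sym (+-assoc (p * p * j) t (p * r)) ⟩
            p * p * j + t + p * r           ∎)
            where
            open ≡-Reasoning
            ring : ∀ p j → p * (suc j * p) ≡ p * p * j + p * p
            ring = solve-∀
          t< : t < p * p
          t< = ∸-monoʳ-< {p * p} {p * r} {0} (*-mono-< 0<p 0<r) (<⇒≤ pr<p²)
          n%% : n %% (p * p) ≡ t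
          n%% = +-cancelˡ-≡ (p * p * j) _ _ (trans (cong (λ z → p * p * z + n %% (p * p)) (sym quot≡)) (trans (sym (//-%% n (p * p) 0<p²)) n≡t))
            where
            quot≡ : n // (p * p) ≡ j
            quot≡ = divMod-unique (%%-< n 0<p²) t< (trans (sym (//-%% n (p * p) 0<p²)) n≡t)

    searched : searchᵇ check kmax ps ≡ true → check n ≡ true
    searched = search-sound capOf (optionsOf kmax) n 0<n ps {1} {_} {1} {0} {n} {1 * capProduct capOf ps <ᵇ 1 * 8} covered (s≤s z≤n) refl
      (subst (n ∣_) (sym (*-identityˡ _)) (∣caps capOf (optionsOf kmax) n ps 0<n covered all)) (sym (*-identityˡ n))
      where
      all : ∀ {p} → Prime p → p ∣ n → p ∈ ps
      all {p} pp p∣ = ps-all pp (subst (_≤ 92) (*-identityʳ p) (p^≤92 pp {1} (subst (_∣ n) (sym (*-identityʳ p)) p∣)))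

-- Prime powers in binomial coefficients

∣-cancel-unit : ∀ {p} → Prime p → ∀ {v w y} → p ∤ w → p ^ v ∣ w * y → p ^ v ∣ y
∣-cancel-unit {p} pp {v} {w} {y} p∤w d∣ with y ≟ 0
... | yes refl = (p ^ v) ∣0
... | no y≢0 with ∥-exists pp y≢0
...   | e , ex = ∥⇒∣ pp ex (∥⇒≤ pp {e} {w * y} {v} (∥-* pp (∤⇒∥ pp p∤w) ex) d∣)

binom-sucʳ : ∀ t s → binom t (suc s) * suc s ≡ suc (t + s) * binom t s
binom-sucʳ t s = *-cancelʳ-≡ _ _ (s !) {{s !≢0}} (begin
  binom t (suc s) * suc s * s !    ≡⟨ *-assoc (binom t (suc s)) (suc s) (s !) ⟩
  binom t (suc s) * (suc s) !      ≡⟨ binom-! t (suc s) ⟩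
  asc t s * (t + suc s)            ≡⟨ cong₂ _*_ (sym (binom-! t s)) (+-suc t s) ⟩
  binom t s * s ! * suc (t + s)    ≡⟨ ring (binom t s) (s !) (suc (t + s)) ⟩
  suc (t + s) * binom t s * s !    ∎)
  where
  open ≡-Reasoning
  ring : ∀ a b c → a * b * c ≡ c * a * b
  ring = solve-∀

-- With N = m + s + 1 this is the classical divisibility of lcm(1, ..., N) by N C(N - 1, s), one
-- prime at a time. The factor N is kept for the induction on base-p digits: when the numerator has
-- an extra multiple of p, the same expression in m₁ and s₁ reappears, multiplied by p.
p^∣binom⇒≤ : ∀ {p} → Prime p → ∀ {v} m s → p ^ v ∣ suc (m + s) * binom m s → p ^ v ≤ suc (m + s)
p^∣binom⇒≤ {p} pp {v} m s = go (<-wellFounded (m + s)) v m s refl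
  where
  0<p = prime>0 pp
  go : ∀ {N} → Acc _<_ N → ∀ v m s → m + s ≡ N → p ^ v ∣ suc (m + s) * binom m s → p ^ v ≤ suc (m + s)
  go _ v zero zero _ d∣ = ∣⇒≤ d∣
  go {N} (acc rec) v m s refl d∣ with m + s ≟ 0 | divMod p 0<p m
  ... | yes z | _ = ∣⇒≤ d∣″
    where
    z′ = m + s
    d∣″ : p ^ v ∣ suc z′
    d∣″ = subst (p ^ v ∣_) (trans (cong (suc z′ *_) (trans (cong (binom m) (m+n≡0⇒n≡0 m z)) (binom-zero m))) (*-identityʳ _)) d∣
  ... | no nz | m₁ , l , l<p , refl = result
    where
    sA = ascSplit pp m₁ l<p (suc s)
    sS = ascSplit pp 0 0<p s
    open AscSplit sA using () renaming (quot to σ; rem to ρ; rem< to ρ<; l+s≡ to l+s≡σ; unit to w; p∤unit to p∤w; asc≡ to ascA)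
    open AscSplit sS using () renaming (quot to s₁; rem to r; rem< to r<; l+s≡ to s≡; unit to w′; p∤unit to p∤w′; asc≡ to ascS)
    m₀ = p * m₁ + l
    X = suc (m₀ + s) * binom m₀ s
    s!≡ : s ! ≡ w′ * (p ^ s₁ * s₁ !)
    s!≡ = trans (sym (asc-0 s)) (trans (cong (λ z → asc z s) (sym (trans (+-identityʳ (p * 0)) (*-zeroʳ p)))) (trans ascS (cong (λ z → w′ * (p ^ s₁ * z)) (asc-0 s₁))))
    main : X * (w′ * (p ^ s₁ * s₁ !)) ≡ w * (p ^ σ * asc m₁ σ)
    main = begin
      X * (w′ * (p ^ s₁ * s₁ !))         ≡⟨ cong (X *_) (sym s!≡) ⟩
      suc (m₀ + s) * binom m₀ s * s !    ≡⟨ ring (suc (m₀ + s)) (binom m₀ s) (s !) ⟩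
      binom m₀ s * s ! * suc (m₀ + s)    ≡⟨ cong₂ _*_ (binom-! m₀ s) (sym (+-suc m₀ s)) ⟩
      asc m₀ s * (m₀ + suc s)            ≡⟨ ascA ⟩
      w * (p ^ σ * asc m₁ σ)             ∎
      where
      open ≡-Reasoning
      ring : ∀ a b c → a * b * c ≡ b * c * a
      ring = solve-∀
    instance
      _ = prime⇒nonZero pp
      cof : NonZero (p ^ s₁ * s₁ !)
      cof = m*n≢0 (p ^ s₁) (s₁ !) {{m^n≢0 p s₁}} {{s₁ !≢0}}
    pσ≤ : p * m₁ + p * σ ≤ suc (m₀ + s)
    pσ≤ = ≤-trans (+-monoʳ-≤ (p * m₁) (≤-trans (m≤m+n (p * σ) ρ) (≤-reflexive (sym l+s≡σ))))
      (≤-reflexive (trans (sym (+-assoc (p * m₁) l (suc s))) (+-suc m₀ s)))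
    s₁≤σ : s₁ ≤ σ
    s₁≤σ = lex-≤ {p} {y₀ = 0} ρ< (begin
      p * s₁ + 0        ≡⟨ +-identityʳ _ ⟩
      p * s₁            ≤⟨ m≤m+n (p * s₁) r ⟩
      p * s₁ + r        ≡⟨ sym s≡ ⟩
      s                 ≤⟨ ≤-trans (n≤1+n s) (m≤n+m (suc s) l) ⟩
      l + suc s         ≡⟨ l+s≡σ ⟩
      p * σ + ρ         ∎)
      where open ≤-Reasoning
    σ≤1+s₁ : σ ≤ suc s₁
    σ≤1+s₁ = s≤s⁻¹ (*-cancelˡ-< p σ (suc (suc s₁)) (begin-strict
      p * σ                  ≤⟨ m≤m+n (p * σ) ρ ⟩
      p * σ + ρ              ≡⟨ sym l+s≡σ ⟩
      l + suc s              ≡⟨ cong (λ z → l + suc z) s≡ ⟩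
      l + suc (p * s₁ + r)   <⟨ +-mono-<-≤ l<p (s≤s ≤-refl) ⟩
      p + suc (p * s₁ + r)   ≡⟨ cong (p +_) (sym (+-suc (p * s₁) r)) ⟩
      p + (p * s₁ + suc r)   ≤⟨ +-monoʳ-≤ p (+-monoʳ-≤ (p * s₁) r<) ⟩
      p + (p * s₁ + p)       ≡⟨ ring p s₁ ⟩
      p * suc (suc s₁)       ∎))
      where
      open ≤-Reasoning
      ring : ∀ p s → p + (p * s + p) ≡ p * suc (suc s)
      ring = solve-∀
    smaller : m₁ + s₁ < m₀ + s
    smaller = <-≤-trans (≰⇒> λ ge → nz (lemma ge)) ≤-refl
      where
      p*≤ : p * (m₁ + s₁) ≤ m₀ + s
      p*≤ = ≤-trans (≤-reflexive (*-distribˡ-+ p m₁ s₁)) (+-mono-≤ (m≤m+n (p * m₁) l) (≤-trans (m≤m+n (p * s₁) r) (≤-reflexive (sym s≡))))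
      lemma : m₀ + s ≤ m₁ + s₁ → m₀ + s ≡ 0
      lemma ge with m₁ + s₁ in eq
      ... | zero  = n≤0⇒n≡0 ge
      ... | suc q = contradiction (subst (λ z → p * z ≤ suc q) eq (≤-trans p*≤ ge)) (<⇒≱ (subst (suc q <_) (*-comm (suc q) p) (m<m*n (suc q) p (prime≥2 pp))))
    result : p ^ v ≤ suc (m₀ + s)
    result with m≤n⇒m<n∨m≡n s₁≤σ
    ... | inj₂ s₁≡σ = ≤-trans (go (rec smaller) v m₁ s₁ refl (∣n⇒∣m*n (suc (m₁ + s₁)) (∣-cancel-unit pp {v} p∤w (subst (p ^ v ∣_) Xw′ (∣m⇒∣m*n w′ d∣)))))
        (≤-trans (s≤s (<⇒≤ smaller)) ≤-refl)
      where
      Xw′ : X * w′ ≡ w * binom m₁ s₁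
      Xw′ = *-cancelʳ-≡ _ _ (p ^ s₁ * s₁ !) (begin
        X * w′ * (p ^ s₁ * s₁ !)               ≡⟨ *-assoc X w′ _ ⟩
        X * (w′ * (p ^ s₁ * s₁ !))             ≡⟨ main ⟩
        w * (p ^ σ * asc m₁ σ)                 ≡⟨ cong (λ z → w * (p ^ z * asc m₁ z)) (sym s₁≡σ) ⟩
        w * (p ^ s₁ * asc m₁ s₁)               ≡⟨ cong (λ z → w * (p ^ s₁ * z)) (sym (binom-! m₁ s₁)) ⟩
        w * (p ^ s₁ * (binom m₁ s₁ * s₁ !))    ≡⟨ ring w (p ^ s₁) (binom m₁ s₁) (s₁ !) ⟩
        w * binom m₁ s₁ * (p ^ s₁ * s₁ !)      ∎)
        where
        open ≡-Reasoning
        ring : ∀ a b c d → a * (b * (c * d)) ≡ a * c * (b * d)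
        ring = solve-∀
    -- The extra multiple of p costs one factor p of p^v, and p (m₁ + σ) ≤ m₀ + s + 1 pays for it.
    ... | inj₁ s₁<σ = bound v Xd
      where
      σ≡ : σ ≡ suc s₁
      σ≡ = ≤-antisym σ≤1+s₁ s₁<σ
      Y = suc (m₁ + s₁) * binom m₁ s₁
      Xw′ : X * w′ ≡ p * (w * Y)
      Xw′ = *-cancelʳ-≡ _ _ (p ^ s₁ * s₁ !) (begin
        X * w′ * (p ^ s₁ * s₁ !)                               ≡⟨ *-assoc X w′ _ ⟩
        X * (w′ * (p ^ s₁ * s₁ !))                             ≡⟨ main ⟩
        w * (p ^ σ * asc m₁ σ)                                 ≡⟨ cong (λ z → w * (p ^ z * asc m₁ z)) σ≡ ⟩
        w * (p * p ^ s₁ * (asc m₁ s₁ * (m₁ + suc s₁)))         ≡⟨ cong₂ (λ y z → w * (p * p ^ s₁ * (y * z))) (sym (binom-! m₁ s₁)) (+-suc m₁ s₁) ⟩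
        w * (p * p ^ s₁ * (binom m₁ s₁ * s₁ ! * suc (m₁ + s₁))) ≡⟨ ring w p (p ^ s₁) (binom m₁ s₁) (s₁ !) (suc (m₁ + s₁)) ⟩
        p * (w * Y) * (p ^ s₁ * s₁ !)                          ∎)
        where
        open ≡-Reasoning
        ring : ∀ w p P b f n → w * (p * P * (b * f * n)) ≡ p * (w * (n * b)) * (P * f)
        ring = solve-∀
      Xd : p ^ v ∣ p * (w * Y)
      Xd = subst (p ^ v ∣_) Xw′ (∣m⇒∣m*n w′ d∣)
      bound : ∀ v → p ^ v ∣ p * (w * Y) → p ^ v ≤ suc (m₀ + s)
      bound zero _ = s≤s z≤n
      bound (suc v) d = ≤-trans (*-monoʳ-≤ p (go (rec smaller) v m₁ s₁ refl (∣-cancel-unit pp {v} p∤w (*-cancelˡ-∣ p d))))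
        (≤-trans (≤-reflexive (trans (cong (p *_) (trans (sym (+-suc m₁ s₁)) (cong (m₁ +_) (sym σ≡)))) (*-distribˡ-+ p m₁ σ))) pσ≤)

p^∣binom⇒≤′ : ∀ {p} → Prime p → ∀ {v} m k → 0 < k → p ^ v ∣ binom m k → p ^ v ≤ m + k
p^∣binom⇒≤′ {p} pp {v} m (suc s) _ d∣ = subst (p ^ v ≤_) (sym (+-suc m s))
  (p^∣binom⇒≤ pp {v} m s (subst (p ^ v ∣_) (binom-sucʳ m s) (∣m⇒∣m*n (suc s) d∣)))

-- Smooth binomial coefficients and counting of primes

primeProd : (ℕ → ℕ) → ℕ → ℕ
primeProd f zero = 1
primeProd f (suc n) with prime? (suc n)
... | yes _ = f (suc n) * primeProd f n
... | no _  = primeProd f n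

≤primeProd : ∀ f N {x} → 0 < x → (∀ {p} → Prime p → p ∣ x → p ≤ N) →
  (∀ {p} → Prime p → p ≤ N → ∀ v → p ^ v ∣ x → p ^ v ≤ f p) → x ≤ primeProd f N
≤primeProd f zero {1} 0<x below bd = ≤-refl
≤primeProd f zero {suc (suc x)} 0<x below bd with primeDivisor {suc (suc x)} (s≤s (s≤s z≤n))
... | p , pp , p∣ = contradiction (below pp p∣) (<⇒≱ (prime>0 pp))
≤primeProd f (suc N) {x} 0<x below bd with prime? (suc N)
... | no ¬p = ≤primeProd f N 0<x below′ (λ pp p≤ → bd pp (m≤n⇒m≤1+n p≤))
  where
  below′ : ∀ {p} → Prime p → p ∣ x → p ≤ N
  below′ pp p∣ with m≤n⇒m<n∨m≡n (below pp p∣)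
  ... | inj₁ (s≤s lt) = lt
  ... | inj₂ refl = contradiction pp ¬p
... | yes pp with ∥-exists pp {x} (λ x≡0 → <-irrefl (sym x≡0) 0<x)
...   | e , exactly w refl p∤w = *-mono-≤ (bd pp ≤-refl e (m∣m*n w)) (≤primeProd f N 0<w below′ (λ pq q≤ v d → bd pq (m≤n⇒m≤1+n q≤) v (∣n⇒∣m*n (suc N ^ e) d)))
  where
  0<w : 0 < w
  0<w = ≢0⇒0< λ { refl → p∤w (suc N ∣0) }
  below′ : ∀ {q} → Prime q → q ∣ w → q ≤ N
  below′ pq q∣ with m≤n⇒m<n∨m≡n (below pq (∣n⇒∣m*n (suc N ^ e) q∣))
  ... | inj₁ (s≤s lt) = lt
  ... | inj₂ refl = contradiction q∣ p∤w

primeProd-* : ∀ f g N → primeProd (λ p → f p * g p) N ≡ primeProd f N * primeProd g N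
primeProd-* f g zero = refl
primeProd-* f g (suc N) with prime? (suc N)
... | yes _ = trans (cong (f (suc N) * g (suc N) *_) (primeProd-* f g N)) ([m*n]*[o*p]≡[m*o]*[n*p] (f (suc N)) (g (suc N)) _ _)
... | no _  = primeProd-* f g N

-- Coprimality to 210 is periodic, with 48 classes out of 210. Estimates of `π` for all k thus
-- reduce to one evaluation and the period.
coprime210ᵇ : ℕ → Bool
coprime210ᵇ x = not (x %% 2 ≡ᵇ 0) ∧ (not (x %% 3 ≡ᵇ 0) ∧ (not (x %% 5 ≡ᵇ 0) ∧ not (x %% 7 ≡ᵇ 0)))

smallPrimeᵇ : ℕ → Bool
smallPrimeᵇ 2 = true
smallPrimeᵇ 3 = true
smallPrimeᵇ 5 = true
smallPrimeᵇ 7 = true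
smallPrimeᵇ _ = false

candidateᵇ : ℕ → Bool
candidateᵇ x = if x <ᵇ 8 then smallPrimeᵇ x else coprime210ᵇ x

bit : Bool → ℕ
bit true  = 1
bit false = 0

-- an upper bound for the number of primes up to n
π : ℕ → ℕ
π zero    = 0
π (suc n) = bit (candidateᵇ (suc n)) + π n

π-mono : ∀ {m n} → m ≤ n → π m ≤ π n
π-mono {m} {n} m≤n with m≤n⇒m<n∨m≡n m≤n
... | inj₂ refl = ≤-refl
π-mono {m} {suc n} m≤n | inj₁ (s≤s lt) = ≤-trans (π-mono lt) (m≤n+m (π n) _)

prime-smallPrime : ∀ {p} → Prime p → p < 8 → smallPrimeᵇ p ≡ true
prime-smallPrime {0} pp _ = contradiction pp ¬prime[0]
prime-smallPrime {1} pp _ = contradiction pp ¬prime[1]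
prime-smallPrime {2} pp _ = refl
prime-smallPrime {3} pp _ = refl
prime-smallPrime {4} pp _ = contradiction pp (from-no (prime? 4))
prime-smallPrime {5} pp _ = refl
prime-smallPrime {6} pp _ = contradiction pp (from-no (prime? 6))
prime-smallPrime {7} pp _ = refl
prime-smallPrime {suc (suc (suc (suc (suc (suc (suc (suc p)))))))} pp (s≤s (s≤s (s≤s (s≤s (s≤s (s≤s (s≤s (s≤s ()))))))))

prime-candidate : ∀ {p} → Prime p → candidateᵇ p ≡ true
prime-candidate {p} pp with p <ᵇ 8 in small
... | true = prime-smallPrime pp (<ᵇ-true {p} {8} small)
... | false = trans (cong₂ (λ a b → not a ∧ b) (no2 2 (s≤s (s≤s z≤n)) (s≤s (s≤s (s≤s z≤n))))
    (cong₂ (λ a b → not a ∧ b) (no2 3 (s≤s (s≤s z≤n)) (s≤s (s≤s (s≤s (s≤s z≤n))))) (cong₂ (λ a b → not a ∧ not b) (no2 5 (s≤s (s≤s z≤n)) (s≤s (s≤s (s≤s (s≤s (s≤s (s≤s z≤n)))))))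
      (no2 7 (s≤s (s≤s z≤n)) ≤-refl)))) refl
  where
  8≤p : 8 ≤ p
  8≤p = <ᵇ-false {p} {8} small
  no2 : ∀ q → 2 ≤ q → q < 8 → (p %% q ≡ᵇ 0) ≡ false
  no2 q 2≤q q<8 with p %% q ≡ᵇ 0 in eq
  ... | false = refl
  ... | true with prime⇒irreducible pp (%%≡0⇒∣ p (<-≤-trans (s≤s z≤n) 2≤q) (≡ᵇ-true eq))
  ...   | inj₁ refl = contradiction 2≤q λ { (s≤s ()) }
  ...   | inj₂ refl = contradiction 8≤p (<⇒≱ q<8)

primeProd-const : ∀ n N → 0 < n → primeProd (λ _ → n) N ≤ n ^ π N
primeProd-const n zero 0<n = ≤-refl
primeProd-const n (suc N) 0<n with prime? (suc N)
... | yes pp rewrite prime-candidate pp = *-monoʳ-≤ n (primeProd-const n N 0<n)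
... | no _ = ≤-trans (primeProd-const n N 0<n) (^-monoʳ-≤ n {{>-nonZero 0<n}} (π-mono (n≤1+n N)))

primeProd-below : ∀ n r N → 0 < n → primeProd (λ p → if p <ᵇ suc r then n else 1) N ≤ n ^ π r
primeProd-below n r zero 0<n = m^n>0 n {{>-nonZero 0<n}} (π r)
primeProd-below n r (suc N) 0<n with suc N <ᵇ suc r in lt
... | false with prime? (suc N)
...   | yes _ rewrite lt = ≤-trans (≤-reflexive (+-identityʳ _)) (primeProd-below n r N 0<n)
...   | no _ = primeProd-below n r N 0<n
primeProd-below n r (suc N) 0<n | true = ≤-trans (upTo (suc N) (s≤s⁻¹ (<ᵇ-true {suc N} {suc r} lt))) (^-monoʳ-≤ n {{>-nonZero 0<n}} (π-mono (s≤s⁻¹ (<ᵇ-true {suc N} {suc r} lt))))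
  where
  upTo : ∀ M → M ≤ r → primeProd (λ p → if p <ᵇ suc r then n else 1) M ≤ n ^ π M
  upTo zero _ = ≤-refl
  upTo (suc M) M≤ with prime? (suc M)
  ... | no _ = ≤-trans (upTo M (<⇒≤ M≤)) (^-monoʳ-≤ n {{>-nonZero 0<n}} (π-mono (n≤1+n M)))
  ... | yes pp rewrite prime-candidate pp with suc M <ᵇ suc r
  ...   | true = *-monoʳ-≤ n (upTo M (<⇒≤ M≤))
  ...   | false = *-mono-≤ 0<n (upTo M (<⇒≤ M≤))

primeProd-above : ∀ n k j → 0 < n → primeProd (λ p → if k <ᵇ p then n else 1) (k + j) * n ^ π k ≤ n ^ π (k + j)
primeProd-above n k zero 0<n rewrite +-identityʳ k = ≤-reflexive (trans (cong (_* n ^ π k) (ones k ≤-refl)) (*-identityˡ _))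
  where
  ones : ∀ M → M ≤ k → primeProd (λ p → if k <ᵇ p then n else 1) M ≡ 1
  ones zero _ = refl
  ones (suc M) M≤ with prime? (suc M)
  ... | no _ = ones M (<⇒≤ M≤)
  ... | yes _ with k <ᵇ suc M in lt
  ...   | true = contradiction (<ᵇ-true {k} {suc M} lt) (≤⇒≯ M≤)
  ...   | false = trans (+-identityʳ _) (ones M (<⇒≤ M≤))
primeProd-above n k (suc j) 0<n rewrite +-suc k j with prime? (suc (k + j))
... | no _ = ≤-trans (primeProd-above n k j 0<n) (^-monoʳ-≤ n {{>-nonZero 0<n}} (π-mono (n≤1+n (k + j))))
... | yes pp rewrite prime-candidate pp with k <ᵇ suc (k + j) in lt
...   | true = ≤-trans (≤-reflexive (*-assoc n _ (n ^ π k))) (*-monoʳ-≤ n (primeProd-above n k j 0<n))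
...   | false = ≤-trans (≤-reflexive (cong (_* n ^ π k) (+-identityʳ (primeProd (λ p → if k <ᵇ p then n else 1) (k + j))))) (≤-trans (primeProd-above n k j 0<n) (m≤n*m (n ^ π (k + j)) n {{>-nonZero 0<n}}))

-- Factor by factor, (m + j) / j ≥ (m + k) / k for 1 ≤ j ≤ k.
pow≤binom : ∀ m k → (m + k) ^ k ≤ k ^ k * binom m k
pow≤binom m k = *-cancelʳ-≤ _ _ (k !) {{k !≢0}} (begin
  (m + k) ^ k * k !          ≤⟨ partial k ≤-refl ⟩
  k ^ k * asc m k            ≡⟨ cong (k ^ k *_) (sym (binom-! m k)) ⟩
  k ^ k * (binom m k * k !)  ≡⟨ sym (*-assoc (k ^ k) _ _) ⟩
  k ^ k * binom m k * k !    ∎)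
  where
  open ≤-Reasoning
  ring₁ : ∀ a P j f → a * P * (j * f) ≡ (a * j) * (P * f)
  ring₁ = solve-∀
  ring₂ : ∀ k P a c → (k * c) * (P * a) ≡ k * P * (a * c)
  ring₂ = solve-∀
  term : ∀ j → j ≤ k → (m + k) * j ≤ k * (m + j)
  term j j≤k = begin
    (m + k) * j    ≡⟨ *-distribʳ-+ j m k ⟩
    m * j + k * j  ≤⟨ +-monoˡ-≤ (k * j) (≤-trans (*-monoʳ-≤ m j≤k) (≤-reflexive (*-comm m k))) ⟩
    k * m + k * j  ≡⟨ sym (*-distribˡ-+ k m j) ⟩
    k * (m + j)    ∎
  partial : ∀ j → j ≤ k → (m + k) ^ j * j ! ≤ k ^ j * asc m j
  partial zero _ = ≤-refl
  partial (suc j) j<k = begin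
    (m + k) * (m + k) ^ j * (suc j * j !)      ≡⟨ ring₁ (m + k) ((m + k) ^ j) (suc j) (j !) ⟩
    ((m + k) * suc j) * ((m + k) ^ j * j !)    ≤⟨ *-mono-≤ (term (suc j) j<k) (partial j (<⇒≤ j<k)) ⟩
    (k * (m + suc j)) * (k ^ j * asc m j)      ≡⟨ ring₂ k (k ^ j) (asc m j) (m + suc j) ⟩
    k * k ^ j * (asc m j * (m + suc j))        ∎

prime∣asc : ∀ {p} → Prime p → ∀ m d → p ∣ asc m d → ∃ λ i → 0 < i × i ≤ d × p ∣ m + i
prime∣asc pp m zero d∣ = contradiction d∣ (p∤1 pp)
prime∣asc pp m (suc d) d∣ with euclidsLemma (asc m d) (m + suc d) pp d∣
... | inj₂ e = suc d , s≤s z≤n , ≤-refl , e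
... | inj₁ e = let (i , 0<i , i≤ , e′) = prime∣asc pp m d e in i , 0<i , m≤n⇒m≤1+n i≤ , e′

-- For n = m + k the numbers n - l with l < k are the m + i. A prime p ≥ k + 92 satisfies s + l < p
-- for all s ≤ 92 and l < k, so it leaves no room for a carry.
Smooth : ℕ → ℕ → Set
Smooth m k = ∀ {p i} → Prime p → k + 92 ≤ p → 0 < i → i ≤ k → p ∤ m + i

binom>0 : ∀ m k → 0 < binom m k
binom>0 m k = ≢0⇒0< (binom≢0 m k)

smooth⇒≤ : ∀ {m k} → Smooth m k → ∀ {p} → Prime p → p ∣ binom m k → p ≤ k + 91
smooth⇒≤ {m} {k} smooth {p} pp p∣ = ≮⇒≥ λ lt →
  let (i , 0<i , i≤ , d) = prime∣asc pp m k (subst (p ∣_) (binom-! m k) (∣m⇒∣m*n (k !) p∣))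
  in smooth pp (subst (_≤ p) (sym (+-suc k 91)) lt) 0<i i≤ d

smooth-bound : ∀ m k → 0 < k → Smooth m k → (m + k) ^ k ≤ k ^ k * (m + k) ^ π (k + 91)
smooth-bound m k 0<k smooth = ≤-trans (pow≤binom m k) (*-monoʳ-≤ (k ^ k)
  (≤-trans (≤primeProd (λ _ → m + k) (k + 91) (binom>0 m k) (smooth⇒≤ smooth) (λ pp _ v d → p^∣binom⇒≤′ pp {v} m k 0<k d))
    (primeProd-const (m + k) (k + 91) (<-≤-trans 0<k (m≤n+m k m)))))

-- c carries π(k + 91) along, so that a row costs one candidate test. For k < 2^b and n ≥ 2^e a row
-- contradicts n^(k - c) ≤ k^k on comparing exponents of 2.
tableᵇ : (fuel k c e b : ℕ) → Bool
tableᵇ zero    k c e b = true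
tableᵇ (suc f) k c e b = (b * k <ᵇ suc (e * (k ∸ c))) ∧ tableᵇ f (suc k) (bit (candidateᵇ (k + 92)) + c) e b

tableᵇ-sound : ∀ f {k c} e b → c ≡ π (k + 91) → tableᵇ f k c e b ≡ true → ∀ k′ → k ≤ k′ → k′ < k + f →
  b * k′ ≤ e * (k′ ∸ π (k′ + 91))
tableᵇ-sound zero {k} e b c≡ eq k′ k≤ k′< = contradiction k≤ (<⇒≱ (subst (k′ <_) (+-identityʳ k) k′<))
tableᵇ-sound (suc f) {k} {c} e b c≡ eq k′ k≤ k′< with ∧-true {b * k <ᵇ suc (e * (k ∸ c))} eq | m≤n⇒m<n∨m≡n k≤
... | now , _ | inj₂ refl = subst (λ z → b * k ≤ e * (k ∸ z)) c≡ (s≤s⁻¹ (<ᵇ-true {b * k} now))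
... | _ , later | inj₁ lt = tableᵇ-sound f e b (trans (cong (bit (candidateᵇ (k + 92)) +_) c≡)
        (trans (cong (λ z → bit (candidateᵇ z) + π (k + 91)) (+-suc k 91)) refl)) later k′ lt (subst (k′ <_) (+-suc k f) k′<)

pow-contradiction : ∀ {n k c e b} → 0 < k → 0 < b → k < 2 ^ b → 2 ^ e ≤ n → b * k ≤ e * (k ∸ c) → n ^ k ≤ k ^ k * n ^ c → ⊥
pow-contradiction {n} {k} {c} {e} {b} 0<k 0<b k<2^b 2^e≤n bk≤ le with k ≤? c
... | yes k≤c = contradiction (≤-trans bk≤ (≤-reflexive (trans (cong (e *_) (m≤n⇒m∸n≡0 k≤c)) (*-zeroʳ e)))) (<⇒≱ (*-mono-< 0<b 0<k))
... | no k≰c = <⇒≱ (begin-strict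
    k ^ k               <⟨ ^-monoˡ-< k {{>-nonZero 0<k}} k<2^b ⟩
    (2 ^ b) ^ k         ≡⟨ ^-*-assoc 2 b k ⟩
    2 ^ (b * k)         ≤⟨ ^-monoʳ-≤ 2 bk≤ ⟩
    2 ^ (e * (k ∸ c))   ≡⟨ sym (^-*-assoc 2 e (k ∸ c)) ⟩
    (2 ^ e) ^ (k ∸ c)   ≤⟨ ^-monoˡ-≤ (k ∸ c) 2^e≤n ⟩
    n ^ (k ∸ c)         ∎)
    (*-cancelʳ-≤ _ _ (n ^ c) {{m^n≢0 n c {{>-nonZero 0<n}}}} (≤-trans (≤-reflexive (trans (sym (^-distribˡ-+-* n (k ∸ c) c)) (cong (n ^_) (m∸n+n≡m (<⇒≤ (≰⇒> k≰c)))))) le))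
  where
  open ≤-Reasoning
  0<n : 0 < n
  0<n = <-≤-trans (m^n>0 2 e) 2^e≤n

coprimeCount : ℕ → ℕ → ℕ
coprimeCount a zero    = 0
coprimeCount a (suc j) = bit (coprime210ᵇ (a + suc j)) + coprimeCount a j

coprime210-periodic : ∀ x → coprime210ᵇ (x + 210) ≡ coprime210ᵇ x
coprime210-periodic x = cong₂ (λ a b → not a ∧ b) (at 2 105 refl) (cong₂ (λ a b → not a ∧ b) (at 3 70 refl) (cong₂ (λ a b → not a ∧ not b) (at 5 42 refl) (at 7 30 refl)))
  where
  at : ∀ q t → 210 ≡ t * q → ((x + 210) %% q ≡ᵇ 0) ≡ (x %% q ≡ᵇ 0)
  at zero    t eq = contradiction (trans eq (*-zeroʳ t)) λ ()
  at (suc q) t eq = cong (_≡ᵇ 0) (trans (cong (λ z → (x + z) % suc q) eq) ([m+kn]%n≡m%n x t (suc q)))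

coprimeCount-shift : ∀ a j → coprimeCount (suc a) j + bit (coprime210ᵇ (suc a)) ≡ coprimeCount a (suc j)
coprimeCount-shift a zero = sym (trans (+-identityʳ _) (cong (bit ∘ coprime210ᵇ) (+-comm a 1)))
coprimeCount-shift a (suc j) = trans (+-assoc (bit (coprime210ᵇ (suc a + suc j))) _ _)
  (cong₂ _+_ (cong (bit ∘ coprime210ᵇ) (sym (+-suc a (suc j)))) (coprimeCount-shift a j))

coprimeCount-210 : ∀ a → coprimeCount a 210 ≡ 48
coprimeCount-210 zero = refl
coprimeCount-210 (suc a) = +-cancelʳ-≡ (bit (coprime210ᵇ (suc a))) _ _ (trans (coprimeCount-shift a 210)
  (trans (cong₂ _+_ (cong bit (trans (cong coprime210ᵇ (+-suc a 210)) (coprime210-periodic (suc a)))) (coprimeCount-210 a)) (+-comm (bit (coprime210ᵇ (suc a))) 48)))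

π-+ : ∀ a j → 7 ≤ a → π (a + j) ≡ coprimeCount a j + π a
π-+ a zero _ = cong π (+-identityʳ a)
π-+ a (suc j) 7≤a = trans (cong π (+-suc a j)) (trans (cong₂ _+_ (cong bit (trans step₁ (cong coprime210ᵇ (sym (+-suc a j))))) (π-+ a j 7≤a))
  (sym (+-assoc (bit (coprime210ᵇ (a + suc j))) _ _)))
  where
  step₁ : candidateᵇ (suc (a + j)) ≡ coprime210ᵇ (suc (a + j))
  step₁ with suc (a + j) <ᵇ 8 in eq
  ... | true = contradiction (<ᵇ-true {suc (a + j)} {8} eq) (≤⇒≯ (s≤s (≤-trans 7≤a (m≤m+n a j))))
  ... | false = refl

π-210 : ∀ a → 7 ≤ a → π (a + 210) ≡ 48 + π a
π-210 a 7≤a = trans (π-+ a 210 7≤a) (cong (_+ π a) (coprimeCount-210 a))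

π-quarter : ∀ a b → 7 ≤ a → π a * 4 < b → ∀ i → π (a + i * 210) * 4 < b + i * 210
π-quarter a b 7≤a base zero = subst₂ _<_ (cong (λ z → π z * 4) (sym (+-identityʳ a))) (sym (+-identityʳ b)) base
π-quarter a b 7≤a base (suc i) = begin-strict
  π (a + (210 + i * 210)) * 4    ≡⟨ cong (λ z → π z * 4) (ring a 210 (i * 210)) ⟩
  π (a + i * 210 + 210) * 4      ≡⟨ cong (_* 4) {π (a + i * 210 + 210)} {48 + π (a + i * 210)} (π-210 (a + i * 210) (≤-trans 7≤a (m≤m+n a (i * 210)))) ⟩
  (48 + π (a + i * 210)) * 4     ≡⟨ *-distribʳ-+ 4 48 (π (a + i * 210)) ⟩
  192 + π (a + i * 210) * 4      <⟨ +-mono-≤-< (<ᵇ-true {191} {210} refl) (π-quarter a b 7≤a base i) ⟩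
  210 + (b + i * 210)            ≡⟨ ring′ 210 b (i * 210) ⟩
  b + (210 + i * 210)            ∎
  where
  open ≤-Reasoning
  ring : ∀ a b c → a + (b + c) ≡ a + c + b
  ring = solve-∀
  ring′ : ∀ a b c → a + (b + c) ≡ b + (a + c)
  ring′ = solve-∀

-- 300 = 209 + 91: rounding k down to K plus a multiple of 210 loses at most 209, and 91 is the
-- shift in π(k + 91).
π-quarter-from : ∀ K → 7 ≤ K → π (K + 300) * 4 < K → ∀ k → K ≤ k → π (k + 91) * 4 < k
π-quarter-from K 7≤K base k K≤k = ≤-<-trans (*-monoˡ-≤ 4 (π-mono k+91≤))
  (<-≤-trans (π-quarter (K + 300) K (≤-trans 7≤K (m≤m+n K 300)) base i) ≤k)
  where
  d = k ∸ K
  i = d // 210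
  d≡ : d ≡ 210 * i + d %% 210
  d≡ = //-%% d 210 (s≤s z≤n)
  k≡ : k ≡ K + d
  k≡ = sym (m+[n∸m]≡n K≤k)
  ≤k : K + i * 210 ≤ k
  ≤k = ≤-trans (+-monoʳ-≤ K (≤-trans (≤-reflexive (*-comm i 210)) (≤-trans (m≤m+n (210 * i) (d %% 210)) (≤-reflexive (sym d≡))))) (≤-reflexive (sym k≡))
  k+91≤ : k + 91 ≤ K + 300 + i * 210
  k+91≤ = begin
    k + 91                            ≡⟨ cong (_+ 91) (trans k≡ (cong (K +_) d≡)) ⟩
    K + (210 * i + d %% 210) + 91     ≤⟨ +-monoˡ-≤ 91 (+-monoʳ-≤ K (+-monoʳ-≤ (210 * i) (s≤s⁻¹ (%%-< d {210} (s≤s z≤n))))) ⟩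
    K + (210 * i + 209) + 91          ≡⟨ ring K (210 * i) 209 91 ⟩
    K + (209 + 91) + 210 * i          ≡⟨ cong (K + 300 +_) (*-comm 210 i) ⟩
    K + 300 + i * 210                 ∎
    where
    open ≤-Reasoning
    ring : ∀ a x b c → a + (x + b) + c ≡ a + (b + c) + x
    ring = solve-∀

-- The fourth power of `smooth-bound` reads n^(4k) ≤ k^(4k) n^(4c) ≤ n^(3k + 4c), whereas 4c < k.
polynomial-range : ∀ m k → 1 < k → π (k + 91) * 4 < k → Smooth m k → k ^ 4 ≤ (m + k) ^ 3 → ⊥
polynomial-range m k 1<k quarter smooth k⁴≤n³ = <⇒≱ (^-monoʳ-< n 1<n exponents) (begin
  n ^ (k * 4)                        ≡⟨ sym (^-*-assoc n k 4) ⟩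
  (n ^ k) ^ 4                        ≤⟨ ^-monoˡ-≤ 4 (smooth-bound m k 0<k smooth) ⟩
  (k ^ k * n ^ c) ^ 4                ≡⟨ ^-distribʳ-* 4 (k ^ k) (n ^ c) ⟩
  (k ^ k) ^ 4 * (n ^ c) ^ 4          ≡⟨ cong₂ _*_ (trans (^-*-assoc k k 4) (trans (cong (k ^_) (*-comm k 4)) (sym (^-*-assoc k 4 k)))) (^-*-assoc n c 4) ⟩
  (k ^ 4) ^ k * n ^ (c * 4)          ≤⟨ *-monoˡ-≤ (n ^ (c * 4)) (^-monoˡ-≤ k k⁴≤n³) ⟩
  (n ^ 3) ^ k * n ^ (c * 4)          ≡⟨ cong (_* n ^ (c * 4)) (^-*-assoc n 3 k) ⟩
  n ^ (3 * k) * n ^ (c * 4)          ≡⟨ sym (^-distribˡ-+-* n (3 * k) (c * 4)) ⟩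
  n ^ (3 * k + c * 4)                ∎)
  where
  open ≤-Reasoning
  n = m + k
  c = π (k + 91)
  0<k : 0 < k
  0<k = <⇒≤ 1<k
  1<n : 1 < n
  1<n = <-≤-trans 1<k (m≤n+m k m)
  exponents : 3 * k + c * 4 < k * 4
  exponents = <-≤-trans (+-monoʳ-< (3 * k) quarter) (≤-reflexive (ring k))
    where
    ring : ∀ k → 3 * k + k ≡ k * 4
    ring = solve-∀
  ^-distribʳ-* : ∀ o a b → (a * b) ^ o ≡ a ^ o * b ^ o
  ^-distribʳ-* zero a b = refl
  ^-distribʳ-* (suc o) a b = trans (cong (a * b *_) (^-distribʳ-* o a b)) ([m*n]*[o*p]≡[m*o]*[n*p] a b _ _)

-- Primorials and the argument of Erdős

prime∣!⇒≤ : ∀ {p} → Prime p → ∀ m → p ∣ m ! → p ≤ m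
prime∣!⇒≤ pp zero d∣ = contradiction d∣ (p∤1 pp)
prime∣!⇒≤ pp (suc m) d∣ with euclidsLemma (suc m) (m !) pp d∣
... | inj₁ e = ∣⇒≤ e
... | inj₂ e = m≤n⇒m≤1+n (prime∣!⇒≤ pp m e)

windowProd : ℕ → ℕ → ℕ
windowProd a zero = 1
windowProd a (suc j) with prime? (suc (a + j))
... | yes _ = suc (a + j) * windowProd a j
... | no _  = windowProd a j

primorial : ℕ → ℕ
primorial = primeProd (λ p → p)

primorial-+ : ∀ a j → primorial (a + j) ≡ windowProd a j * primorial a
primorial-+ a zero = trans (cong primorial (+-identityʳ a)) (sym (*-identityˡ _))
primorial-+ a (suc j) rewrite +-suc a j with prime? (suc (a + j))
... | yes _ = trans (cong (suc (a + j) *_) (primorial-+ a j)) (sym (*-assoc (suc (a + j)) (windowProd a j) (primorial a)))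
... | no _  = primorial-+ a j

windowProd-∤ : ∀ {p} → Prime p → ∀ a j → a + j < p → p ∤ windowProd a j
windowProd-∤ pp a zero _ = p∤1 pp
windowProd-∤ {p} pp a (suc j) lt with prime? (suc (a + j))
... | yes _ = ∤-* pp (λ d∣ → <⇒≱ (subst (_< p) (+-suc a j) lt) (∣⇒≤ d∣)) (windowProd-∤ pp a j (≤-<-trans (+-monoʳ-≤ a (n≤1+n j)) lt))
... | no _ = windowProd-∤ pp a j (≤-<-trans (+-monoʳ-≤ a (n≤1+n j)) lt)

windowProd-∣ : ∀ a N j → (∀ {p} → Prime p → a < p → p ≤ a + j → p ∣ N) → windowProd a j ∣ N
windowProd-∣ a N zero all = 1∣ N
windowProd-∣ a N (suc j) all with prime? (suc (a + j)) | windowProd-∣ a N j (λ pp a< p≤ → all pp a< (≤-trans p≤ (+-monoʳ-≤ a (n≤1+n j))))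
... | no _ | rest = rest
... | yes pp | divides z refl with euclidsLemma z (windowProd a j) pp (all pp (s≤s (m≤m+n a j)) (≤-reflexive (sym (+-suc a j))))
...   | inj₂ e = contradiction e (windowProd-∤ pp a j ≤-refl)
...   | inj₁ (divides y refl) = divides y (*-assoc y (suc (a + j)) (windowProd a j))

-- Successive quotients are 2 (2m + 3) / (m + 2) < 4.
central : ∀ m → binom (suc m) m ≤ 4 ^ m
central zero = ≤-reflexive (binom-zero 1)
central (suc m) = *-cancelʳ-≤ _ _ (suc m * suc (suc m)) (begin
  B′ * (suc m * suc (suc m))                           ≡⟨ ring₁ B′ (suc m) (suc (suc m)) ⟩
  (B′ * suc m) * suc (suc m)                           ≡⟨ cong (_* suc (suc m)) (binom-sucʳ (suc (suc m)) m) ⟩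
  suc (suc (suc m) + m) * binom (suc (suc m)) m * suc (suc m)   ≡⟨ *-assoc (suc (suc (suc m) + m)) (binom (suc (suc m)) m) (suc (suc m)) ⟩
  suc (suc (suc m) + m) * (binom (suc (suc m)) m * suc (suc m)) ≡⟨ cong (suc (suc (suc m) + m) *_) (binom-suc (suc m) m) ⟩
  suc (suc (suc m) + m) * (binom (suc m) m * (suc m + suc m))   ≤⟨ *-monoˡ-≤ _ (≤-reflexive (ring₂ m)) ⟩
  (2 * m + 3) * (binom (suc m) m * (suc m + suc m))    ≤⟨ *-mono-≤ (≤-trans (+-monoʳ-≤ (2 * m) (n≤1+n 3)) (≤-reflexive (ring₃ m))) ≤-refl ⟩
  (2 * suc (suc m)) * (binom (suc m) m * (suc m + suc m)) ≡⟨ ring₄ m (binom (suc m) m) ⟩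
  4 * binom (suc m) m * (suc m * suc (suc m))          ≤⟨ *-monoˡ-≤ (suc m * suc (suc m)) (*-monoʳ-≤ 4 (central m)) ⟩
  4 * 4 ^ m * (suc m * suc (suc m))                    ∎)
  where
  open ≤-Reasoning
  B′ = binom (suc (suc m)) (suc m)
  ring₁ : ∀ a b c → a * (b * c) ≡ a * b * c
  ring₁ = solve-∀
  ring₂ : ∀ m → suc (suc (suc m) + m) ≡ 2 * m + 3
  ring₂ = solve-∀
  ring₃ : ∀ m → 2 * m + 4 ≡ 2 * suc (suc m)
  ring₃ = solve-∀
  ring₄ : ∀ m b → (2 * suc (suc m)) * (b * (suc m + suc m)) ≡ 4 * b * (suc m * suc (suc m))
  ring₄ = solve-∀

-- Induction after Erdős: the primes in (m + 1, 2m + 1] all divide C(2m + 1, m) ≤ 4^m, and an even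
-- number beyond 2 adds no prime.
primorial≤ : ∀ x → primorial x ≤ 4 ^ x
primorial≤ x = go (<-wellFounded x)
  where
  go : ∀ {x} → Acc _<_ x → primorial x ≤ 4 ^ x
  odd : ∀ m → primorial (suc m) ≤ 4 ^ suc m → primorial (suc (m + m)) ≤ 4 ^ suc (m + m)
  odd m IH = begin
    primorial (suc m + m)                 ≡⟨ primorial-+ (suc m) m ⟩
    windowProd (suc m) m * primorial (suc m) ≤⟨ *-mono-≤ (≤-trans (∣⇒≤′ (≢0⇒0< (binom≢0 (suc m) m)) (windowProd-∣ (suc m) (binom (suc m) m) m divides-binom)) (central m)) IH ⟩
    4 ^ m * 4 ^ suc m                     ≡⟨ trans (sym (^-distribˡ-+-* 4 m (suc m))) (cong (4 ^_) (+-suc m m)) ⟩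
    4 ^ suc (m + m)                       ∎
    where
    open ≤-Reasoning
    divides-binom : ∀ {p} → Prime p → suc m < p → p ≤ suc m + m → p ∣ binom (suc m) m
    divides-binom {p} pp lt le with euclidsLemma (binom (suc m) m) (m !) pp
      (subst (p ∣_) (sym (binom-! (suc m) m)) (subst (_∣ asc (suc m) m) (m+[n∸m]≡n (<⇒≤ lt)) (∣asc (suc m) (m<n⇒0<n∸m lt) (m≤n+o⇒m∸n≤o p (suc m) le))))
    ... | inj₁ e = e
    ... | inj₂ e = contradiction (prime∣!⇒≤ pp m e) (<⇒≱ (<-trans (n<1+n m) lt))
  go {zero} _ = ≤-refl
  go {suc zero} _ = s≤s z≤n
  go {suc (suc x)} (acc rec) with divMod 2 (s≤s z≤n) (suc (suc x))
  ... | zero , r , r<2 , eq = contradiction (subst (_< 2) (sym eq) r<2) λ { (s≤s (s≤s ())) }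
  ... | suc m , 1 , _ , eq = subst (λ z → primorial z ≤ 4 ^ z) (sym x≡) (odd (suc m) (go (rec (subst (suc (suc m) <_) (sym x≡) (s≤s (m<n+m (suc m) (s≤s z≤n)))))))
    where
    x≡ : suc (suc x) ≡ suc (suc m + suc m)
    x≡ = trans eq (ring m)
      where
      ring : ∀ m → 2 * suc m + 1 ≡ suc (suc m + suc m)
      ring = solve-∀
  ... | suc m , suc (suc r) , s≤s (s≤s ()) , eq
  ... | suc zero , 0 , _ , refl = <ᵇ-true {1} {16} refl
  ... | suc (suc m) , 0 , _ , eq with prime? (suc (suc x))
  ...   | no _ = ≤-trans (go (rec ≤-refl)) (^-monoʳ-≤ 4 (n≤1+n (suc x)))
  ...   | yes pp with prime⇒irreducible pp {2} (divides (suc (suc m)) (trans eq (trans (+-identityʳ _) (*-comm 2 (suc (suc m))))))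
  ...     | inj₁ ()
  ...     | inj₂ refl = contradiction (*-cancelˡ-≡ 1 (suc (suc m)) 2 (trans eq (+-identityʳ _))) λ ()

primeProd-id-below : ∀ x N → primeProd (λ p → if p <ᵇ suc x then p else 1) N ≤ primorial x
primeProd-id-below x zero = primorial>0 x
  where
  primorial>0 : ∀ x → 0 < primorial x
  primorial>0 zero = s≤s z≤n
  primorial>0 (suc x) with prime? (suc x)
  ... | yes _ = *-mono-≤ {1} {suc x} (s≤s z≤n) (primorial>0 x)
  ... | no _ = primorial>0 x
primeProd-id-below x (suc N) with suc N <ᵇ suc x in lt
... | false with prime? (suc N)
...   | yes _ rewrite lt = ≤-trans (≤-reflexive (+-identityʳ _)) (primeProd-id-below x N)
...   | no _ = primeProd-id-below x N
primeProd-id-below x (suc N) | true = ≤-trans (upTo (suc N)) (mono x (s≤s⁻¹ (<ᵇ-true {suc N} {suc x} lt)))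
  where
  upTo : ∀ M → primeProd (λ p → if p <ᵇ suc x then p else 1) M ≤ primorial M
  upTo zero = ≤-refl
  upTo (suc M) with prime? (suc M)
  ... | no _ = upTo M
  ... | yes pp with suc M <ᵇ suc x
  ...   | true = *-monoʳ-≤ (suc M) (upTo M)
  ...   | false = *-mono-≤ {1} {suc M} (s≤s z≤n) (upTo M)
  mono : ∀ x {M} → M ≤ x → primorial M ≤ primorial x
  mono zero z≤n = ≤-refl
  mono (suc x) M≤ with m≤n⇒m<n∨m≡n M≤
  ... | inj₂ refl = ≤-refl
  ... | inj₁ (s≤s lt) with prime? (suc x)
  ...   | yes _ = ≤-trans (mono x lt) (m≤n*m (primorial x) (suc x))
  ...   | no _ = mono x lt

-- A prime p with n/3 < p ≤ k ≤ n/2 occurs twice in n! and twice in k!(n-k)!.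
no-middle-prime : ∀ {p} → Prime p → ∀ m k → k ≤ m → p ≤ k → 2 < p → m + k < 3 * p → p ∤ binom m k
no-middle-prime {p} pp m k k≤m p≤k 2<p n<3p = subst₂ (λ x y → p ∤ binom x y) m≡ k≡
  (lucas pp 1 1 {m ∸ p} {k ∸ p} rems λ d∣ → <⇒≱ 2<p (∣⇒≤ d∣))
  where
  p≤m = ≤-trans p≤k k≤m
  m≡ : p * 1 + (m ∸ p) ≡ m
  m≡ = trans (cong (_+ (m ∸ p)) (*-identityʳ p)) (m+[n∸m]≡n p≤m)
  k≡ : p * 1 + (k ∸ p) ≡ k
  k≡ = trans (cong (_+ (k ∸ p)) (*-identityʳ p)) (m+[n∸m]≡n p≤k)
  rems : (m ∸ p) + (k ∸ p) < p
  rems = +-cancelˡ-< (p * 1 + p * 1) _ _ (subst₂ _<_ (trans (cong₂ _+_ (sym m≡) (sym k≡)) (ring₁ (p * 1) (m ∸ p) (k ∸ p))) (ring₂ p) n<3p)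
    where
    ring₁ : ∀ q a b → (q + a) + (q + b) ≡ (q + q) + (a + b)
    ring₁ = solve-∀
    ring₂ : ∀ p → 3 * p ≡ p * 1 + p * 1 + p
    ring₂ = solve-∀

-- Primes up to r contribute at most n each. As r² > n, those in (r, k] occur at most once, and
-- above n / 3 not at all, whence the primorial. The interval (k, k + 91] holds at most 48
-- candidates, those of one period of the sieve.
upper : ∀ m k r → 7 ≤ k → k ≤ m → 2 ≤ r → m + k < r * r → Smooth m k →
  binom m k ≤ (m + k) ^ π r * (4 ^ (k ⊓ ((m + k) // 3)) * (m + k) ^ 48)
upper m k r 7≤k k≤m 2≤r n<r² smooth = begin
  binom m k                           ≤⟨ ≤primeProd f (k + 91) (binom>0 m k) (smooth⇒≤ smooth) bound ⟩
  primeProd f (k + 91)                ≡⟨ trans (primeProd-* f₁ (λ p → f₂ p * f₃ p) (k + 91)) (cong (primeProd f₁ (k + 91) *_) (primeProd-* f₂ f₃ (k + 91))) ⟩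
  primeProd f₁ (k + 91) * (primeProd f₂ (k + 91) * primeProd f₃ (k + 91))
    ≤⟨ *-mono-≤ (primeProd-below n r (k + 91) 0<n) (*-mono-≤ (≤-trans (primeProd-id-below x (k + 91)) (primorial≤ x)) window) ⟩
  n ^ π r * (4 ^ x * n ^ 48)          ∎
  where
  open ≤-Reasoning
  n = m + k
  x = k ⊓ (n // 3)
  f₁ f₂ f₃ f : ℕ → ℕ
  f₁ p = if p <ᵇ suc r then n else 1
  f₂ p = if p <ᵇ suc x then p else 1
  f₃ p = if k <ᵇ p then n else 1
  f p = f₁ p * (f₂ p * f₃ p)
  0<k = <-≤-trans (s≤s z≤n) 7≤k
  0<n : 0 < n
  0<n = <-≤-trans 0<k (m≤n+m k m)
  window : primeProd f₃ (k + 91) ≤ n ^ 48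
  window = *-cancelʳ-≤ _ _ (n ^ π k) {{m^n≢0 n (π k) {{>-nonZero 0<n}}}} (≤-trans (primeProd-above n k 91 0<n)
    (≤-trans (^-monoʳ-≤ n {{>-nonZero 0<n}} (≤-trans (π-mono (+-monoʳ-≤ k (<ᵇ-true {90} {210} refl))) (≤-reflexive (π-210 k 7≤k))))
      (≤-reflexive (^-distribˡ-+-* n 48 (π k)))))
  f₂>0 : ∀ p → 0 < p → 0 < f₂ p
  f₂>0 p 0<p with p <ᵇ suc x
  ... | true = 0<p
  ... | false = s≤s z≤n
  f₃>0 : ∀ p → 0 < f₃ p
  f₃>0 p with k <ᵇ p
  ... | true = 0<n
  ... | false = s≤s z≤n
  ≤*₁ : ∀ {a b} → 0 < b → a ≤ a * b
  ≤*₁ {a} {b} 0<b = m≤m*n a b {{>-nonZero 0<b}}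
  ≤*₂ : ∀ {a b} → 0 < a → b ≤ a * b
  ≤*₂ {a} {b} 0<a = m≤n*m b a {{>-nonZero 0<a}}
  bound : ∀ {p} → Prime p → p ≤ k + 91 → ∀ v → p ^ v ∣ binom m k → p ^ v ≤ f p
  bound {p} pp _ v d∣ with p <ᵇ suc r in small
  ... | true = ≤-trans (p^∣binom⇒≤′ pp {v} m k 0<k d∣) (≤*₁ (*-mono-< (f₂>0 p (prime>0 pp)) (f₃>0 p)))
  ... | false with k <ᵇ p in large
  ...   | true = ≤-trans (p^∣binom⇒≤′ pp {v} m k 0<k d∣) (≤-trans (≤*₂ (f₂>0 p (prime>0 pp))) (≤-reflexive (sym (+-identityʳ _))))
  ...   | false = ≤-trans (low v d∣) (≤-reflexive (sym (trans (+-identityʳ _) (*-identityʳ _))))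
    where
    r<p : r < p
    r<p = <ᵇ-false {p} {suc r} small
    p≤k : p ≤ k
    p≤k = <ᵇ-false {k} {p} large
    low : ∀ v → p ^ v ∣ binom m k → p ^ v ≤ f₂ p
    low zero _ = f₂>0 p (prime>0 pp)
    low (suc zero) d with p <ᵇ suc x in e
    ... | true = ≤-reflexive (*-identityʳ p)
    ... | false = contradiction (subst (_∣ binom m k) (*-identityʳ p) d) (no-middle-prime pp m k k≤m p≤k (≤-<-trans 2≤r r<p) n<3p)
      where
      n//3<p : n // 3 < p
      n//3<p = ≰⇒> λ p≤ → <⇒≱ (<ᵇ-false {p} {suc x} e) (⊓-glb p≤k p≤)
      n<3p : n < 3 * p
      n<3p = begin-strict
        n                         ≡⟨ //-%% n 3 (s≤s z≤n) ⟩
        3 * (n // 3) + n %% 3     <⟨ +-monoʳ-< (3 * (n // 3)) (%%-< n {3} (s≤s z≤n)) ⟩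
        3 * (n // 3) + 3          ≡⟨ trans (+-comm _ 3) (sym (*-suc 3 (n // 3))) ⟩
        3 * suc (n // 3)          ≤⟨ *-monoʳ-≤ 3 n//3<p ⟩
        3 * p                     ∎
    low (suc (suc v)) d = contradiction (≤-trans (≤-trans (*-monoʳ-≤ p (m≤m*n p (p ^ v) {{m^n≢0 p v {{prime⇒nonZero pp}}}})) (p^∣binom⇒≤′ pp {suc (suc v)} m k 0<k d)) (<⇒≤ n<r²))
      (<⇒≱ (*-mono-< r<p r<p))

4^k≤ : ∀ k → 0 < k → 4 ^ k ≤ 2 * k * binom k k
4^k≤ (suc zero) _ = ≤-refl
4^k≤ (suc k@(suc _)) _ = *-cancelʳ-≤ _ _ (suc k * k) (begin
  4 * 4 ^ k * (suc k * k)                    ≤⟨ *-monoˡ-≤ (suc k * k) (*-monoʳ-≤ 4 (4^k≤ k (s≤s z≤n))) ⟩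
  4 * (2 * k * binom k k) * (suc k * k)      ≡⟨ ring₁ k (binom k k) ⟩
  (4 * k) * (binom k k * (2 * k)) * suc k    ≤⟨ *-monoˡ-≤ (suc k) (*-monoʳ-≤ (4 * k) (*-monoʳ-≤ (binom k k) (m≤m+n (2 * k) 1))) ⟩
  (4 * k) * (binom k k * (2 * k + 1)) * suc k ≡⟨ cong (λ z → (4 * k) * (binom k k * z) * suc k) (ring₂ k) ⟩
  (4 * k) * (binom k k * (k + suc k)) * suc k ≡⟨ cong (λ z → (4 * k) * z * suc k) (sym (binom-suc k k)) ⟩
  (4 * k) * (binom (suc k) k * suc k) * suc k ≡⟨ ring₃ k (binom (suc k) k) ⟩
  2 * suc k * (suc (suc k + k) * binom (suc k) k) * k ≡⟨ cong (λ z → 2 * suc k * z * k) (sym (binom-sucʳ (suc k) k)) ⟩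
  2 * suc k * (binom (suc k) (suc k) * suc k) * k ≡⟨ ring₄ (2 * suc k) (binom (suc k) (suc k)) (suc k) k ⟩
  2 * suc k * binom (suc k) (suc k) * (suc k * k) ∎)
  where
  open ≤-Reasoning
  ring₁ : ∀ k b → 4 * (2 * k * b) * (suc k * k) ≡ (4 * k) * (b * (2 * k)) * suc k
  ring₁ = solve-∀
  ring₂ : ∀ k → 2 * k + 1 ≡ k + suc k
  ring₂ = solve-∀
  ring₃ : ∀ k b → (4 * k) * (b * suc k) * suc k ≡ 2 * suc k * (suc (suc k + k) * b) * k
  ring₃ = solve-∀
  ring₄ : ∀ a b c d → a * (b * c) * d ≡ a * b * (c * d)
  ring₄ = solve-∀

binom-monoˡ : ∀ {m m′} k → m ≤ m′ → binom m k ≤ binom m′ k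
binom-monoˡ {m} {m′} k m≤m′ with m≤n⇒m<n∨m≡n m≤m′
... | inj₂ refl = ≤-refl
binom-monoˡ {m} {suc m′} k m≤m′ | inj₁ (s≤s lt) = ≤-trans (binom-monoˡ k lt) (*-cancelʳ-≤ _ _ (suc m′)
  (≤-trans (*-monoʳ-≤ (binom m′ k) (≤-trans (s≤s (m≤m+n m′ k)) (≤-reflexive (sym (+-suc m′ k))))) (≤-reflexive (sym (binom-suc m′ k)))))

-- The ratio of C(2k + t + 1, k) to C(2k + t, k) is (2k + t + 1) / (k + t + 1), which is at least
-- 3/2 as long as t < k.
growth : ∀ k t → t ≤ k → 3 ^ t * binom k k ≤ 2 ^ t * binom (k + t) k
growth k zero _ = ≤-reflexive (cong (λ z → 1 * binom z k) (sym (+-identityʳ k)))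
growth k (suc t) t<k rewrite +-suc k t = *-cancelʳ-≤ _ _ (suc (k + t)) (begin
  3 * 3 ^ t * binom k k * suc (k + t)             ≡⟨ ring₁ (3 ^ t) (binom k k) (suc (k + t)) ⟩
  (3 * suc (k + t)) * (3 ^ t * binom k k)         ≤⟨ *-mono-≤ ratio (growth k t (<⇒≤ t<k)) ⟩
  (2 * (k + t + suc k)) * (2 ^ t * binom (k + t) k) ≡⟨ ring₂ (k + t + suc k) (2 ^ t) (binom (k + t) k) ⟩
  2 * 2 ^ t * (binom (k + t) k * (k + t + suc k)) ≡⟨ cong (2 * 2 ^ t *_) (sym (binom-suc (k + t) k)) ⟩
  2 * 2 ^ t * (binom (suc (k + t)) k * suc (k + t)) ≡⟨ sym (*-assoc (2 * 2 ^ t) _ _) ⟩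
  2 * 2 ^ t * binom (suc (k + t)) k * suc (k + t) ∎)
  where
  open ≤-Reasoning
  ring₁ : ∀ a b c → 3 * a * b * c ≡ (3 * c) * (a * b)
  ring₁ = solve-∀
  ring₂ : ∀ a b c → (2 * a) * (b * c) ≡ 2 * b * (c * a)
  ring₂ = solve-∀
  ratio : 3 * suc (k + t) ≤ 2 * (k + t + suc k)
  ratio = begin
    3 * suc (k + t)                     ≡⟨ ring₃ k t ⟩
    2 * suc (k + t) + k + suc t         ≤⟨ +-monoʳ-≤ (2 * suc (k + t) + k) t<k ⟩
    2 * suc (k + t) + k + k             ≡⟨ ring₄ k t ⟩
    2 * (k + t + suc k)                 ∎
    where
    ring₃ : ∀ k t → 3 * suc (k + t) ≡ 2 * suc (k + t) + k + suc t
    ring₃ = solve-∀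
    ring₄ : ∀ k t → 2 * suc (k + t) + k + k ≡ 2 * (k + t + suc k)
    ring₄ = solve-∀

-- Because (3/2)^3 = 27/8 < 32/8 = 4.
27-32 : ∀ u y → u ≤ 3 * y → 3 ^ u ≤ 4 ^ y * 2 ^ u
27-32 u y u≤3y = *-cancelʳ-≤ _ _ (3 ^ z) {{m^n≢0 3 z}} (begin
  3 ^ u * 3 ^ z               ≡⟨ trans (sym (^-distribˡ-+-* 3 u z)) (cong (3 ^_) (m+[n∸m]≡n u≤3y)) ⟩
  3 ^ (3 * y)                 ≡⟨ sym (^-*-assoc 3 3 y) ⟩
  27 ^ y                      ≤⟨ ^-monoˡ-≤ y (<ᵇ-true {26} {32} refl) ⟩
  32 ^ y                      ≡⟨ ^-distribʳ y ⟩
  4 ^ y * 8 ^ y               ≡⟨ cong (4 ^ y *_) (trans (^-*-assoc 2 3 y) (trans (cong (2 ^_) (sym (m+[n∸m]≡n u≤3y))) (^-distribˡ-+-* 2 u z))) ⟩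
  4 ^ y * (2 ^ u * 2 ^ z)     ≤⟨ *-monoʳ-≤ (4 ^ y) (*-monoʳ-≤ (2 ^ u) (^-monoˡ-≤ z (n≤1+n 2))) ⟩
  4 ^ y * (2 ^ u * 3 ^ z)     ≡⟨ sym (*-assoc (4 ^ y) _ _) ⟩
  4 ^ y * 2 ^ u * 3 ^ z       ∎)
  where
  open ≤-Reasoning
  z = 3 * y ∸ u
  ^-distribʳ : ∀ y → 32 ^ y ≡ 4 ^ y * 8 ^ y
  ^-distribʳ zero = refl
  ^-distribʳ (suc y) = trans (cong (32 *_) (^-distribʳ y)) ([m*n]*[o*p]≡[m*o]*[n*p] 4 8 (4 ^ y) (8 ^ y))

-- C(n, k) is at least (3/2)^t 4^k / (2k). If n < 3k, the growth stops at t = n - 2k, but then the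
-- primorial has exponent at most n / 3, and the saving 4^(k - x) makes up for the missing (3/2)^(k
-- - t). The 49th factor n comes from 2k ≤ n.
three-halves : ∀ m k r → 7 ≤ k → k ≤ m → 2 ≤ r → m + k < r * r → Smooth m k → 3 ^ k ≤ 2 ^ k * (m + k) ^ (π r + 49)
three-halves m k r 7≤k k≤m 2≤r n<r² smooth = *-cancelˡ-≤ (4 ^ x) {{m^n≢0 4 x}} (begin
  4 ^ x * 3 ^ k                                ≡⟨ cong (4 ^ x *_) (trans (cong (3 ^_) (sym u+t)) (^-distribˡ-+-* 3 u t)) ⟩
  4 ^ x * (3 ^ u * 3 ^ t)                      ≤⟨ *-monoʳ-≤ (4 ^ x) (*-monoˡ-≤ (3 ^ t) (27-32 u y u≤3y)) ⟩
  4 ^ x * (4 ^ y * 2 ^ u * 3 ^ t)              ≡⟨ ring₁ (4 ^ x) (4 ^ y) (2 ^ u) (3 ^ t) ⟩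
  (4 ^ x * 4 ^ y) * (2 ^ u * 3 ^ t)            ≡⟨ cong (_* (2 ^ u * 3 ^ t)) (trans (sym (^-distribˡ-+-* 4 x y)) (cong (4 ^_) (m+[n∸m]≡n x≤k))) ⟩
  4 ^ k * (2 ^ u * 3 ^ t)                      ≤⟨ *-monoˡ-≤ (2 ^ u * 3 ^ t) (4^k≤ k 0<k) ⟩
  2 * k * binom k k * (2 ^ u * 3 ^ t)          ≡⟨ ring₂ (2 * k) (binom k k) (2 ^ u) (3 ^ t) ⟩
  2 * k * 2 ^ u * (3 ^ t * binom k k)          ≤⟨ *-monoʳ-≤ (2 * k * 2 ^ u) (≤-trans (growth k t (m⊓n≤n (m ∸ k) k)) (*-monoʳ-≤ (2 ^ t) (≤-trans (binom-monoˡ k k+t≤m) (upper m k r 7≤k k≤m 2≤r n<r² smooth)))) ⟩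
  2 * k * 2 ^ u * (2 ^ t * (n ^ π r * (4 ^ x * n ^ 48))) ≤⟨ *-monoˡ-≤ _ (*-monoˡ-≤ (2 ^ u) 2k≤n) ⟩
  n * 2 ^ u * (2 ^ t * (n ^ π r * (4 ^ x * n ^ 48))) ≡⟨ ring₃ n (2 ^ u) (2 ^ t) (n ^ π r) (4 ^ x) (n ^ 48) ⟩
  4 ^ x * (2 ^ u * 2 ^ t * (n ^ π r * (n * n ^ 48))) ≡⟨ cong₂ (λ a b → 4 ^ x * (a * b)) (trans (sym (^-distribˡ-+-* 2 u t)) (cong (2 ^_) u+t)) (sym (^-distribˡ-+-* n (π r) 49)) ⟩
  4 ^ x * (2 ^ k * n ^ (π r + 49))             ∎)
  where
  open ≤-Reasoning
  n = m + k
  x = k ⊓ (n // 3)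
  t = (m ∸ k) ⊓ k
  u = k ∸ t
  y = k ∸ x
  0<k = <-≤-trans (s≤s z≤n) 7≤k
  x≤k : x ≤ k
  x≤k = m⊓n≤m k (n // 3)
  u+t : u + t ≡ k
  u+t = m∸n+n≡m (m⊓n≤n (m ∸ k) k)
  k+t≤m : k + t ≤ m
  k+t≤m = ≤-trans (+-monoʳ-≤ k (m⊓n≤m (m ∸ k) k)) (≤-reflexive (m+[n∸m]≡n k≤m))
  2k≤n : 2 * k ≤ n
  2k≤n = ≤-trans (≤-reflexive (cong (k +_) (+-identityʳ k))) (+-monoˡ-≤ k k≤m)
  3x≤n : 3 * x ≤ n
  3x≤n = ≤-trans (*-monoʳ-≤ 3 (m⊓n≤n k (n // 3))) (≤-trans (m≤m+n (3 * (n // 3)) (n %% 3)) (≤-reflexive (sym (//-%% n 3 (s≤s z≤n)))))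
  u≤3y : u ≤ 3 * y
  u≤3y with ≤-total (m ∸ k) k
  ... | inj₂ k≤ = ≤-trans (≤-reflexive (trans (cong (k ∸_) (m≥n⇒m⊓n≡n k≤)) (n∸n≡0 k))) z≤n
  ... | inj₁ ≤k = ≤-trans (≤-reflexive (cong (k ∸_) (m≤n⇒m⊓n≡m ≤k))) (m≤n+o⇒m∸n≤o k (m ∸ k) (+-cancelʳ-≤ (3 * x) _ _ (begin
    k + 3 * x                    ≤⟨ +-monoʳ-≤ k 3x≤n ⟩
    k + (m + k)                  ≡⟨ cong (λ z → k + (z + k)) (sym (m+[n∸m]≡n k≤m)) ⟩
    k + ((k + (m ∸ k)) + k)      ≡⟨ ring₄ k (m ∸ k) ⟩
    (m ∸ k) + 3 * k              ≡⟨ cong (λ z → (m ∸ k) + 3 * z) (sym (m∸n+n≡m x≤k)) ⟩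
    (m ∸ k) + 3 * (y + x)        ≡⟨ ring₅ (m ∸ k) y x ⟩
    (m ∸ k) + 3 * y + 3 * x      ∎)))
    where
    ring₄ : ∀ k d → k + ((k + d) + k) ≡ d + 3 * k
    ring₄ = solve-∀
    ring₅ : ∀ d y x → d + 3 * (y + x) ≡ d + 3 * y + 3 * x
    ring₅ = solve-∀
  ring₁ : ∀ a b c d → a * (b * c * d) ≡ (a * b) * (c * d)
  ring₁ = solve-∀
  ring₂ : ∀ a b c d → a * b * (c * d) ≡ a * c * (d * b)
  ring₂ = solve-∀
  ring₃ : ∀ n a b c d e → n * a * (b * (c * (d * e))) ≡ d * (a * b * (c * (n * e)))
  ring₃ = solve-∀

-- As n < 4^(e + 1), `three-halves` puts (3/2)^k below 2^h, which contradicts 2h ≤ k because (3/2)^2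
-- > 2. That k is large enough follows from 64^e ≤ n^3 < k^4.
erdős-range : ∀ m k e → 7 ≤ k → k ≤ m → 10 ≤ e → 4 ^ e ≤ m + k → m + k < 4 ^ suc e → π (2 ^ suc e) * 4 ≤ 2 ^ suc e →
  (m + k) ^ 3 < k ^ 4 → Smooth m k → ⊥
erdős-range m k e 7≤k k≤m 10≤e 4^e≤n n<4^ quarter n³<k⁴ smooth = <⇒≱ (begin-strict
  2 ^ k * n ^ Q                   <⟨ *-monoʳ-< (2 ^ k) {{m^n≢0 2 k}} (^-monoˡ-< Q {{>-nonZero (<-≤-trans (s≤s z≤n) (m≤n+m 49 (π r)))}} n<4^) ⟩
  2 ^ k * (4 ^ suc e) ^ Q         ≡⟨ cong (2 ^ k *_) (trans (^-*-assoc 4 (suc e) Q) (trans (^-*-assoc 2 2 (suc e * Q)) refl)) ⟩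
  2 ^ k * 2 ^ h                   ≡⟨ cong (λ z → 2 ^ z * 2 ^ h) (sym k≡) ⟩
  2 ^ (2 * h + z) * 2 ^ h         ≡⟨ cong (_* 2 ^ h) (^-distribˡ-+-* 2 (2 * h) z) ⟩
  2 ^ (2 * h) * 2 ^ z * 2 ^ h     ≡⟨ ring₁ (2 ^ (2 * h)) (2 ^ z) (2 ^ h) ⟩
  2 ^ (2 * h) * 2 ^ h * 2 ^ z     ≡⟨ cong (_* 2 ^ z) (trans (sym (^-distribˡ-+-* 2 (2 * h) h)) (trans (cong (2 ^_) (ring₂ h)) (sym (^-*-assoc 2 3 h)))) ⟩
  8 ^ h * 2 ^ z                   ≤⟨ *-mono-≤ (^-monoˡ-≤ h (n≤1+n 8)) (^-monoˡ-≤ z (n≤1+n 2)) ⟩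
  9 ^ h * 3 ^ z                   ≡⟨ cong (_* 3 ^ z) (^-*-assoc 3 2 h) ⟩
  3 ^ (2 * h) * 3 ^ z             ≡⟨ trans (sym (^-distribˡ-+-* 3 (2 * h) z)) (cong (3 ^_) k≡) ⟩
  3 ^ k                           ∎) (three-halves m k r 7≤k k≤m 2≤r (subst (n <_) 4^≡ n<4^) smooth)
  where
  open ≤-Reasoning
  n = m + k
  r = 2 ^ suc e
  Q = π r + 49
  h = 2 * (suc e * Q)
  z = k ∸ 2 * h
  ring₁ : ∀ a b c → a * b * c ≡ a * c * b
  ring₁ = solve-∀
  ring₂ : ∀ h → 2 * h + h ≡ 3 * h
  ring₂ = solve-∀
  2≤r : 2 ≤ r
  2≤r = ^-monoʳ-≤ 2 (s≤s (z≤n {e}))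
  4^≡ : 4 ^ suc e ≡ r * r
  4^≡ = trans (^-*-assoc 2 2 (suc e)) (trans (cong (2 ^_) (cong (suc e +_) (+-identityʳ (suc e)))) (^-distribˡ-+-* 2 (suc e) (suc e)))
  -- A bound for 2h once π r ≤ r / 4. From e = 10 on it grows by a factor of at most 24/11 per step,
  -- and (24/11)² < 8 keeps its square below 8^e.
  bound : ℕ → ℕ
  bound e = suc e * (2 ^ suc e + 196)
  bound² : ∀ e → 10 ≤ e → bound e * bound e ≤ 8 ^ e
  bound² e 10≤e with m≤n⇒m<n∨m≡n 10≤e
  ... | inj₂ refl = s≤s⁻¹ (<ᵇ-true {bound 10 * bound 10} {suc (8 ^ 10)} refl)
  bound² (suc e) _ | inj₁ (s≤s 10≤e) = *-cancelˡ-≤ 121 (begin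
    121 * (bound (suc e) * bound (suc e))           ≡⟨ ring₃ (bound (suc e)) ⟩
    (11 * bound (suc e)) * (11 * bound (suc e))     ≤⟨ *-mono-≤ ratio ratio ⟩
    (24 * bound e) * (24 * bound e)                 ≡⟨ ring₄ (bound e) ⟩
    576 * (bound e * bound e)                       ≤⟨ *-mono-≤ (<ᵇ-true {575} {968} refl) (bound² e 10≤e) ⟩
    968 * 8 ^ e                                     ≡⟨ *-assoc 121 8 (8 ^ e) ⟩
    121 * (8 * 8 ^ e)                               ∎)
    where
    ring₃ : ∀ b → 121 * (b * b) ≡ (11 * b) * (11 * b)
    ring₃ = solve-∀
    ring₄ : ∀ b → (24 * b) * (24 * b) ≡ 576 * (b * b)
    ring₄ = solve-∀
    ratio : 11 * bound (suc e) ≤ 24 * bound e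
    ratio = begin
      11 * (suc (suc e) * (2 * 2 ^ suc e + 196))     ≡⟨ sym (*-assoc 11 (suc (suc e)) (2 * 2 ^ suc e + 196)) ⟩
      (11 * suc (suc e)) * (2 * 2 ^ suc e + 196)     ≤⟨ *-mono-≤ le₁ (+-monoʳ-≤ (2 * 2 ^ suc e) (<ᵇ-true {195} {392} refl)) ⟩
      (12 * suc e) * (2 * 2 ^ suc e + 392)           ≡⟨ ring₅ (suc e) (2 ^ suc e) ⟩
      24 * (suc e * (2 ^ suc e + 196))               ∎
      where
      ring₅ : ∀ a b → (12 * a) * (2 * b + 392) ≡ 24 * (a * (b + 196))
      ring₅ = solve-∀
      ring₆ : ∀ e → 11 * suc (suc e) ≡ 11 * e + 12 + 10
      ring₆ = solve-∀
      ring₇ : ∀ e → 11 * e + 12 + e ≡ 12 * suc e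
      ring₇ = solve-∀
      le₁ : 11 * suc (suc e) ≤ 12 * suc e
      le₁ = ≤-trans (≤-reflexive (ring₆ e)) (≤-trans (+-monoʳ-≤ (11 * e + 12) 10≤e) (≤-reflexive (ring₇ e)))
  8^e<k² : 8 ^ e < k * k
  8^e<k² = ≰⇒> λ ge → <⇒≱ n³<k⁴ (begin
    k ^ 4             ≡⟨ trans (^-distribˡ-+-* k 2 2) (cong₂ _*_ k²≡ k²≡) ⟩
    (k * k) * (k * k) ≤⟨ *-mono-≤ ge ge ⟩
    8 ^ e * 8 ^ e     ≡⟨ 8⁴ ⟩
    (4 ^ e) ^ 3       ≤⟨ ^-monoˡ-≤ 3 4^e≤n ⟩
    n ^ 3             ∎)
    where
    k²≡ : k ^ 2 ≡ k * k
    k²≡ = cong (k *_) (*-identityʳ k)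
    8⁴ : 8 ^ e * 8 ^ e ≡ (4 ^ e) ^ 3
    8⁴ = trans (sym (^-distribˡ-+-* 8 e e)) (trans (^-*-assoc 2 3 (e + e)) (trans (cong (2 ^_) (ring₈ e)) (sym (trans (^-*-assoc 4 e 3) (^-*-assoc 2 2 (e * 3))))))
      where
      ring₈ : ∀ e → 3 * (e + e) ≡ 2 * (e * 3)
      ring₈ = solve-∀
  bound<k : bound e < k
  bound<k = ≰⇒> λ k≤ → <⇒≱ 8^e<k² (≤-trans (*-mono-≤ k≤ k≤) (bound² e 10≤e))
  2h≤k : 2 * h ≤ k
  2h≤k = ≤-trans (≤-reflexive (ring₉ (suc e) (π r))) (≤-trans (*-monoʳ-≤ (suc e) (+-monoˡ-≤ 196 quarter)) (<⇒≤ bound<k))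
    where
    ring₉ : ∀ a b → 2 * (2 * (a * (b + 49))) ≡ a * (b * 4 + 196)
    ring₉ = solve-∀
  k≡ : 2 * h + z ≡ k
  k≡ = m+[n∸m]≡n 2h≤k

-- Covers by primes and numerical tables

≤ᵇ-true : ∀ {x y} → (x <ᵇ suc y) ≡ true → x ≤ y
≤ᵇ-true {x} {y} eq = s≤s⁻¹ (<ᵇ-true {x} {suc y} eq)

trialᵇ : ℕ → ℕ → ℕ → Bool
trialᵇ zero    d n = false
trialᵇ (suc f) d n = if n <ᵇ d * d then true else (not (n %% d ≡ᵇ 0) ∧ trialᵇ f (suc d) n)

trialᵇ-sound : ∀ f d n → 2 ≤ d → 2 ≤ n → d Rough n → trialᵇ f d n ≡ true → Prime n
trialᵇ-sound (suc f) d n 2≤d 2≤n rough eq with n <ᵇ d * d in sq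
... | true = rough∧square>⇒prime {{n>1⇒nonTrivial 2≤n}} rough (<ᵇ-true {n} {d * d} sq)
... | false with ∧-true {not (n %% d ≡ᵇ 0)} eq
...   | nd , rest = trialᵇ-sound f (suc d) n (m≤n⇒m≤1+n 2≤d) 2≤n
        (∤⇒rough-suc (λ d∣n → ≡ᵇ-false (not-true nd) (∣⇒%%≡0 n (<-≤-trans (s≤s z≤n) 2≤d) d∣n)) rough) rest

isPrimeᵇ : ℕ → Bool
isPrimeᵇ n = (1 <ᵇ n) ∧ trialᵇ n 2 n

isPrimeᵇ-sound : ∀ n → isPrimeᵇ n ≡ true → Prime n
isPrimeᵇ-sound n eq with ∧-true {1 <ᵇ n} eq
... | 1<n , t = trialᵇ-sound n 2 n ≤-refl (<ᵇ-true {1} {n} 1<n) 2-rough t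

module Cover (P : ℕ → Bool) (g end : ℕ) where

  -- Searching downwards takes the farthest point within reach; 0 signals that there is none.
  next : ℕ → ℕ → ℕ
  next m zero    = 0
  next m (suc j) = if P (m + suc j) then suc j else next m j

  -- Starting from the point m, points of P with gaps at most g reach past end.
  coverᵇ : ℕ → ℕ → Bool
  continueᵇ : ℕ → ℕ → ℕ → Bool
  coverᵇ zero    m = false
  coverᵇ (suc f) m = if end <ᵇ m + g then true else continueᵇ f m (next m g)
  continueᵇ f m zero    = false
  continueᵇ f m (suc j) = coverᵇ f (m + suc j)

  next-sound : ∀ m j {i} → next m j ≡ suc i → P (m + suc i) ≡ true × suc i ≤ j
  next-sound m (suc j) eq with P (m + suc j) in Pm | eq
  ... | true  | refl = Pm , ≤-refl
  ... | false | eq′  = let (a , b) = next-sound m j eq′ in a , m≤n⇒m≤1+n b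

  cover-sound : ∀ f m → P m ≡ true → coverᵇ f m ≡ true → ∀ {n} → m ≤ n → n ≤ end → ∃ λ q → P q ≡ true × q ≤ n × n < q + g
  cover-sound (suc f) m Pm eq {n} m≤n n≤end with end <ᵇ m + g in done
  ... | true = m , Pm , m≤n , ≤-<-trans n≤end (<ᵇ-true {end} {m + g} done)
  ... | false with next m g in nx
  ...   | suc j with m + suc j ≤? n
  ...     | yes le = cover-sound f (m + suc j) (proj₁ (next-sound m g nx)) eq le n≤end
  ...     | no ¬le = m , Pm , m≤n , <-≤-trans (≰⇒> ¬le) (+-monoʳ-≤ m (proj₂ (next-sound m g nx)))

tripleᵇ : List ℕ → ℕ → ℕ → Bool
tripleᵇ ps n k = (k <ᵇ 46) ∨ ((n <ᵇ 2 * k) ∨ allBelow 93 (tripleTest ps n k))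

rowᵇ : List ℕ → ℕ → Bool
rowᵇ ps n = allBelow 93 (tripleᵇ ps n)

row-true : ∀ ps n → rowᵇ ps n ≡ true → ∀ {k} → k < 93 → tripleᵇ ps n k ≡ true
row-true ps n = allBelow-true 93 (tripleᵇ ps n)

-- The range is k₀ ≤ k < k₀ + f ≤ 2^b. At k = 46 equality holds, 6 · 46 = 23 · (46 - 34), which is
-- why n ≥ 2^23 is required; from k = 93 on, n ≥ 2^18 suffices.
table₁ : tableᵇ 18 46 (π (46 + 91)) 23 6 ≡ true
table₁ = refl

table₂ : tableᵇ 29 64 (π (64 + 91)) 23 7 ≡ true
table₂ = refl

table₃ : tableᵇ 35 93 (π (93 + 91)) 18 7 ≡ true
table₃ = refl

table₄ : tableᵇ 128 128 (π (128 + 91)) 18 8 ≡ true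
table₄ = refl

table₅ : tableᵇ 256 256 (π (256 + 91)) 18 9 ≡ true
table₅ = refl

table₆ : tableᵇ 512 512 (π (512 + 91)) 18 10 ≡ true
table₆ = refl

table₇ : tableᵇ 1024 1024 (π (1024 + 91)) 18 11 ≡ true
table₇ = refl

table₈ : tableᵇ 2048 2048 (π (2048 + 91)) 18 12 ≡ true
table₈ = refl

quarter₁₀ : (π (2 ^ 11) * 4 <ᵇ suc (2 ^ 11)) ≡ true
quarter₁₀ = refl

quarter-base : (π (4096 + 300) * 4 <ᵇ 4096) ≡ true
quarter-base = refl

n<4^n : ∀ n → n < 4 ^ n
n<4^n zero = s≤s z≤n
n<4^n (suc n) = ≤-<-trans (n<4^n n) (^-monoʳ-< 4 (s≤s (s≤s z≤n)) (n<1+n n))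

log₄ : ∀ n f e → 4 ^ e ≤ n → n < 4 ^ (e + f) → ∃ λ e′ → e ≤ e′ × 4 ^ e′ ≤ n × n < 4 ^ suc e′
log₄ n zero e lo hi = contradiction lo (<⇒≱ (subst (λ z → n < 4 ^ z) (+-identityʳ e) hi))
log₄ n (suc f) e lo hi with 4 ^ suc e ≤? n
... | no ¬le = e , ≤-refl , lo , ≰⇒> ¬le
... | yes le = let (e′ , e≤ , a , b) = log₄ n f (suc e) le (subst (λ z → n < 4 ^ z) (+-suc e f) hi) in e′ , <⇒≤ e≤ , a , b

segment : ∀ k₀ f e b → 0 < b → tableᵇ f k₀ (π (k₀ + 91)) e b ≡ true → k₀ + f ≤ 2 ^ b →
  ∀ {m k} → 0 < k → k₀ ≤ k → k < k₀ + f → 2 ^ e ≤ m + k → Smooth m k → ⊥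
segment k₀ f e b 0<b table k₀+f≤ {m} {k} 0<k k₀≤k k< 2^e≤n smooth =
  pow-contradiction {m + k} {k} {π (k + 91)} {e} {b} 0<k 0<b (<-≤-trans k< k₀+f≤) 2^e≤n
    (tableᵇ-sound f {k₀} e b refl table k k₀≤k k<) (smooth-bound m k 0<k smooth)

π-quarter-2^ : ∀ K → 7 ≤ K → π (K + 300) * 4 < K → ∀ {r} → K ≤ r → π r * 4 ≤ r
π-quarter-2^ K 7≤K base {r} K≤r = <⇒≤ (≤-<-trans (*-monoˡ-≤ 4 (π-mono (m≤m+n r 91))) (π-quarter-from K 7≤K base r K≤r))

-- Two regimes: for n³ ≥ k⁴ every prime may be charged a full factor n, whereas for smaller n the
-- primes above the square root of n must be counted only once.
asymptotic : ∀ K E → 7 ≤ K → 10 ≤ E → K ≡ 2 ^ suc (suc E) → π (K + 300) * 4 < K → π (2 ^ suc E) * 4 ≤ 2 ^ suc E →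
  ∀ m k → K ≤ k → k ≤ m → 4 ^ E ≤ m + k → Smooth m k → ⊥
asymptotic K E 7≤K 10≤E K≡ base baseE m k K≤k k≤m 4^E≤n smooth with k ^ 4 ≤? (m + k) ^ 3
... | yes le = polynomial-range m k (≤-trans (s≤s (s≤s z≤n)) (≤-trans 7≤K K≤k)) (π-quarter-from K 7≤K base k K≤k) smooth le
... | no ¬le with log₄ (m + k) (m + k) E 4^E≤n (<-≤-trans (n<4^n (m + k)) (^-monoʳ-≤ 4 (m≤n+m (m + k) E)))
...   | e , E≤e , lo , hi = erdős-range m k e (≤-trans 7≤K K≤k) k≤m (≤-trans 10≤E E≤e) lo hi (quarter (m≤n⇒m<n∨m≡n E≤e)) (≰⇒> ¬le) smooth
  where
  quarter : E < e ⊎ E ≡ e → π (2 ^ suc e) * 4 ≤ 2 ^ suc e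
  -- For e = E the number 2^(e + 1) is still below K, hence the separate check.
  quarter (inj₂ refl) = baseE
  quarter (inj₁ E<e) = π-quarter-2^ K 7≤K base (subst (_≤ 2 ^ suc e) (sym K≡) (^-monoʳ-≤ 2 (s≤s E<e)))

-- Degrees above 45

module Large (n s k : ℕ) (b : Fin (suc n) → ℤ) (b₀≡1 : ∣ b fzero ∣ ≡ 1) (bₙ≡1 : ∣ b (fromℕ n) ∣ ≡ 1)
  (fact : Factorisation n k (gCoef n s b)) (s≤92 : s ≤ 92) (0<k : 0 < k) (2k≤n : 2 * k ≤ n) where

  open Excluded n s k b b₀≡1 bₙ≡1 fact

  k≤n : k ≤ n
  k≤n = ≤-trans (m≤m+n k (k + 0)) 2k≤n

  m = n ∸ k

  m+k : m + k ≡ n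
  m+k = m∸n+n≡m k≤n

  k≤m : k ≤ m
  k≤m = m+n≤o⇒m≤o∸n k (subst (λ z → k + z ≤ n) (+-identityʳ k) 2k≤n)

  smooth : Smooth m k
  smooth {p} {i} pp le 0<i i≤k p∣ = prime-> pp (≤-trans (s≤s (≤-trans (m≤m+n k 91) ≤-refl)) (subst (_≤ p) (+-suc k 91) le)) l<k (≤-trans (m∸n≤m k i) k≤n) (subst (p ∣_) (sym n∸l) p∣)
    (<-≤-trans (+-mono-≤-< s≤92 l<k) (subst (_≤ p) (+-comm k 92) le))
    where
    l<k : k ∸ i < k
    l<k = ∸-monoʳ-< 0<i i≤k
    n∸l : n ∸ (k ∸ i) ≡ m + i
    n∸l = trans (cong (_∸ (k ∸ i)) (trans (sym m+k) (trans (cong (m +_) (sym (m+[n∸m]≡n i≤k))) (sym (+-assoc m i (k ∸ i)))))) (m+n∸n≡m (m + i) (k ∸ i))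

  near : ∀ {p q g} → Prime p → k < p → p ∣ q → q ≤ n → n < q + g → g ≤ k → s + g ≤ p → ⊥
  near {p} {q} {g} pp k<p p∣q q≤n n<q+g g≤k s+g≤p = prime-> {p} {n ∸ q} pp k<p (<-≤-trans l<g g≤k) (m∸n≤m n q)
    (subst (p ∣_) (sym (m∸[m∸n]≡n q≤n)) p∣q) (<-≤-trans (+-monoʳ-< s l<g) s+g≤p)
    where
    l<g : n ∸ q < g
    l<g = m<n+o⇒m∸n<o n q {g} {{>-nonZero 0<g}} n<q+g
      where
      0<g : 0 < g
      0<g = +-cancelˡ-< q 0 g (subst (_< q + g) (sym (+-identityʳ q)) (≤-<-trans q≤n n<q+g))

  near-prime : ∀ {q g} → Prime q → q ≤ n → n < q + g → g ≤ k → s + g ≤ q → g ≤ q → ⊥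
  near-prime {q} {g} pq q≤n n<q+g g≤k s+g≤q g≤q = near pq k<q ∣-refl q≤n n<q+g g≤k s+g≤q
    where
    -- 2k ≤ n < q + g ≤ 2q.
    k<q : k < q
    k<q = *-cancelˡ-< 2 k q (≤-<-trans 2k≤n (<-≤-trans n<q+g (≤-trans (+-monoʳ-≤ q g≤q) (≤-reflexive (cong (q +_) (sym (+-identityʳ q)))))))

  rough-range : ∀ Q g end f start B → Q ≡ B ! → Cover.coverᵇ (roughᵇ Q) g end f start ≡ true → roughᵇ Q start ≡ true →
    0 < start → k ≤ B → s + g ≤ suc B → g ≤ k → g ≤ start → start ≤ n → n ≤ end → ⊥
  rough-range _ g end f start B refl cov st 0<start k≤B s+g≤ g≤k g≤start start≤n n≤end =
    let (q , rq , q≤n , n<q+g) = Cover.cover-sound (roughᵇ (B !)) g end f start st cov start≤n n≤end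
        0<q = ≢0⇒0< λ q≡0 → <⇒≱ (subst (λ z → n < z + g) q≡0 n<q+g) (≤-trans g≤start start≤n)
        (p , pp , p∣q , B<p) = roughᵇ-sound B q 0<q rq
    in near pp (≤-<-trans k≤B B<p) p∣q q≤n n<q+g g≤k (≤-trans s+g≤ B<p)

  prime-range : ∀ g end f start → Cover.coverᵇ isPrimeᵇ g end f start ≡ true → isPrimeᵇ start ≡ true →
    g ≤ k → s + g + g ≤ start → start ≤ n → n ≤ end → ⊥
  prime-range g end f start cov st g≤k s+g≤ start≤n n≤end =
    let (q , pq , q≤n , n<q+g) = Cover.cover-sound isPrimeᵇ g end f start st cov start≤n n≤end
        -- s + 2g ≤ start ≤ n < q + g.
        s+g≤q = +-cancelʳ-≤ g (s + g) q (≤-trans s+g≤ (≤-trans start≤n (<⇒≤ n<q+g)))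
    in near-prime (isPrimeᵇ-sound q pq) q≤n n<q+g g≤k s+g≤q (≤-trans (m≤n+m g s) s+g≤q)

  module _ (ps : List ℕ) (ps-prime : ∀ {p} → p ∈ ps → Prime p) (small : allBelow 139 (rowᵇ ps) ≡ true) where

    small-range : 46 ≤ k → k ≤ 92 → n < 139 → Conclusion n k s
    small-range 46≤k k≤92 n<139 =
      [ (λ k< → contradiction 46≤k (<⇒≱ (<ᵇ-true {k} {46} k<)))
      , (λ e → [ (λ n< → contradiction 2k≤n (<⇒≱ (<ᵇ-true {n} {2 * k} n<)))
               , (λ t → tripleTest-sound 0<k ps ps-prime (allBelow-true 93 (tripleTest ps n k) t (s≤s s≤92)))
               ]′ (∨-true {n <ᵇ 2 * k} {allBelow 93 (tripleTest ps n k)} e))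
      ]′ (∨-true {k <ᵇ 46} {(n <ᵇ 2 * k) ∨ allBelow 93 (tripleTest ps n k)} (row-true ps n (allBelow-true 139 (rowᵇ ps) small n<139) (s≤s k≤92)))

  s+≤ : ∀ {g t} → 92 + g ≤ t → s + g ≤ t
  s+≤ {g} le = ≤-trans (+-monoˡ-≤ g s≤92) le

  medium-segments : 46 ≤ k → k ≤ 92 → 8388608 ≤ m + k → ⊥
  medium-segments 46≤k k≤92 2^23≤ with k <? 64
  ... | yes k<64 = segment 46 18 23 6 (s≤s z≤n) table₁ ≤-refl 0<k 46≤k k<64 2^23≤ smooth
  ... | no 64≤k = segment 64 29 23 7 (s≤s z≤n) table₂ (≤ᵇ-true {93} {128} refl) 0<k (≮⇒≥ 64≤k) (s≤s k≤92) 2^23≤ smooth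

  -- The hypotheses on covers stay out of reach of `with`, which would evaluate them.
  medium : ∀ Q → Q ≡ 138 ! → roughᵇ Q 139 ≡ true → Cover.coverᵇ (roughᵇ Q) 46 8388608 1000000 139 ≡ true → 46 ≤ k → k ≤ 92 → 139 ≤ n → ⊥
  medium Q Q≡ start cov 46≤k k≤92 139≤n =
    [ rough-range Q 46 8388608 1000000 139 138 Q≡ cov start (s≤s z≤n) (≤-trans k≤92 (≤ᵇ-true {92} {138} refl))
        (s+≤ {46} {139} (≤ᵇ-true {138} {139} refl)) 46≤k (≤ᵇ-true {46} {139} refl) 139≤n
    , (λ gt → medium-segments 46≤k k≤92 (subst (8388608 ≤_) (sym m+k) (<⇒≤ gt)))
    ]′ (≤-<-connex n 8388608)

  middle-segments : 93 ≤ k → k < 4096 → 262144 ≤ m + k → ⊥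
  middle-segments 93≤k k<4096 2^18≤ with k <? 128 | k <? 256 | k <? 512 | k <? 1024 | k <? 2048
  ... | yes lt | _ | _ | _ | _ = segment 93 35 18 7 (s≤s z≤n) table₃ ≤-refl 0<k 93≤k lt 2^18≤ smooth
  ... | no ge | yes lt | _ | _ | _ = segment 128 128 18 8 (s≤s z≤n) table₄ ≤-refl 0<k (≮⇒≥ ge) lt 2^18≤ smooth
  ... | no _ | no ge | yes lt | _ | _ = segment 256 256 18 9 (s≤s z≤n) table₅ ≤-refl 0<k (≮⇒≥ ge) lt 2^18≤ smooth
  ... | no _ | no _ | no ge | yes lt | _ = segment 512 512 18 10 (s≤s z≤n) table₆ ≤-refl 0<k (≮⇒≥ ge) lt 2^18≤ smooth
  ... | no _ | no _ | no _ | no ge | yes lt = segment 1024 1024 18 11 (s≤s z≤n) table₇ ≤-refl 0<k (≮⇒≥ ge) lt 2^18≤ smooth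
  ... | no _ | no _ | no _ | no _ | no ge = segment 2048 2048 18 12 (s≤s z≤n) table₈ ≤-refl 0<k (≮⇒≥ ge) k<4096 2^18≤ smooth

  large : Cover.coverᵇ isPrimeᵇ 12 283 1000 181 ≡ true → Cover.coverᵇ isPrimeᵇ 93 262144 10000 283 ≡ true →
    Cover.coverᵇ isPrimeᵇ 4096 1048576 1000 8287 ≡ true → 93 ≤ k → ⊥
  large cov₁ cov₂ cov₃ 93≤k =
    -- A gap of 93 requires a start of at least 92 + 2 · 93 = 278, but n may be as small as 186; so
    -- the range up to 283 is covered with gaps of at most 12.
    [ prime-range 12 283 1000 181 cov₁ refl (≤-trans (≤ᵇ-true {12} {93} refl) 93≤k)
        (≤-trans (+-monoˡ-≤ 12 (s+≤ {12} {104} ≤-refl)) (≤ᵇ-true {116} {181} refl)) (≤-trans (≤ᵇ-true {181} {186} refl) (≤-trans (*-monoʳ-≤ 2 93≤k) 2k≤n))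
    , (λ 283<n → [ prime-range 93 262144 10000 283 cov₂ refl 93≤k
                     (≤-trans (+-monoˡ-≤ 93 (s+≤ {93} {185} ≤-refl)) (≤ᵇ-true {278} {283} refl)) (<⇒≤ 283<n)
                 -- For k ≥ 4096 a cover with wide gaps raises the bound from 2^18 to 4^10, where
                 -- `asymptotic` takes over with E = 10.
                 , (λ 2^18<n → [ (λ 4096≤k → [ prime-range 4096 1048576 1000 8287 cov₃ refl 4096≤k
                                                 (≤-trans (+-monoˡ-≤ 4096 (s+≤ {4096} {4188} ≤-refl)) (≤ᵇ-true {8284} {8287} refl)) (≤-trans (≤ᵇ-true {8287} {262144} refl) (<⇒≤ 2^18<n))
                                             , (λ 2^20<n → beyond 4096≤k (subst (1048576 ≤_) (sym m+k) (<⇒≤ 2^20<n))) ]′ (≤-<-connex n 1048576))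
                               , (λ k<4096 → middle-segments 93≤k k<4096 (subst (262144 ≤_) (sym m+k) (<⇒≤ 2^18<n))) ]′ (≤-<-connex 4096 k))
                 ]′ (≤-<-connex n 262144))
    ]′ (≤-<-connex n 283)
    where
    beyond : 4096 ≤ k → 1048576 ≤ m + k → ⊥
    beyond 4096≤k 2^20≤ = asymptotic 4096 10 (≤ᵇ-true {7} {4096} refl) ≤-refl refl (<ᵇ-true {π (4096 + 300) * 4} {4096} quarter-base)
      (s≤s⁻¹ (<ᵇ-true {π (2 ^ 11) * 4} {suc (2 ^ 11)} quarter₁₀)) m k 4096≤k k≤m 2^20≤ smooth

-- The triple (10 , 5 , 5): 3-adically, either 3 ∤ b₁ and the slopes are 1, 4/9, …, 4/9,
-- or 3 ∣ b₁ and every slope is 1/2; neither polygon admits a piece of width 5.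
module Exceptional (b : Fin 11 → ℤ) (b₀≡1 : ∣ b fzero ∣ ≡ 1) (b₁₀≡1 : ∣ b (fromℕ 10) ∣ ≡ 1)
  (fact : Factorisation 10 5 (gCoef 10 5 b)) where

  open Criteria 10 5 5 b b₀≡1 b₁₀≡1 fact using (g; ∣g; ∣g₀∣; ∣gₙ∣)

  v₃ : ℕ → ℕ
  v₃ 0 = 5
  v₃ 1 = 4
  v₃ 2 = 6
  v₃ 3 = 5
  v₃ 4 = 4
  v₃ 5 = 5
  v₃ 6 = 4
  v₃ 7 = 2
  v₃ 8 = 3
  v₃ 9 = 1
  v₃ _ = 0

  v₃-∣ : ∀ m → m ≤ 10 → 3 ^ v₃ m ∣ ∣ g m ∣
  v₃-∣ m m≤10 = ∣g m (%%≡0⇒∣ (cCoef 10 5 m) (m^n>0 3 (v₃ m))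
    (≡ᵇ-true (allBelow-true 11 (λ m → cCoef 10 5 m %% 3 ^ v₃ m ≡ᵇ 0) refl (s≤s m≤10))))

  3∤g₁₀ : ¬ 3 ∣ ∣ g 10 ∣
  3∤g₁₀ d∣ = p∤1 prime[3] (subst (3 ∣_) ∣gₙ∣ d∣)

  right : ∀ m → m ≤ 10 → 0 < 10 ∸ m → ∃ λ v → 3 ^ v ∣ ∣ g m ∣ × 2 * 10 < 5 * v + 2 * m
  right m m≤10 0< = v₃ m , v₃-∣ m m≤10 , <ᵇ-true {20} (allBelow-true 10 (λ m → 20 <ᵇ 5 * v₃ m + 2 * m) refl m<10)
    where
    m<10 : m < 10
    m<10 = ≤∧≢⇒< m≤10 λ { refl → <-irrefl refl 0< }

  3∤b₁ : 3 ∤ ∣ extend b 1 ∣ → ⊥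
  -- Strictly between 2/5 and 1/2 the least denominator is that of 3/7.
  3∤b₁ 3∤ = noFactor prime[3] fact 4 2 1 1 0 1 1 4 (s≤s (s≤s z≤n)) 3∤g₁₀ right 3^5∤ left
    (λ d u d≤5 _ → gapᵇ-sound 5 2 1 1 5 refl d u d≤5)
    where
    c₁ : 3 ^ 4 ∥ cCoef 10 5 1
    c₁ = exactly 89689600 refl λ d∣ → contradiction (∣⇒%%≡0 89689600 {3} (s≤s z≤n) d∣) λ ()
    3^5∤ : ¬ 3 ^ 5 ∣ ∣ g 1 ∣
    3^5∤ d∣ = <-irrefl refl (∥⇒≤ prime[3] {4} {∣ g 1 ∣} {5} (subst (3 ^ 4 ∥_) (sym (ℤ.abs-* (extend b 1) (ℤ.+ cCoef 10 5 1))) (∥-* prime[3] (∤⇒∥ prime[3] 3∤) c₁)) d∣)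
    left : ∀ m → m ≤ 10 → 1 < m → ∃ λ v → 3 ^ v ∣ ∣ g m ∣ × 2 * 4 + 1 * 1 < 2 * v + 1 * m
    left m m≤10 1<m = v₃ m , v₃-∣ m m≤10 ,
      [ (λ m<2 → contradiction 1<m (<⇒≱ (<ᵇ-true {m} {2} m<2))) , <ᵇ-true {9} ]′
        (∨-true {m <ᵇ 2} (allBelow-true 11 (λ m → (m <ᵇ 2) ∨ (9 <ᵇ 2 * v₃ m + 1 * m)) refl (s≤s m≤10)))

  3∣b₁ : 3 ∣ ∣ extend b 1 ∣ → ⊥
  -- The slopes 2/5 and 3/5 enclose 1/2, so the width matters: l = l′ = 0 forces d = 5, and no
  -- integer lies strictly between 2 and 3.
  3∣b₁ 3∣ = noFactor prime[3] fact 4 2 4 3 0 0 0 5 (s≤s z≤n) 3∤g₁₀ right 3^6∤ left gap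
    where
    c₀ : 3 ^ 5 ∥ binom 10 5 * 10 !
    c₀ = exactly 44844800 refl λ d∣ → contradiction (∣⇒%%≡0 44844800 {3} (s≤s z≤n) d∣) λ ()
    3^6∤ : ¬ 3 ^ 6 ∣ ∣ g 0 ∣
    3^6∤ d∣ = <-irrefl refl (∥⇒≤ prime[3] {5} {∣ g 0 ∣} {6} (subst (3 ^ 5 ∥_) (sym ∣g₀∣) c₀) d∣)
    left : ∀ m → m ≤ 10 → 0 < m → ∃ λ v → 3 ^ v ∣ ∣ g m ∣ × 5 * 5 + 3 * 0 < 5 * v + 3 * m
    left (suc zero) _ _ = 5 , subst (3 ^ 5 ∣_) (sym (ℤ.abs-* (extend b 1) (ℤ.+ cCoef 10 5 1)))
      (*-pres-∣ 3∣ (%%≡0⇒∣ (cCoef 10 5 1) {81} (s≤s z≤n) refl)) , <ᵇ-true {25} {28} refl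
    left m@(suc (suc m-2)) m≤10 _ = v₃ m , v₃-∣ m m≤10 ,
      <ᵇ-true {25} (allBelow-true 9 (λ i → 25 <ᵇ 5 * v₃ (suc (suc i)) + 3 * suc (suc i)) refl {m-2} (s≤s⁻¹ m≤10))
    gap : ∀ d u → d ≤ 5 → 5 ≤ d + 0 → 2 * d < 5 * u → 5 * u < 3 * d → ⊥
    gap d u d≤5 5≤d lt lt′ with ≤-antisym d≤5 (subst (5 ≤_) (+-identityʳ d) 5≤d)
    ... | refl = <⇒≱ (*-cancelˡ-< 5 u 3 lt′) (*-cancelˡ-< 5 2 u lt)

  impossible : ⊥
  impossible with 3 ∣? ∣ extend b 1 ∣
  ... | yes d = 3∣b₁ d
  ... | no ¬d = 3∤b₁ ¬d

-- Assembly of the ranges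

module Assemble (n s k : ℕ) (b : Fin (suc n) → ℤ) (b₀≡1 : ∣ b fzero ∣ ≡ 1) (bₙ≡1 : ∣ b (fromℕ n) ∣ ≡ 1)
  (fact : Factorisation n k (gCoef n s b)) (s≤92 : s ≤ 92) (2≤k : 2 ≤ k) (2k≤n : 2 * k ≤ n) where

  0<k : 0 < k
  0<k = <⇒≤ 2≤k

  0<n : 0 < n
  0<n = ≤-trans 0<k (≤-trans (m≤m+n k (k + 0)) 2k≤n)

  open Excluded n s k b b₀≡1 bₙ≡1 fact

  searched-range : ∀ ps qs → (∀ {p} → p ∈ ps → Prime p) → (∀ {p} → p ∈ qs → Prime p) → (∀ {p} → Prime p → p ≤ 92 → p ∈ qs) →
    ∀ kmin kmax Q B → Q ≡ B ! → 10 ≤ kmax → kmax ≤ 92 → kmax ≤ B → 92 + kmin ≤ suc B →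
    searchᵇ (checkᵇ ps kmin kmax Q) kmax qs ≡ true → kmin ≤ k → k ≤ kmax → Conclusion n k s
  searched-range ps qs ps-prime qs-prime qs-all kmin kmax _ B refl 10≤ ≤92 ≤B B≥ found kmin≤k k≤kmax =
    checkᵇ-sound 0<k ps ps-prime kmin kmax B kmin≤k k≤kmax ≤B (≤-trans (+-monoˡ-≤ kmin s≤92) B≥) (s≤s s≤92) 2k≤n
      (searched n s k b b₀≡1 bₙ≡1 fact 0<n 0<k s≤92 (checkᵇ ps kmin kmax (B !)) kmax 10≤ ≤92 k≤kmax qs qs-prime qs-all found)

only-exceptions : ∀ n s k (b : Fin (suc n) → ℤ) → ∣ b fzero ∣ ≡ 1 → ∣ b (fromℕ n) ∣ ≡ 1 → Factorisation n k (gCoef n s b) →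
  Conclusion n k s → (n , k , s) ∈ exceptions
only-exceptions n s k b b₀≡1 bₙ≡1 fact (here refl) = ⊥-elim (Exceptional.impossible b b₀≡1 bₙ≡1 fact)
only-exceptions n s k b b₀≡1 bₙ≡1 fact (there e) = e

-- 93 = 92 + 1 and 102 = 92 + 10 are the largest s + l with l < kmin, for kmin = 2 and 11. With gaps
-- of at most 46 one has s + l ≤ 137, and the primes above 137 are those above 138.
Q₉₃ Q₁₀₂ Q₁₃₈ : ℕ
Q₉₃ = 1156772507081641574759205162306240436214753229576413535186142281213246807121467315215203289516844845303838996289387078090752000000000000000000000
Q₁₀₂ = 961446671503512660926865558697259548455355905059659464369444714048531715130254590603314961882364451384985595980362059157503710042865532928000000000000000000000000
Q₁₃₈ = 691778647261948849222819828311491035886734385827028118707676848307166514238979223884785249055995983385450621636277440066920043595627074569065446040152660143904127838730788278294186615891819670506731208704000000000000000000000000000000000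

Q₉₃≡93! : Q₉₃ ≡ 93 !
Q₉₃≡93! = refl

Q₁₀₂≡102! : Q₁₀₂ ≡ 102 !
Q₁₀₂≡102! = refl

Q₁₃₈≡138! : Q₁₃₈ ≡ 138 !
Q₁₃₈≡138! = refl

smallSearch : searchᵇ (checkᵇ (primesUpTo 137) 2 10 Q₉₃) 10 (primesUpTo 92) ≡ true
smallSearch = refl

largeSearch : searchᵇ (checkᵇ (primesUpTo 137) 11 45 Q₁₀₂) 45 (primesUpTo 92) ≡ true
largeSearch = refl

smallCheck : allBelow 139 (rowᵇ (primesUpTo 137)) ≡ true
smallCheck = refl

roughStart : roughᵇ Q₁₃₈ 139 ≡ true
roughStart = refl

roughCover : Cover.coverᵇ (roughᵇ Q₁₃₈) 46 8388608 1000000 139 ≡ true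
roughCover = refl

primeCover₁ : Cover.coverᵇ isPrimeᵇ 12 283 1000 181 ≡ true
primeCover₁ = refl

primeCover₂ : Cover.coverᵇ isPrimeᵇ 93 262144 10000 283 ≡ true
primeCover₂ = refl

primeCover₃ : Cover.coverᵇ isPrimeᵇ 4096 1048576 1000 8287 ≡ true
primeCover₃ = refl

open import Data.Fin using (zero)

theorem1p4 : (n s : ℕ) → 1 ≤ n → (b : Fin (suc n) → ℤ) →
    ∣ b zero ∣ ≡ 1 → ∣ b (fromℕ n) ∣ ≡ 1 →
    (k : ℕ) → 2 ≤ k → 2 * k ≤ n →
    HasFactorOfDegree (G n s b) k →
    92 < s ⊎ (n , k , s) ∈ exceptions
theorem1p4 n s 1≤n b b₀≡1 bₙ≡1 k 2≤k 2k≤n factor = [ (λ s≤92 → inj₂ (only-exceptions n s k b b₀≡1 bₙ≡1 fact (conclusion s≤92))) , inj₁ ]′ (≤-<-connex s 92)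
  where
  fact : Factorisation n k (gCoef n s b)
  fact = factorisation n s b k bₙ≡1 factor

  0<k : 0 < k
  0<k = <⇒≤ 2≤k

  conclusion : s ≤ 92 → Conclusion n k s
  conclusion s≤92 =
    [ A.searched-range (primesUpTo 137) (primesUpTo 92) (primesUpTo-prime {137}) (primesUpTo-prime {92}) ∈-primesUpTo
        2 10 Q₉₃ 93 Q₉₃≡93! (≤ᵇ-true {10} {10} refl) (≤ᵇ-true {10} {92} refl) (≤ᵇ-true {10} {93} refl) (≤ᵇ-true {94} {94} refl) smallSearch 2≤k
    , (λ 10<k →
    [ A.searched-range (primesUpTo 137) (primesUpTo 92) (primesUpTo-prime {137}) (primesUpTo-prime {92}) ∈-primesUpTo
        11 45 Q₁₀₂ 102 Q₁₀₂≡102! (≤ᵇ-true {10} {45} refl) (≤ᵇ-true {45} {92} refl) (≤ᵇ-true {45} {102} refl) (≤ᵇ-true {103} {103} refl) largeSearch 10<k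
    , (λ 45<k →
    [ (λ k≤92 →
      [ (λ n≥139 → ⊥-elim (L.medium Q₁₃₈ Q₁₃₈≡138! roughStart roughCover 45<k k≤92 n≥139))
      , L.small-range (primesUpTo 137) (primesUpTo-prime {137}) smallCheck 45<k k≤92
      ]′ (≤-<-connex 139 n))
    , (λ 92<k → ⊥-elim (L.large primeCover₁ primeCover₂ primeCover₃ 92<k))
    ]′ (≤-<-connex k 92)) ]′ (≤-<-connex k 45)) ]′ (≤-<-connex k 10)
    where
    module A = Assemble n s k b b₀≡1 bₙ≡1 fact s≤92 2≤k 2k≤n
    module L = Large n s k b b₀≡1 bₙ≡1 fact s≤92 0<k 2k≤n
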